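{- Let $q$ be an odd prime power, $n>1$, and let $\ell$ be a nonzero $q$-linear polynomial over $\mathbb F_{q^n}$ of degree less than $q^n$. Let $L=\frac{\ell+\ell'}2$ (with $'$ as defined in the context), and suppose $\dim_{\mathbb F_q}\operatorname{im}L=r$ for some integer $0<r\le n$. Let $\epsilon$ be the invariant of the quadratic form $\mathrm{Tr}(x\ell(x))$ and $\eta$ the quadratic character of $\mathbb F_q^*$. If $r=n$, then $\det M_L\in\mathbb F_q$ and $\epsilon=(-1)^{n-1}\eta(\det M_L)$. If $r<n$, then $\det M_L^{(r)}\neq0$, and: (1) $\big(\det M_L^{(r)}\big)^{q+1}=\big(\det M_L^{(r,1)}\big)^2$, where $M_L^{(r,1)}$ is the $r\times r$ submatrix of $M_L$ formed by rows $2,3,\dots,r+1$ and columns $1,\dots,r$; moreover $\epsilon=1$ if and only if $\big(\det M_L^{(r)}\big)^{\frac{q+1}2}=\det M_L^{(r,1)}$; (2) when $n$ is odd, $\epsilon=1$ if and only if $\det M_L^{(r)}$ is a square in $\mathbb F_{q^n}$; (3) when $r=n-2m$ and $\ell$ has degree $q^m$ with leading coefficient $a$, one has $a^{2q^r\frac{q^m-1}{q-1}}\det M_L^{(r)}\in\mathbb F_q$ and $\epsilon=(-1)^{n-1}\eta\Big(a^{2q^r\frac{q^m-1}{q-1}}\det M_L^{(r)}\Big)$.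
   Context: $\mathrm{Tr}$ denotes the trace map $\mathrm{Tr}(x)=\sum_{i=0}^{n-1}x^{q^i}$ of $\mathbb F_{q^n}/\mathbb F_q$. A $q$-linear polynomial is one of the form $\sum_i a_ix^{q^i}$; it is viewed as an $\mathbb F_q$-linear endomorphism of $\mathbb F_{q^n}$. For $L(x)=\sum_{i=0}^{n-1}a_ix^{q^i}$ with $a_i\in\mathbb F_{q^n}$, define $L'(x)=a_0x+\sum_{i=1}^{n-1}(a_ix)^{q^{n-i}}$, and let $M_L$ be the $n\times n$ matrix whose $(i,j)$ entry is $a_{(j-i)\bmod n}^{q^{i-1}}$ (first row $a_0,a_1,\dots,a_{n-1}$; second row $a_{n-1}^q,a_0^q,\dots,a_{n-2}^q$; etc.). For a matrix $M$ and positive integer $k$, $M^{(k)}$ denotes the submatrix formed by its first $k$ rows and first $k$ columns. The map $x\mapsto\mathrm{Tr}(x\ell(x))$ is a quadratic form on the $\mathbb F_q$-vector space $\mathbb F_{q^n}$; in suitable $\mathbb F_q$-coordinates $w_1,\dots,w_n$ it becomes $d_1w_1^2+\dots+d_rw_r^2$ with $d_1,\dots,d_r\in\mathbb F_q^*$; the integer $r$ (rank) and $\epsilon=\eta(d_1\cdots d_r)$ do not depend on the choice of coordinates, and $\epsilon$ is called the invariant of the quadratic form. -}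

module Defs where

open import Level using (0ℓ)
open import Algebra.Bundles using (CommutativeRing)
open import Data.Nat as ℕ using (ℕ; zero; suc; _<ᵇ_; _≤ᵇ_)
open import Data.Nat.Primality using (Prime)
open import Data.Bool using (if_then_else_)
open import Data.List using (List; length)
open import Data.List.Relation.Unary.Any using (Any)
open import Data.List.Relation.Unary.AllPairs using (AllPairs)
open import Data.Product using (Σ; ∃; ∃₂; _×_; _,_)
open import Relation.Nullary using (¬_)
open import Relation.Binary.PropositionalEquality using (_≡_)

IsPrimePower : ℕ → Set
IsPrimePower q = ∃₂ λ p k → Prime p × (0 ℕ.< k) × (q ≡ p ℕ.^ k)

-- geom q m = 1 + q + ... + q^{m-1} = (q^m - 1)/(q - 1)
geom : ℕ → ℕ → ℕ
geom q zero    = 0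
geom q (suc m) = geom q m ℕ.+ q ℕ.^ m

record FiniteField : Set₁ where
  field
    commRing : CommutativeRing 0ℓ 0ℓ
  open CommutativeRing commRing public
  field
    nontrivial : ¬ (1# ≈ 0#)
    _⁻¹        : Carrier → Carrier
    inverse    : ∀ x → ¬ (x ≈ 0#) → (x * (x ⁻¹)) ≈ 1#
    elements   : List Carrier
    complete   : ∀ x → Any (x ≈_) elements
    distinct   : AllPairs (λ x y → ¬ (x ≈ y)) elements

  size : ℕ
  size = length elements

module Setup (F : FiniteField) (q n : ℕ) (a : ℕ → FiniteField.Carrier F) where
  open FiniteField F

  pow : Carrier → ℕ → Carrier
  pow x zero    = 1#
  pow x (suc k) = x * pow x k

  sumTo : ℕ → (ℕ → Carrier) → Carrier
  sumTo zero    f = 0#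
  sumTo (suc k) f = sumTo k f + f k

  prodTo : ℕ → (ℕ → Carrier) → Carrier
  prodTo zero    f = 1#
  prodTo (suc k) f = prodTo k f * f k

  InFq : Carrier → Set
  InFq x = pow x q ≈ x

  -- quadratic character of F_q^* : η(x) = x^((q-1)/2)  (value 1# or - 1#)
  η : Carrier → Carrier
  η x = pow x ((q ℕ.∸ 1) ℕ./ 2)

  IsSquare : Carrier → Set
  IsSquare x = ∃ λ y → (y * y) ≈ x

  Tr : Carrier → Carrier
  Tr x = sumTo n (λ i → pow x (q ℕ.^ i))

  qlin : (ℕ → Carrier) → Carrier → Carrier
  qlin c x = sumTo n (λ i → c i * pow x (q ℕ.^ i))

  ℓ : Carrier → Carrier
  ℓ = qlin a

  ℓ′ : Carrier → Carrier
  ℓ′ x = a 0 * x + sumTo n (λ i → if i ℕ.≡ᵇ 0 then 0# else pow (a i * x) (q ℕ.^ (n ℕ.∸ i)))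

  half : Carrier
  half = (1# + 1#) ⁻¹

  -- coefficients of ℓ' as a q-linear polynomial:
  --   (a_i x)^{q^{n-i}} = a_i^{q^{n-i}} x^{q^{n-i}}, so the coefficient of x^{q^j}
  --   (1 ≤ j ≤ n-1) is a_{n-j}^{q^j}; the coefficient of x is a_0.
  ℓ′coeff : ℕ → Carrier
  ℓ′coeff zero    = a 0
  ℓ′coeff (suc j) = pow (a (n ℕ.∸ suc j)) (q ℕ.^ suc j)

  Lcoeff : ℕ → Carrier
  Lcoeff j = half * (a j + ℓ′coeff j)

  L : Carrier → Carrier
  L = qlin Lcoeff

  -- (j - i) mod n for 0 ≤ i, j < n
  cyc : ℕ → ℕ → ℕ
  cyc i j = if i ℕ.≤ᵇ j then j ℕ.∸ i else (n ℕ.+ j) ℕ.∸ i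

  -- matrices as functions ℕ → ℕ → Carrier (0-indexed); the matrix M_c
  -- with (i,j) entry c_{(j-i) mod n}^{q^i}  (i,j = 0..n-1)
  Mat : (ℕ → Carrier) → ℕ → ℕ → Carrier
  Mat c i j = pow (c (cyc i j)) (q ℕ.^ i)

  M_L : ℕ → ℕ → Carrier
  M_L = Mat Lcoeff

  minor : ℕ → (ℕ → ℕ → Carrier) → ℕ → ℕ → Carrier
  minor j M i c = M (suc i) (if c ℕ.<ᵇ j then c else suc c)

  -- det k M = determinant of the top-left k×k block of M (Laplace expansion
  -- along the first row)
  det : ℕ → (ℕ → ℕ → Carrier) → Carrier
  det zero    M = 1#
  det (suc k) M = sumTo (suc k) (λ j → pow (- 1#) j * (M 0 j * det k (minor j M)))

  -- rows 2..k+1, columns 1..k (1-indexed) of M, i.e. drop the first row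
  dropRow : (ℕ → ℕ → Carrier) → ℕ → ℕ → Carrier
  dropRow M i j = M (suc i) j

  FqIndependent : ℕ → (ℕ → Carrier) → Set
  FqIndependent k v = (c : ℕ → Carrier) → (∀ i → i ℕ.< k → InFq (c i)) →
    sumTo k (λ i → c i * v i) ≈ 0# → ∀ i → i ℕ.< k → c i ≈ 0#

  InFqSpan : ℕ → (ℕ → Carrier) → Carrier → Set
  InFqSpan k v x = ∃ λ (c : ℕ → Carrier) → (∀ i → i ℕ.< k → InFq (c i)) ×
    (x ≈ sumTo k (λ i → c i * v i))

  DimImL : ℕ → Set
  DimImL r = ∃ λ (v : ℕ → Carrier) →
    (∀ i → i ℕ.< r → ∃ λ x → L x ≈ v i) × FqIndependent r v ×
    (∀ x → InFqSpan r v (L x))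

  Q : Carrier → Carrier
  Q x = Tr (x * ℓ x)

  IsInvariant : Carrier → Set
  IsInvariant ε = ∃ λ (e : ℕ → Carrier) → FqIndependent n e ×
    (∀ x → InFqSpan n e x) ×
    ∃ λ k → (k ℕ.≤ n) × ∃ λ (d : ℕ → Carrier) →
      (∀ i → i ℕ.< k → InFq (d i) × ¬ (d i ≈ 0#)) ×
      ((w : ℕ → Carrier) → (∀ i → i ℕ.< n → InFq (w i)) →
        Q (sumTo n (λ i → w i * e i)) ≈ sumTo k (λ i → d i * (w i * w i))) ×
      (ε ≈ η (prodTo k d))

{-# OPTIONS --safe #-}
-- Let e diagonalise the form, with diagonal entries d_1, …, d_k, and let f be the basis dual to e
-- for the trace form.  Then L(x) = Σ d_l f_l Tr(f_l x), so k = r and the (s,t) entry of M_L is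
-- Σ d_l f_l^(q^s) f_l^(q^t).  Hence r consecutive rows and columns starting at α and β have minor
-- P δ^(q^α) δ^(q^β), where P = d_1 ⋯ d_r and δ is the Moore determinant of f_1, …, f_r, which is
-- nonzero because the f_l are independent over F_q.  Every assertion follows from such minors:
-- for r = n, rotating the columns of the Moore matrix gives δ^q = (-1)^(n-1) δ; for r = n - 2m and
-- deg ℓ = q^m, the minors at (0,m) and (0,m+1) are triangular up to a cyclic shift, and comparing
-- them determines δ^(q-1).

module Submission where

open import Defs
open import Level using (0ℓ)
open import Data.Nat as ℕ using (ℕ; zero; suc; z≤n; s≤s; _<ᵇ_; _≡ᵇ_; _!)
open import Data.Product using (∃; _×_; _,_; proj₁; proj₂)
open import Relation.Nullary using (¬_; Dec; yes; no; does)
open import Relation.Binary.PropositionalEquality as ≡ using (_≡_; _≢_)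
open import Function using (_∘_)
open import Algebra.Bundles using (CommutativeMonoid)
open import Data.Bool as Bool using (Bool; true; false; if_then_else_)
import Data.Bool.Properties as Boolₚ
open import Data.Empty using (⊥-elim)
open import Data.Fin as Fin using (Fin; zero; suc; toℕ; inject₁; fromℕ)
import Data.Fin.Properties as Finₚ
open import Data.Fin.Permutation using (Permutation; permutation; _⟨$⟩ʳ_)
open import Data.List using (lookup)
open import Data.List.Membership.Propositional.Properties using (∈-lookup)
open import Data.List.Relation.Unary.All as All using ()
open import Data.List.Relation.Unary.AllPairs using (AllPairs; []; _∷_)
open import Data.List.Relation.Unary.Any as Any using ()
open import Data.List.Relation.Unary.Any.Properties using (lookup-index)
open import Data.Nat.Combinatorics using (_C_; nCn≡1; nCk≡nC[n∸k]; nCk≡n!/k![n-k]!; k![n∸k]!∣n!)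
open import Data.Nat.Divisibility using (_∣_; divides; ∣⇒≤; m∣m*n; ∣1⇒≡1)
open import Data.Nat.DivMod using (m/n*n≡m; m≡m%n+[m/n]*n; m*n/n≡m)
open import Data.Nat.Primality using (Prime; euclidsLemma; prime⇒nonTrivial; prime⇒nonZero)
import Data.Nat.Properties as ℕₚ
open import Data.Nat.Solver using (module +-*-Solver)
open import Data.Sum using (_⊎_; inj₁; inj₂; [_,_]′)
open import Data.Unit using (⊤; tt)
open import Data.Vec as Vec using (Vec; []; _∷_)
open import Relation.Nullary.Decidable as Dec using ()

-- The character `η` is the power (q-1)/2, so η(x u²) = η(x) u^(q-1) for every nonzero u, inside F_q
-- or not. With det M_L^(r) = P δ² and ε = η(P), the whole question is the value of δ^(q-1), which
-- nothing forces to be 1: in the full-rank case the sign (-1)^(n-1) is exactly this value. Part (1)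
-- avoids computing it, because δ^q δ is visible in the minor with the first row dropped. Part (2)
-- avoids it through a square root of P, on which Frobenius acts as multiplication by η(P). In part
-- (3) it is a sign times a power of a, and the exponent q^r (q^m-1)/(q-1) is the one for which
-- multiplying δ by that power of a leaves only the sign. The other obstacle is that `det` is a bare
-- Laplace recursion. Its multiplicativity, on which the minors rest, comes from the theory of
-- alternating forms.

-- Finite sums, and determinants by way of alternating multilinear forms

module Determinants (F : FiniteField) (q n : ℕ) (a : ℕ → FiniteField.Carrier F) where
  open FiniteField F hiding (zero)
  open Setup F q n a
  open import Relation.Binary.Reasoning.Setoid setoid
  open import Algebra.Properties.Ring ring
  open import Algebra.Solver.Ring.NaturalCoefficients.Default commutativeSemiring
    using (solve; _:=_; _:+_; _:*_)

  pow-cong : ∀ {x y} k → x ≈ y → pow x k ≈ pow y k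
  pow-cong zero    x≈y = refl
  pow-cong (suc k) x≈y = *-cong x≈y (pow-cong k x≈y)

  pow-+ : ∀ x j k → pow x (j ℕ.+ k) ≈ pow x j * pow x k
  pow-+ x zero    k = sym (*-identityˡ _)
  pow-+ x (suc j) k = trans (*-congˡ (pow-+ x j k)) (sym (*-assoc _ _ _))

  pow-pow : ∀ x j k → pow (pow x k) j ≈ pow x (j ℕ.* k)
  pow-pow x zero    k = refl
  pow-pow x (suc j) k = sym (trans (pow-+ x k (j ℕ.* k)) (*-congˡ (sym (pow-pow x j k))))

  pow-distrib-* : ∀ x y k → pow (x * y) k ≈ pow x k * pow y k
  pow-distrib-* x y zero    = sym (*-identityˡ 1#)
  pow-distrib-* x y (suc k) = trans (*-congˡ (pow-distrib-* x y k))
    (solve 4 (λ x y u v → (x :* y) :* (u :* v) := (x :* u) :* (y :* v)) refl x y (pow x k) (pow y k))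

  pow-1# : ∀ k → pow 1# k ≈ 1#
  pow-1# zero    = refl
  pow-1# (suc k) = trans (*-identityˡ _) (pow-1# k)

  pow-one : ∀ x → pow x 1 ≈ x
  pow-one = *-identityʳ

  pow-swap : ∀ x j k → pow (pow x j) k ≈ pow (pow x k) j
  pow-swap x j k = trans (pow-pow x k j)
    (trans (reflexive (≡.cong (pow x) (ℕₚ.*-comm k j))) (sym (pow-pow x j k)))

  sumTo-cong : ∀ k {f g} → (∀ i → i ℕ.< k → f i ≈ g i) → sumTo k f ≈ sumTo k g
  sumTo-cong zero    f≈g = refl
  sumTo-cong (suc k) f≈g =
    +-cong (sumTo-cong k (λ i i<k → f≈g i (ℕₚ.m<n⇒m<1+n i<k))) (f≈g k (ℕₚ.n<1+n k))

  sumTo-0# : ∀ k {f} → (∀ i → i ℕ.< k → f i ≈ 0#) → sumTo k f ≈ 0#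
  sumTo-0# zero    f≈0 = refl
  sumTo-0# (suc k) f≈0 = trans
    (+-cong (sumTo-0# k (λ i i<k → f≈0 i (ℕₚ.m<n⇒m<1+n i<k))) (f≈0 k (ℕₚ.n<1+n k)))
    (+-identityˡ 0#)

  sumTo-+ : ∀ k f g → sumTo k (λ i → f i + g i) ≈ sumTo k f + sumTo k g
  sumTo-+ zero    f g = sym (+-identityˡ 0#)
  sumTo-+ (suc k) f g = trans (+-congʳ (sumTo-+ k f g))
    (solve 4 (λ x y u v → (x :+ y) :+ (u :+ v) := (x :+ u) :+ (y :+ v)) refl
      (sumTo k f) (sumTo k g) (f k) (g k))

  *-sumTo : ∀ k x f → x * sumTo k f ≈ sumTo k (λ i → x * f i)
  *-sumTo zero    x f = zeroʳ x
  *-sumTo (suc k) x f = trans (distribˡ x _ _) (+-congʳ (*-sumTo k x f))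

  sumTo-* : ∀ k x f → sumTo k f * x ≈ sumTo k (λ i → f i * x)
  sumTo-* zero    x f = zeroˡ x
  sumTo-* (suc k) x f = trans (distribʳ x _ _) (+-congʳ (sumTo-* k x f))

  sumTo-swap : ∀ j k (f : ℕ → ℕ → Carrier) → sumTo j (λ u → sumTo k (f u)) ≈ sumTo k (λ v → sumTo j (λ u → f u v))
  sumTo-swap zero    k f = sym (sumTo-0# k (λ _ _ → refl))
  sumTo-swap (suc j) k f = trans (+-congʳ (sumTo-swap j k f)) (sym (sumTo-+ k _ _))

  sumTo-head : ∀ k f → sumTo (suc k) f ≈ f 0 + sumTo k (f ∘ suc)
  sumTo-head zero    f = +-comm 0# (f 0)
  sumTo-head (suc k) f = trans (+-congʳ (sumTo-head k f)) (+-assoc _ _ _)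

  sumTo-reverse : ∀ k f → sumTo k f ≈ sumTo k (λ i → f (k ℕ.∸ suc i))
  sumTo-reverse zero    f = refl
  sumTo-reverse (suc k) f = begin
    sumTo k f + f k                            ≈⟨ +-comm _ _ ⟩
    f k + sumTo k f                            ≈⟨ +-congˡ (sumTo-reverse k f) ⟩
    f k + sumTo k (λ i → f (k ℕ.∸ suc i))      ≈⟨ sumTo-head k (λ i → f (k ℕ.∸ i)) ⟨
    sumTo (suc k) (λ i → f (k ℕ.∸ i))          ∎

  prodTo-cong : ∀ k {f g} → (∀ i → i ℕ.< k → f i ≈ g i) → prodTo k f ≈ prodTo k g
  prodTo-cong zero    f≈g = refl
  prodTo-cong (suc k) f≈g =
    *-cong (prodTo-cong k (λ i i<k → f≈g i (ℕₚ.m<n⇒m<1+n i<k))) (f≈g k (ℕₚ.n<1+n k))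

  prodTo-head : ∀ k f → prodTo (suc k) f ≈ f 0 * prodTo k (f ∘ suc)
  prodTo-head zero    f = *-comm 1# (f 0)
  prodTo-head (suc k) f = trans (*-congʳ (prodTo-head k f)) (*-assoc _ _ _)

  -- The increasing enumeration of the naturals other than `j`. It is the renumbering inside
  -- `minor`, so `minor j M i c` unfolds to `M (suc i) (skip j c)`.
  skip : ℕ → ℕ → ℕ
  skip j c = if c <ᵇ j then c else suc c

  skip-suc : ∀ j c → skip (suc j) (suc c) ≡ suc (skip j c)
  skip-suc j c with c <ᵇ j
  ... | true  = ≡.refl
  ... | false = ≡.refl

  skip-< : ∀ j c {k} → c ℕ.< k → skip j c ℕ.< suc k
  skip-< j c c<k with c <ᵇ j
  ... | true  = ℕₚ.m<n⇒m<1+n c<k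
  ... | false = s≤s c<k

  sumTo-skip : ∀ k f l → l ℕ.≤ k → sumTo (suc k) f ≈ f l + sumTo k (f ∘ skip l)
  sumTo-skip k       f zero    l≤k       = sumTo-head k f
  sumTo-skip (suc k) f (suc l) (s≤s l≤k) = begin
    sumTo (suc (suc k)) f                                            ≈⟨ sumTo-head (suc k) f ⟩
    f 0 + sumTo (suc k) (f ∘ suc)                                    ≈⟨ +-congˡ (sumTo-skip k (f ∘ suc) l l≤k) ⟩
    f 0 + (f (suc l) + sumTo k (f ∘ suc ∘ skip l))                   ≈⟨ solve 3 (λ x y z → x :+ (y :+ z) := y :+ (x :+ z)) refl _ _ _ ⟩
    f (suc l) + (f 0 + sumTo k (f ∘ suc ∘ skip l))                   ≈⟨ +-congˡ (+-congˡ (sumTo-cong k (λ i _ → reflexive (≡.cong f (skip-suc l i))))) ⟨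
    f (suc l) + (f 0 + sumTo k (f ∘ skip (suc l) ∘ suc))             ≈⟨ +-congˡ (sumTo-head k (f ∘ skip (suc l))) ⟨
    f (suc l) + sumTo (suc k) (f ∘ skip (suc l))                     ∎

  -1^ : ℕ → Carrier
  -1^ = pow (- 1#)

  Column : Set
  Column = ℕ → Carrier

  minorCol : ℕ → (ℕ → ℕ → Carrier) → ℕ → ℕ → Carrier
  minorCol i M r c = M (skip i r) (suc c)

  det-cong : ∀ k {M N} → (∀ i j → i ℕ.< k → j ℕ.< k → M i j ≈ N i j) → det k M ≈ det k N
  det-cong zero    M≈N = refl
  det-cong (suc k) M≈N = sumTo-cong (suc k) λ j j<k → *-congˡ (*-cong (M≈N 0 j (s≤s z≤n) j<k)
    (det-cong k λ i c i<k c<k → M≈N (suc i) (skip j c) (s≤s i<k) (skip-< j c c<k)))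

  -- Expanding along the first row and then along the first column of each minor, or in the opposite
  -- order, removes the same two rows and columns. Outside the common corner term the two double
  -- sums agree term by term.
  det-expandCol : ∀ k M → det (suc k) M ≈ sumTo (suc k) (λ i → -1^ i * (M i 0 * det k (minorCol i M)))
  det-expandCol zero    M = refl
  det-expandCol (suc k) M = begin
    det (suc (suc k)) M
      ≈⟨ sumTo-head (suc k) _ ⟩
    T + sumTo (suc k) (λ j → (- 1# * -1^ j) * (M 0 (suc j) * det (suc k) (minor (suc j) M)))
      ≈⟨ +-congˡ (sumTo-cong (suc k) λ j _ → trans
           (*-congˡ (trans (*-congˡ (det-expandCol k (minor (suc j) M))) (*-sumTo (suc k) _ _)))
           (*-sumTo (suc k) _ _)) ⟩
    T + sumTo (suc k) (λ j → sumTo (suc k) (λ i → (- 1# * -1^ j) * (M 0 (suc j) *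
          (-1^ i * (M (suc i) 0 * det k (minorCol i (minor (suc j) M)))))))
      ≈⟨ +-congˡ (sumTo-swap (suc k) (suc k) _) ⟩
    T + sumTo (suc k) (λ i → sumTo (suc k) (λ j → (- 1# * -1^ j) * (M 0 (suc j) *
          (-1^ i * (M (suc i) 0 * det k (minorCol i (minor (suc j) M)))))))
      ≈⟨ +-congˡ (sumTo-cong (suc k) λ i _ → sumTo-cong (suc k) λ j _ → rearrange i j) ⟩
    T + sumTo (suc k) (λ i → sumTo (suc k) (λ j → (- 1# * -1^ i) * (M (suc i) 0 *
          (-1^ j * (M 0 (suc j) * det k (minor j (minorCol (suc i) M)))))))
      ≈⟨ +-congˡ (sumTo-cong (suc k) λ i _ → trans
           (*-congˡ (*-sumTo (suc k) _ _)) (*-sumTo (suc k) _ _)) ⟨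
    T + sumTo (suc k) (λ i → (- 1# * -1^ i) * (M (suc i) 0 * det (suc k) (minorCol (suc i) M)))
      ≈⟨ sumTo-head (suc k) _ ⟨
    sumTo (suc (suc k)) (λ i → -1^ i * (M i 0 * det (suc k) (minorCol i M))) ∎
    where
    T = 1# * (M 0 0 * det (suc k) (minor 0 M))
    rearrange : ∀ i j →
      (- 1# * -1^ j) * (M 0 (suc j) * (-1^ i * (M (suc i) 0 * det k (minorCol i (minor (suc j) M))))) ≈
      (- 1# * -1^ i) * (M (suc i) 0 * (-1^ j * (M 0 (suc j) * det k (minor j (minorCol (suc i) M)))))
    rearrange i j = trans
      (*-congˡ (*-congˡ (*-congˡ (*-congˡ (det-cong k λ r c _ _ →
        reflexive (≡.cong₂ M (≡.sym (skip-suc i r)) (skip-suc j c)))))))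
      (solve 6 (λ m x u y v d → (m :* x) :* (u :* (y :* (v :* d))) := (m :* y) :* (v :* (x :* (u :* d)))) refl
        (- 1#) (-1^ j) (M 0 (suc j)) (-1^ i) (M (suc i) 0) _)

  det-transpose : ∀ k M → det k (λ i j → M j i) ≈ det k M
  det-transpose zero    M = refl
  det-transpose (suc k) M = trans
    (sumTo-cong (suc k) λ j _ → *-congˡ (*-congˡ (det-transpose k (minorCol j M))))
    (sym (det-expandCol k M))

  -- The first two terms of the expansion carry the same minor with opposite signs. Every later
  -- minor still begins with the two equal columns, so induction applies.
  det-equalCols : ∀ k M → (∀ i → M i 0 ≈ M i 1) → det (suc (suc k)) M ≈ 0#
  det-equalCols k M eq = begin
    det (suc (suc k)) M
      ≈⟨ trans (sumTo-head (suc k) _) (+-congˡ (sumTo-head k _)) ⟩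
    1# * (M 0 0 * det (suc k) (minor 0 M)) + (- 1# * 1# * (M 0 1 * det (suc k) (minor 1 M)) + rest)
      ≈⟨ +-cong (*-congˡ (*-cong (eq 0) (det-cong (suc k) λ i c _ _ → minors i c)))
                (trans (+-congˡ (rest≈0 k M eq)) (+-identityʳ _)) ⟩
    1# * (M 0 1 * det (suc k) (minor 1 M)) + - 1# * 1# * (M 0 1 * det (suc k) (minor 1 M))
      ≈⟨ +-cong (*-identityˡ _) (trans (*-congʳ (*-identityʳ _)) (-1*x≈-x _)) ⟩
    M 0 1 * det (suc k) (minor 1 M) - M 0 1 * det (suc k) (minor 1 M)
      ≈⟨ -‿inverseʳ _ ⟩
    0# ∎
    where
    rest = sumTo k (λ j → -1^ (suc (suc j)) * (M 0 (suc (suc j)) * det (suc k) (minor (suc (suc j)) M)))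
    minors : ∀ i c → minor 0 M i c ≈ minor 1 M i c
    minors i zero    = sym (eq (suc i))
    minors i (suc c) = refl
    rest≈0 : ∀ k M → (∀ i → M i 0 ≈ M i 1) →
      sumTo k (λ j → -1^ (suc (suc j)) * (M 0 (suc (suc j)) * det (suc k) (minor (suc (suc j)) M))) ≈ 0#
    rest≈0 zero    M eq = refl
    rest≈0 (suc k) M eq = sumTo-0# (suc k) λ j _ → trans
      (*-congˡ (trans (*-congˡ (det-equalCols k (minor (suc (suc j)) M) (λ i → eq (suc i)))) (zeroʳ _)))
      (zeroʳ _)

  HeadLinear : ∀ {k} → (Vec Column (suc k) → Carrier) → Set
  HeadLinear D = ∀ x u v vs → D ((λ i → x * u i + v i) ∷ vs) ≈ x * D (u ∷ vs) + D (v ∷ vs)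

  HeadCong : ∀ {k} → (Vec Column (suc k) → Carrier) → Set
  HeadCong D = ∀ {u v} vs → (∀ i → u i ≈ v i) → D (u ∷ vs) ≈ D (v ∷ vs)

  HeadAlternating : ∀ {k} → (Vec Column (suc k) → Carrier) → Set
  HeadAlternating {zero}  D = ⊤
  HeadAlternating {suc k} D = ∀ u vs → D (u ∷ u ∷ vs) ≈ 0#

  -- Equality is tested only on the two leading columns, but every way of freezing the first column
  -- must again give an alternating form. This is vanishing on adjacent equal columns, in a shape
  -- that matches recursion on the list of columns.
  data IsAlternating : ∀ k → (Vec Column k → Carrier) → Set where
    nullary : ∀ {D} → IsAlternating zero D
    stepwise : ∀ {k} {D : Vec Column (suc k) → Carrier} → HeadCong D → HeadLinear D →
      HeadAlternating D → (∀ v → IsAlternating k (λ vs → D (v ∷ vs))) → IsAlternating (suc k) D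

  tab : ∀ k → (ℕ → Column) → Vec Column k
  tab zero    f = []
  tab (suc k) f = f 0 ∷ tab k (f ∘ suc)

  mat : ∀ {k} → Vec Column k → ℕ → ℕ → Carrier
  mat []       i j       = 0#
  mat (v ∷ vs) i zero    = v i
  mat (v ∷ vs) i (suc j) = mat vs i j

  mat-tab : ∀ k f i j → j ℕ.< k → mat (tab k f) i j ≈ f j i
  mat-tab (suc k) f i zero    j<k       = refl
  mat-tab (suc k) f i (suc j) (s≤s j<k) = mat-tab k (f ∘ suc) i j j<k

  headAlternating-resp : ∀ k {D E : Vec Column (suc k) → Carrier} → (∀ vs → D vs ≈ E vs) →
    HeadAlternating D → HeadAlternating E
  headAlternating-resp zero    D≈E alt      = tt
  headAlternating-resp (suc k) D≈E alt u vs = trans (sym (D≈E _)) (alt u vs)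

  isAlternating-resp : ∀ k {D E : Vec Column k → Carrier} → (∀ vs → D vs ≈ E vs) →
    IsAlternating k D → IsAlternating k E
  isAlternating-resp zero    D≈E alt = nullary
  isAlternating-resp (suc k) D≈E (stepwise congruent linear alternating tails) = stepwise
    (λ vs u≈v → trans (sym (D≈E _)) (trans (congruent vs u≈v) (D≈E _)))
    (λ x u v vs → trans (sym (D≈E _)) (trans (linear x u v vs) (+-cong (*-congˡ (D≈E _)) (D≈E _))))
    (headAlternating-resp k D≈E alternating)
    (λ v → isAlternating-resp k (λ vs → D≈E (v ∷ vs)) (tails v))

  -- Needed for `g = skip i`, which deletes row i: it makes a cofactor an alternating form in the
  -- remaining columns.
  isAlternating-reindex : ∀ k (g : ℕ → ℕ) {D : Vec Column k → Carrier} → IsAlternating k D →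
    IsAlternating k (λ vs → D (Vec.map (_∘ g) vs))
  isAlternating-reindex zero    g alt = nullary
  isAlternating-reindex (suc k) g (stepwise congruent linear alternating tails) = stepwise
    (λ vs u≈v → congruent _ (λ i → u≈v (g i)))
    (λ x u v vs → linear x _ _ _)
    (headAlt k alternating)
    (λ v → isAlternating-reindex k g (tails (v ∘ g)))
    where
    headAlt : ∀ k {D : Vec Column (suc k) → Carrier} → HeadAlternating D →
      HeadAlternating (λ vs → D (Vec.map (_∘ g) vs))
    headAlt zero    alternating      = tt
    headAlt (suc k) alternating u vs = alternating (u ∘ g) _

  module _ {k : ℕ} {D : Vec Column (suc k) → Carrier} where

    head-cong : IsAlternating (suc k) D → HeadCong D
    head-cong (stepwise congruent _ _ _) = congruent

    head-linear : IsAlternating (suc k) D → HeadLinear D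
    head-linear (stepwise _ linear _ _) = linear

    head-alternating : IsAlternating (suc k) D → HeadAlternating D
    head-alternating (stepwise _ _ alternating _) = alternating

    tail-alternating : IsAlternating (suc k) D → ∀ v → IsAlternating k (λ vs → D (v ∷ vs))
    tail-alternating (stepwise _ _ _ tails) = tails

  isAlternating-sum : ∀ k m (c : ℕ → Carrier) {D : ℕ → Vec Column k → Carrier} →
    (∀ i → IsAlternating k (D i)) → IsAlternating k (λ vs → sumTo m (λ i → c i * D i vs))
  isAlternating-sum zero    m c alt = nullary
  isAlternating-sum (suc k) m c {D} alt = stepwise
    (λ vs u≈v → sumTo-cong m (λ i _ → *-congˡ (head-cong (alt i) vs u≈v)))
    (λ x u v vs → begin
      sumTo m (λ i → c i * D i _)
        ≈⟨ sumTo-cong m (λ i _ → trans (*-congˡ (head-linear (alt i) x u v vs))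
             (solve 4 (λ c x d e → c :* (x :* d :+ e) := x :* (c :* d) :+ c :* e) refl (c i) x _ _)) ⟩
      sumTo m (λ i → x * (c i * D i (u ∷ vs)) + c i * D i (v ∷ vs))
        ≈⟨ sumTo-+ m _ _ ⟩
      sumTo m (λ i → x * (c i * D i (u ∷ vs))) + sumTo m (λ i → c i * D i (v ∷ vs))
        ≈⟨ +-congʳ (*-sumTo m x _) ⟨
      x * sumTo m (λ i → c i * D i (u ∷ vs)) + sumTo m (λ i → c i * D i (v ∷ vs)) ∎)
    (headAlt k (λ i → head-alternating (alt i)))
    (λ v → isAlternating-sum k m c (λ i → tail-alternating (alt i) v))
    where
    headAlt : ∀ k {D : ℕ → Vec Column (suc k) → Carrier} → (∀ i → HeadAlternating (D i)) →
      HeadAlternating (λ vs → sumTo m (λ i → c i * D i vs))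
    headAlt zero    alternating      = tt
    headAlt (suc k) alternating u vs =
      sumTo-0# m (λ i _ → trans (*-congˡ (alternating i u vs)) (zeroʳ _))

  mat-map : ∀ {k} (g : ℕ → ℕ) (vs : Vec Column k) i j → mat (Vec.map (_∘ g) vs) i j ≈ mat vs (g i) j
  mat-map g []       i j       = refl
  mat-map g (v ∷ vs) i zero    = refl
  mat-map g (v ∷ vs) i (suc j) = mat-map g vs i j

  cofactors : ∀ {k} → Vec Column k → ℕ → Carrier
  cofactors {k} vs i = -1^ i * det k (mat (Vec.map (_∘ skip i) vs))

  det-cofactors : ∀ k v (vs : Vec Column k) →
    det (suc k) (mat (v ∷ vs)) ≈ sumTo (suc k) (λ i → v i * cofactors vs i)
  det-cofactors k v vs = trans (det-expandCol k (mat (v ∷ vs))) (sumTo-cong (suc k) λ i _ → trans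
    (*-congˡ (*-congˡ (det-cong k (λ r c _ _ → sym (mat-map (skip i) vs r c)))))
    (solve 3 (λ x y z → x :* (y :* z) := y :* (x :* z)) refl _ _ _))

  -- Freezing the first column leaves a fixed linear combination of cofactors of the others, by
  -- expansion along that column. Each cofactor alternates by induction on the size.
  det-isAlternating : ∀ k → IsAlternating k (λ vs → det k (mat vs))
  det-isAlternating zero    = nullary
  det-isAlternating (suc k) = stepwise
    (λ {u} {v} vs u≈v → det-cong (suc k) {mat (u ∷ vs)} {mat (v ∷ vs)}
      (λ { i zero _ _ → u≈v i ; i (suc j) _ _ → refl }))
    (λ x u v vs → begin
      det (suc k) (mat ((λ i → x * u i + v i) ∷ vs))
        ≈⟨ det-cofactors k _ vs ⟩
      sumTo (suc k) (λ i → (x * u i + v i) * cofactors vs i)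
        ≈⟨ sumTo-cong (suc k) (λ i _ →
             solve 4 (λ x u v d → (x :* u :+ v) :* d := x :* (u :* d) :+ v :* d) refl x (u i) (v i) _) ⟩
      sumTo (suc k) (λ i → x * (u i * cofactors vs i) + v i * cofactors vs i)
        ≈⟨ sumTo-+ (suc k) _ _ ⟩
      sumTo (suc k) (λ i → x * (u i * cofactors vs i)) + sumTo (suc k) (λ i → v i * cofactors vs i)
        ≈⟨ +-cong (trans (*-congˡ (det-cofactors k u vs)) (*-sumTo (suc k) x _)) (det-cofactors k v vs) ⟨
      x * det (suc k) (mat (u ∷ vs)) + det (suc k) (mat (v ∷ vs)) ∎)
    (headAlt k)
    (λ v → isAlternating-resp k (λ vs → trans
        (sumTo-cong (suc k) (λ i _ → *-assoc (v i) (-1^ i) _)) (sym (det-cofactors k v vs)))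
      (isAlternating-sum k (suc k) (λ i → v i * -1^ i)
        (λ i → isAlternating-reindex k (skip i) (det-isAlternating k))))
    where
    headAlt : ∀ k → HeadAlternating {k} (λ vs → det (suc k) (mat vs))
    headAlt zero         = tt
    headAlt (suc k) u vs = det-equalCols k (mat (u ∷ u ∷ vs)) (λ _ → refl)

  module _ {k : ℕ} {D : Vec Column (suc k) → Carrier} (alt : IsAlternating (suc k) D) where

    head-+ : ∀ u v vs → D ((λ i → u i + v i) ∷ vs) ≈ D (u ∷ vs) + D (v ∷ vs)
    head-+ u v vs = trans (head-cong alt vs (λ i → +-congʳ (sym (*-identityˡ (u i)))))
      (trans (head-linear alt 1# u v vs) (+-congʳ (*-identityˡ _)))

    head-0# : ∀ vs → D ((λ _ → 0#) ∷ vs) ≈ 0#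
    head-0# vs = begin
      D ((λ _ → 0#) ∷ vs)               ≈⟨ head-cong alt vs (λ _ → sym (trans (+-congʳ (zeroʳ (- 1#))) (+-identityʳ 0#))) ⟩
      D ((λ _ → - 1# * 0# + 0#) ∷ vs)   ≈⟨ head-linear alt (- 1#) _ _ vs ⟩
      - 1# * D ((λ _ → 0#) ∷ vs) + D ((λ _ → 0#) ∷ vs)  ≈⟨ +-congʳ (-1*x≈-x _) ⟩
      - D ((λ _ → 0#) ∷ vs) + D ((λ _ → 0#) ∷ vs)       ≈⟨ -‿inverseˡ _ ⟩
      0# ∎

    head-scale : ∀ x u vs → D ((λ i → x * u i) ∷ vs) ≈ x * D (u ∷ vs)
    head-scale x u vs = trans (head-cong alt vs (λ i → sym (+-identityʳ (x * u i))))
      (trans (head-linear alt x u _ vs) (trans (+-congˡ (head-0# vs)) (+-identityʳ _)))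

    head-sum : ∀ m (c : ℕ → Carrier) (e : ℕ → Column) vs →
      D ((λ i → sumTo m (λ l → c l * e l i)) ∷ vs) ≈ sumTo m (λ l → c l * D (e l ∷ vs))
    head-sum zero    c e vs = head-0# vs
    head-sum (suc m) c e vs = trans (head-+ _ _ vs) (+-cong (head-sum m c e vs) (head-scale _ _ vs))

  head-swap : ∀ {k} {D : Vec Column (suc (suc k)) → Carrier} → IsAlternating (suc (suc k)) D →
    ∀ u v vs → D (u ∷ v ∷ vs) ≈ - D (v ∷ u ∷ vs)
  head-swap {D = D} alt u v vs = +-inverseˡ-unique _ _ (begin
    D (u ∷ v ∷ vs) + D (v ∷ u ∷ vs)
      ≈⟨ +-cong (+-identityˡ _) (+-identityʳ _) ⟨
    (0# + D (u ∷ v ∷ vs)) + (D (v ∷ u ∷ vs) + 0#)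
      ≈⟨ +-cong (+-congʳ (head-alternating alt u vs)) (+-congˡ (head-alternating alt v vs)) ⟨
    (D (u ∷ u ∷ vs) + D (u ∷ v ∷ vs)) + (D (v ∷ u ∷ vs) + D (v ∷ v ∷ vs))
      ≈⟨ +-cong (head-+ (tail-alternating alt u) u v vs) (head-+ (tail-alternating alt v) u v vs) ⟨
    D (u ∷ u+v ∷ vs) + D (v ∷ u+v ∷ vs)
      ≈⟨ head-+ alt u v (u+v ∷ vs) ⟨
    D (u+v ∷ u+v ∷ vs)
      ≈⟨ head-alternating alt u+v vs ⟩
    0# ∎)
    where
    u+v : Column
    u+v i = u i + v i

  alternating-cong : ∀ k {D} → IsAlternating k D → ∀ {f g : ℕ → Column} →
    (∀ j i → f j i ≈ g j i) → D (tab k f) ≈ D (tab k g)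
  alternating-cong zero    alt f≈g = refl
  alternating-cong (suc k) alt f≈g = trans (head-cong alt _ (f≈g 0))
    (alternating-cong k (tail-alternating alt _) (λ j → f≈g (suc j)))

  -- Only equality of the two leading columns is known to kill the form. So `w` is swapped past each
  -- column once the multiple of `w` in it has been removed, and swapped back afterwards.
  alternating-shear : ∀ k {D} → IsAlternating (suc k) D → ∀ w (b : ℕ → Carrier) u →
    D (w ∷ tab k (λ j i → b j * w i + u j i)) ≈ D (w ∷ tab k u)
  alternating-shear zero    alt w b u = refl
  alternating-shear (suc k) {D} alt w b u = begin
    D (w ∷ (λ i → b 0 * w i + u 0 i) ∷ sheared)
      ≈⟨ head-linear (tail-alternating alt w) (b 0) w (u 0) sheared ⟩
    b 0 * D (w ∷ w ∷ sheared) + D (w ∷ u 0 ∷ sheared)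
      ≈⟨ +-congʳ (trans (*-congˡ (head-alternating alt w sheared)) (zeroʳ (b 0))) ⟩
    0# + D (w ∷ u 0 ∷ sheared)
      ≈⟨ +-identityˡ _ ⟩
    D (w ∷ u 0 ∷ sheared)
      ≈⟨ head-swap alt w (u 0) sheared ⟩
    - D (u 0 ∷ w ∷ sheared)
      ≈⟨ -‿cong (alternating-shear k (tail-alternating alt (u 0)) w (b ∘ suc) (u ∘ suc)) ⟩
    - D (u 0 ∷ w ∷ tab k (u ∘ suc))
      ≈⟨ head-swap alt w (u 0) _ ⟨
    D (w ∷ u 0 ∷ tab k (u ∘ suc)) ∎
    where
    sheared = tab k (λ j i → b (suc j) * w i + u (suc j) i)

  -- One transposition for each of the `l` columns passed over.
  alternating-move : ∀ k {D} → IsAlternating (suc k) D → ∀ (e : ℕ → Column) l → l ℕ.≤ k →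
    D (e l ∷ tab k (e ∘ skip l)) ≈ -1^ l * D (tab (suc k) e)
  alternating-move k       alt e zero    l≤k = sym (*-identityˡ _)
  alternating-move (suc k) {D} alt e (suc l) (s≤s l≤k) = begin
    D (e (suc l) ∷ e 0 ∷ tab k (e ∘ skip (suc l) ∘ suc))
      ≈⟨ head-swap alt _ _ _ ⟩
    - D (e 0 ∷ e (suc l) ∷ tab k (e ∘ skip (suc l) ∘ suc))
      ≈⟨ -‿cong (alternating-cong k (tail-alternating (tail-alternating alt (e 0)) (e (suc l)))
           (λ j i → reflexive (≡.cong (λ m → e m i) (skip-suc l j)))) ⟩
    - D (e 0 ∷ e (suc l) ∷ tab k (e ∘ suc ∘ skip l))
      ≈⟨ -‿cong (alternating-move k (tail-alternating alt (e 0)) (e ∘ suc) l l≤k) ⟩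
    - (-1^ l * D (tab (suc (suc k)) e))
      ≈⟨ trans (sym (-1*x≈-x _)) (sym (*-assoc _ _ _)) ⟩
    -1^ (suc l) * D (tab (suc (suc k)) e) ∎

  alternating-scale : ∀ k {D} → IsAlternating k D → ∀ (d : ℕ → Carrier) u →
    D (tab k (λ j i → d j * u j i)) ≈ prodTo k d * D (tab k u)
  alternating-scale zero    alt d u = sym (*-identityˡ _)
  alternating-scale (suc k) {D} alt d u = begin
    D ((λ i → d 0 * u 0 i) ∷ tab k (λ j i → d (suc j) * u (suc j) i))
      ≈⟨ head-scale alt (d 0) (u 0) _ ⟩
    d 0 * D (u 0 ∷ tab k (λ j i → d (suc j) * u (suc j) i))
      ≈⟨ *-congˡ (alternating-scale k (tail-alternating alt (u 0)) (d ∘ suc) (u ∘ suc)) ⟩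
    d 0 * (prodTo k (d ∘ suc) * D (tab (suc k) u))
      ≈⟨ *-assoc _ _ _ ⟨
    (d 0 * prodTo k (d ∘ suc)) * D (tab (suc k) u)
      ≈⟨ *-congʳ (prodTo-head k d) ⟨
    prodTo (suc k) d * D (tab (suc k) u) ∎

  -- An alternating form is determined by its value on one family up to the determinant
  -- of the coefficients; expanding along the first column of B avoids permutations.
  alternating-combination : ∀ k {D} → IsAlternating k D → ∀ B (e : ℕ → Column) →
    D (tab k (λ j i → sumTo k (λ l → B l j * e l i))) ≈ det k B * D (tab k e)
  alternating-combination zero    alt B e = sym (*-identityˡ _)
  alternating-combination (suc k) {D} alt B e = begin
    D ((λ i → sumTo (suc k) (λ l → B l 0 * e l i)) ∷ tab k others)
      ≈⟨ head-sum alt (suc k) (λ l → B l 0) e _ ⟩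
    sumTo (suc k) (λ l → B l 0 * D (e l ∷ tab k others))
      ≈⟨ sumTo-cong (suc k) (λ l l<k → *-congˡ (term l (ℕₚ.≤-pred l<k))) ⟩
    sumTo (suc k) (λ l → B l 0 * (det k (minorCol l B) * (-1^ l * D (tab (suc k) e))))
      ≈⟨ sumTo-cong (suc k) (λ l _ →
           solve 4 (λ b m s d → b :* (m :* (s :* d)) := (s :* (b :* m)) :* d) refl _ _ _ _) ⟩
    sumTo (suc k) (λ l → (-1^ l * (B l 0 * det k (minorCol l B))) * D (tab (suc k) e))
      ≈⟨ sumTo-* (suc k) _ _ ⟨
    sumTo (suc k) (λ l → -1^ l * (B l 0 * det k (minorCol l B))) * D (tab (suc k) e)
      ≈⟨ *-congʳ (det-expandCol k B) ⟨
    det (suc k) B * D (tab (suc k) e) ∎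
    where
    others : ℕ → Column
    others j i = sumTo (suc k) (λ l → B l (suc j) * e l i)
    term : ∀ l → l ℕ.≤ k → D (e l ∷ tab k others) ≈ det k (minorCol l B) * (-1^ l * D (tab (suc k) e))
    term l l≤k = begin
      D (e l ∷ tab k others)
        ≈⟨ alternating-cong k (tail-alternating alt (e l))
             (λ j i → sumTo-skip k (λ l → B l (suc j) * e l i) l l≤k) ⟩
      D (e l ∷ tab k (λ j i → B l (suc j) * e l i + sumTo k (λ l′ → minorCol l B l′ j * e (skip l l′) i)))
        ≈⟨ alternating-shear k alt (e l) (λ j → B l (suc j)) _ ⟩
      D (e l ∷ tab k (λ j i → sumTo k (λ l′ → minorCol l B l′ j * e (skip l l′) i)))
        ≈⟨ alternating-combination k (tail-alternating alt (e l)) (minorCol l B) (e ∘ skip l) ⟩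
      det k (minorCol l B) * D (e l ∷ tab k (e ∘ skip l))
        ≈⟨ *-congˡ (alternating-move k alt e l l≤k) ⟩
      det k (minorCol l B) * (-1^ l * D (tab (suc k) e)) ∎

  detCols : ℕ → (ℕ → Column) → Carrier
  detCols k f = det k (mat (tab k f))

  detCols-det : ∀ k f → detCols k f ≈ det k (λ i j → f j i)
  detCols-det k f = det-cong k (λ i j _ j<k → mat-tab k f i j j<k)

  -- The columns of the product are combinations of the columns of `A` with coefficients from `B`,
  -- so `alternating-combination` applies to the determinant itself.
  det-* : ∀ k A B → det k (λ i j → sumTo k (λ l → A i l * B l j)) ≈ det k A * det k B
  det-* k A B = begin
    det k (λ i j → sumTo k (λ l → A i l * B l j))
      ≈⟨ det-cong k (λ i j _ _ → sumTo-cong k (λ l _ → *-comm _ _)) ⟩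
    det k (λ i j → sumTo k (λ l → B l j * A i l))
      ≈⟨ detCols-det k _ ⟨
    detCols k (λ j i → sumTo k (λ l → B l j * A i l))
      ≈⟨ alternating-combination k (det-isAlternating k) B (λ l i → A i l) ⟩
    det k B * detCols k (λ l i → A i l)
      ≈⟨ *-comm _ _ ⟩
    detCols k (λ l i → A i l) * det k B
      ≈⟨ *-congʳ (detCols-det k _) ⟩
    det k A * det k B ∎

  det-scaleCols : ∀ k d M → det k (λ i j → d j * M i j) ≈ prodTo k d * det k M
  det-scaleCols k d M = begin
    det k (λ i j → d j * M i j)               ≈⟨ detCols-det k _ ⟨
    detCols k (λ j i → d j * M i j)           ≈⟨ alternating-scale k (det-isAlternating k) d (λ j i → M i j) ⟩
    prodTo k d * detCols k (λ j i → M i j)    ≈⟨ *-congˡ (detCols-det k _) ⟩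
    prodTo k d * det k M ∎

  -- The columns `R` are the partial sums of the columns `K`. Shearing with the first one turns the
  -- others into partial sums that start at `K 1`, the same situation with one column fewer.
  alternating-differences : ∀ k {D} → IsAlternating k D → ∀ (R K : ℕ → Column) →
    (∀ i → R 0 i ≈ K 0 i) → (∀ j i → R (suc j) i ≈ R j i + K (suc j) i) → D (tab k R) ≈ D (tab k K)
  alternating-differences zero    alt R K start step = refl
  alternating-differences (suc k) {D} alt R K start step = begin
    D (R 0 ∷ tab k (R ∘ suc))
      ≈⟨ alternating-cong k (tail-alternating alt (R 0)) (λ j i → decompose (R 0 i) (R (suc j) i)) ⟩
    D (R 0 ∷ tab k (λ j i → 1# * R 0 i + (R (suc j) i - R 0 i)))
      ≈⟨ alternating-shear k alt (R 0) (λ _ → 1#) _ ⟩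
    D (R 0 ∷ tab k (λ j i → R (suc j) i - R 0 i))
      ≈⟨ alternating-differences k (tail-alternating alt (R 0)) _ (K ∘ suc)
           (λ i → trans (+-congʳ (step 0 i)) (trans (+-congʳ (+-comm _ _))
             (trans (+-assoc _ _ _) (trans (+-congˡ (-‿inverseʳ _)) (+-identityʳ _)))))
           (λ j i → trans (+-congʳ (step (suc j) i))
             (solve 3 (λ x y z → (x :+ y) :+ z := (x :+ z) :+ y) refl _ _ _)) ⟩
    D (R 0 ∷ tab k (K ∘ suc))
      ≈⟨ head-cong alt _ start ⟩
    D (K 0 ∷ tab k (K ∘ suc)) ∎
    where
    decompose : ∀ x y → y ≈ 1# * x + (y - x)
    decompose x y = sym (trans (+-congʳ (*-identityˡ x)) (trans (+-congˡ (+-comm y (- x)))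
      (trans (sym (+-assoc x (- x) y)) (trans (+-congʳ (-‿inverseʳ x)) (+-identityˡ y)))))

  det-differences : ∀ k R K → (∀ i → R i 0 ≈ K i 0) →
    (∀ i j → R i (suc j) ≈ R i j + K i (suc j)) → det k R ≈ det k K
  det-differences k R K start step = trans (sym (detCols-det k (λ j i → R i j)))
    (trans (alternating-differences k (det-isAlternating k) (λ j i → R i j) (λ j i → K i j)
             start (λ j i → step i j))
      (detCols-det k (λ j i → K i j)))

-- Binomial coefficients at a prime, and splitting a term off a finite sum

p∤k! : ∀ {p} → Prime p → ∀ k → k ℕ.< p → ¬ (p ∣ k !)
p∤k! {p} pr zero    k<p p∣1 = ℕ.nonTrivial⇒≢1 {{prime⇒nonTrivial pr}} (∣1⇒≡1 p∣1)
p∤k! {p} pr (suc k) k<p p∣k! with euclidsLemma (suc k) (k !) pr p∣k!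
... | inj₁ p∣1+k = ℕₚ.<⇒≱ k<p (∣⇒≤ p∣1+k)
... | inj₂ p∣k!′ = p∤k! pr k (ℕₚ.<-trans (ℕₚ.n<1+n k) k<p) p∣k!′

p∣pCk : ∀ {p} → Prime p → ∀ k → 0 ℕ.< k → k ℕ.< p → p ∣ p C k
p∣pCk {suc p} pr k 0<k k<p =
  [ (λ d → d) , (λ d → ⊥-elim ([ p∤k! pr k k<p , p∤k! pr (suc p ℕ.∸ k) (ℕₚ.∸-monoʳ-< 0<k k≤p) ]′
      (euclidsLemma (k !) _ pr d))) ]′
  (euclidsLemma (suc p C k) (k ! ℕ.* (suc p ℕ.∸ k) !) pr (≡.subst (suc p ∣_) (≡.sym C*k!≡p!) (m∣m*n (p !))))
  where
  k≤p : k ℕ.≤ suc p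
  k≤p = ℕₚ.<⇒≤ k<p
  C*k!≡p! : (suc p C k) ℕ.* (k ! ℕ.* (suc p ℕ.∸ k) !) ≡ suc p !
  C*k!≡p! = ≡.trans (≡.cong (ℕ._* (k ! ℕ.* (suc p ℕ.∸ k) !)) (nCk≡n!/k![n-k]! k≤p))
    (m/n*n≡m {{k ℕₚ.!* (suc p ℕ.∸ k) !≢0}} (k![n∸k]!∣n! k≤p))

module _ (M : CommutativeMonoid 0ℓ 0ℓ) where
  open CommutativeMonoid M
  open import Algebra.Properties.CommutativeMonoid.Sum M using (sum)
  open import Algebra.Properties.CommutativeSemigroup commutativeSemigroup using (x∙yz≈y∙xz)

  -- The extracted term is replaced by the neutral element instead of being deleted. The index type
  -- stays `Fin N`, so products and counts over subsets of the field can all run over one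
  -- enumeration.
  sum-single : ∀ {N} (t : Fin N → Carrier) i →
    sum t ≈ t i ∙ sum (λ j → if does (j Fin.≟ i) then ε else t j)
  sum-single t zero    = ∙-congˡ (sym (identityˡ _))
  sum-single t (suc i) = trans (∙-congˡ (sum-single (t ∘ suc) i)) (x∙yz≈y∙xz _ _ _)

-- The finite field: Fermat, Wilson, Euler's criterion, additivity of Frobenius

module FieldFacts (F : FiniteField) (q n : ℕ) (a : ℕ → FiniteField.Carrier F) where
  open FiniteField F hiding (zero)
  open Setup F q n a
  open Determinants F q n a
  open import Relation.Binary.Reasoning.Setoid setoid
  open import Algebra.Properties.Ring ring
  open import Algebra.Solver.Ring.NaturalCoefficients.Default commutativeSemiring
    using (solve; _:=_; _:+_; _:*_; con)
  open import Algebra.Properties.Semiring.Mult semiring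
    renaming (_×_ to _·_)
  import Algebra.Properties.CommutativeMonoid.Sum +-commutativeMonoid as Σ
  import Algebra.Properties.CommutativeMonoid.Sum *-commutativeMonoid as Π
  import Algebra.Properties.CommutativeMonoid.Sum ℕₚ.+-0-commutativeMonoid as Σℕ
  open import Algebra.Properties.Semiring.Exp semiring using (_^_)
  import Algebra.Properties.CommutativeSemiring.Binomial commutativeSemiring as Binomial

  -- The linear algebra of the trace form takes these as parameters in place of the value of `size`.
  FrobeniusAdditive FrobeniusPeriodic CharacteristicNot2 : Set
  FrobeniusAdditive  = ∀ x y → pow (x + y) q ≈ pow x q + pow y q
  FrobeniusPeriodic  = ∀ x → pow x (q ℕ.^ n) ≈ x
  CharacteristicNot2 = ¬ (1# + 1# ≈ 0#)

  el : Fin size → Carrier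
  el = lookup elements

  idx : Carrier → Fin size
  idx x = Any.index (complete x)

  el-idx : ∀ x → el (idx x) ≈ x
  el-idx x = sym (lookup-index (complete x))

  lookup-injective : ∀ {xs} → AllPairs (λ x y → ¬ (x ≈ y)) xs →
    ∀ i j → lookup xs i ≈ lookup xs j → i ≡ j
  lookup-injective (x≉ ∷ _)  zero    zero    eq = ≡.refl
  lookup-injective (x≉ ∷ _)  zero    (suc j) eq = ⊥-elim (All.lookup x≉ (∈-lookup j) eq)
  lookup-injective (x≉ ∷ _)  (suc i) zero    eq = ⊥-elim (All.lookup x≉ (∈-lookup i) (sym eq))
  lookup-injective (_ ∷ dis) (suc i) (suc j) eq = ≡.cong suc (lookup-injective dis i j eq)

  el-injective : ∀ {i j} → el i ≈ el j → i ≡ j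
  el-injective = lookup-injective distinct _ _

  idx-unique : ∀ {x i} → el i ≈ x → idx x ≡ i
  idx-unique {x} eq = el-injective (trans (el-idx x) (sym eq))

  infix 4 _≟_
  _≟_ : ∀ x y → Dec (x ≈ y)
  x ≟ y = Dec.map′
    (λ eq → trans (sym (el-idx x)) (trans (reflexive (≡.cong el eq)) (el-idx y)))
    (λ x≈y → idx-unique (trans (el-idx y) (sym x≈y)))
    (idx x Fin.≟ idx y)

  -- _⁻¹ is not assumed to respect ≈, so cancellation is used in place of congruence.
  *-cancelˡ : ∀ {x y z} → ¬ (x ≈ 0#) → x * y ≈ x * z → y ≈ z
  *-cancelˡ {x} {y} {z} x≉0 eq = trans (sym (cancel y)) (trans (*-congˡ eq) (cancel z))
    where
    cancel : ∀ w → x ⁻¹ * (x * w) ≈ w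
    cancel w = trans (sym (*-assoc _ _ _)) (trans (*-congʳ (trans (*-comm _ _) (inverse x x≉0))) (*-identityˡ w))

  *≈0⇒≈0 : ∀ {x y} → ¬ (x ≈ 0#) → x * y ≈ 0# → y ≈ 0#
  *≈0⇒≈0 {x} x≉0 eq = *-cancelˡ x≉0 (trans eq (sym (zeroʳ x)))

  *-≉0 : ∀ {x y} → ¬ (x ≈ 0#) → ¬ (y ≈ 0#) → ¬ (x * y ≈ 0#)
  *-≉0 x≉0 y≉0 eq = y≉0 (*≈0⇒≈0 x≉0 eq)

  pow-≉0 : ∀ {x} → ¬ (x ≈ 0#) → ∀ k → ¬ (pow x k ≈ 0#)
  pow-≉0 x≉0 zero    = nontrivial
  pow-≉0 x≉0 (suc k) = *-≉0 x≉0 (pow-≉0 x≉0 k)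

  prodTo-≉0 : ∀ k {d} → (∀ i → i ℕ.< k → ¬ (d i ≈ 0#)) → ¬ (prodTo k d ≈ 0#)
  prodTo-≉0 zero    d≉0 = nontrivial
  prodTo-≉0 (suc k) d≉0 =
    *-≉0 (prodTo-≉0 k (λ i i<k → d≉0 i (ℕₚ.m<n⇒m<1+n i<k))) (d≉0 k (ℕₚ.n<1+n k))

  inverse-≉0 : ∀ {x} → ¬ (x ≈ 0#) → ¬ (x ⁻¹ ≈ 0#)
  inverse-≉0 {x} x≉0 eq = nontrivial (trans (sym (inverse x x≉0)) (trans (*-congˡ eq) (zeroʳ x)))

  relabel : (g h : Carrier → Carrier) → (∀ {x y} → x ≈ y → g x ≈ g y) → (∀ {x y} → x ≈ y → h x ≈ h y) →
    (∀ x → g (h x) ≈ x) → (∀ x → h (g x) ≈ x) → Permutation size size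
  relabel g h g-cong h-cong gh hg = permutation (idx ∘ g ∘ el) (idx ∘ h ∘ el)
    (λ i → idx-unique (sym (trans (g-cong (el-idx _)) (gh (el i)))))
    (λ i → idx-unique (sym (trans (h-cong (el-idx _)) (hg (el i)))))

  -- Translation by 1 permutes the field, so it preserves the sum of all elements while adding
  -- `size · 1#` to it.
  size·1≈0 : size · 1# ≈ 0#
  size·1≈0 = identityˡ-unique _ (Σ.sum el) (begin
    size · 1# + Σ.sum el                       ≈⟨ +-congʳ (Σ.sum-replicate size) ⟨
    Σ.sum (λ (_ : Fin size) → 1#) + Σ.sum el   ≈⟨ Σ.∑-distrib-+ _ el ⟨
    Σ.sum (λ i → 1# + el i)                    ≈⟨ Σ.sum-cong-≋ (λ i → el-idx (1# + el i)) ⟨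
    Σ.sum (λ i → el (idx (1# + el i)))         ≈⟨ Σ.sum-permute el shift ⟨
    Σ.sum el                                   ∎)
    where
    open import Algebra.Properties.Group +-group using (identityˡ-unique)
    shift = relabel (1# +_) (- 1# +_) +-congˡ +-congˡ
      (λ x → trans (sym (+-assoc _ _ _)) (trans (+-congʳ (-‿inverseʳ 1#)) (+-identityˡ x)))
      (λ x → trans (sym (+-assoc _ _ _)) (trans (+-congʳ (-‿inverseˡ 1#)) (+-identityˡ x)))

  Π-≉0 : ∀ {N} (t : Fin N → Carrier) → (∀ i → ¬ (t i ≈ 0#)) → ¬ (Π.sum t ≈ 0#)
  Π-≉0 {zero}  t t≉0 = nontrivial
  Π-≉0 {suc N} t t≉0 = *-≉0 (t≉0 zero) (Π-≉0 (t ∘ suc) (t≉0 ∘ suc))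

  replicate-pow : ∀ N x → Π.sum (λ (_ : Fin N) → x) ≈ pow x N
  replicate-pow zero    x = refl
  replicate-pow (suc N) x = *-congˡ (replicate-pow N x)

  origin : Fin size
  origin = idx 0#

  origin? : Fin size → Bool
  origin? i = does (i Fin.≟ origin)

  el-≉0 : ∀ {i} → i ≢ origin → ¬ (el i ≈ 0#)
  el-≉0 i≢ eq = i≢ (≡.sym (idx-unique eq))

  0^k : ∀ {k} → 0 ℕ.< k → pow 0# k ≈ 0#
  0^k {suc k} _ = zeroˡ _

  -- Multiplication by `x` permutes the nonzero elements, so the factor `X`, which is x^(size-1),
  -- fixes their product and must be 1. In `units` the zero element is replaced by 1, which keeps
  -- the product nonzero and hence cancellable.
  fermat-≉0 : ∀ {x} → ¬ (x ≈ 0#) → pow x size ≈ x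
  fermat-≉0 {x} x≉0 = begin
    pow x size                      ≈⟨ replicate-pow size x ⟨
    Π.sum (λ (_ : Fin size) → x)    ≈⟨ sum-single *-commutativeMonoid {size} (λ _ → x) origin ⟩
    x * X                           ≈⟨ *-congˡ (*-cancelˡ (Π-≉0 units units≉0) (trans (*-comm _ _) (trans XU≈U (sym (*-identityʳ _))))) ⟩
    x * 1#                          ≈⟨ *-identityʳ x ⟩
    x ∎
    where
    unit : Bool → Carrier → Carrier
    unit b y = if b then 1# else y
    X : Carrier
    X = Π.sum (λ j → unit (origin? j) x)
    units : Fin size → Carrier
    units j = unit (origin? j) (el j)
    units≉0 : ∀ i → ¬ (units i ≈ 0#)
    units≉0 i with i Fin.≟ origin
    ... | yes _  = nontrivial
    ... | no  i≢ = el-≉0 i≢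
    dilate : Permutation size size
    dilate = relabel (x *_) (x ⁻¹ *_) *-congˡ *-congˡ
      (λ y → trans (sym (*-assoc _ _ _)) (trans (*-congʳ (inverse x x≉0)) (*-identityˡ y)))
      (λ y → trans (sym (*-assoc _ _ _)) (trans (*-congʳ (trans (*-comm _ _) (inverse x x≉0))) (*-identityˡ y)))
    split : ∀ j → units (dilate ⟨$⟩ʳ j) ≈ unit (origin? j) x * units j
    split j with j Fin.≟ origin | idx (x * el j) Fin.≟ origin
    ... | yes _  | yes _  = sym (*-identityˡ 1#)
    ... | yes j≡ | no  k≢ = ⊥-elim (k≢ (idx-unique (trans (el-idx 0#)
                              (sym (trans (*-congˡ (trans (reflexive (≡.cong el j≡)) (el-idx 0#))) (zeroʳ x))))))
    ... | no  j≢ | yes k≡ = ⊥-elim (*-≉0 x≉0 (el-≉0 j≢)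
                              (trans (sym (el-idx _)) (trans (reflexive (≡.cong el k≡)) (el-idx 0#))))
    ... | no  _  | no  _  = el-idx _
    XU≈U : X * Π.sum units ≈ Π.sum units
    XU≈U = begin
      X * Π.sum units                                  ≈⟨ Π.∑-distrib-+ _ units ⟨
      Π.sum (λ j → unit (origin? j) x * units j)       ≈⟨ Π.sum-cong-≋ split ⟨
      Π.sum (λ j → units (dilate ⟨$⟩ʳ j))              ≈⟨ Π.sum-permute units dilate ⟨
      Π.sum units ∎

  size>0 : 0 ℕ.< size
  size>0 = ℕₚ.≤-<-trans z≤n (Finₚ.toℕ<n origin)

  fermat : ∀ x → pow x size ≈ x
  fermat x with x ≟ 0#
  ... | yes x≈0 = trans (pow-cong size x≈0) (trans (0^k size>0) (sym x≈0))
  ... | no  x≉0 = fermat-≉0 x≉0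

  pow-≡ : ∀ x {j k} → j ≡ k → pow x j ≈ pow x k
  pow-≡ x eq = reflexive (≡.cong (pow x) eq)

  -- Subsets of the field are given by characteristic functions on the enumeration.
  remove : (Fin size → Bool) → Fin size → Fin size → Bool
  remove P i j = if does (j Fin.≟ i) then false else P j

  product : (Fin size → Bool) → Carrier
  product P = Π.sum (λ i → if P i then el i else 1#)

  count : (Fin size → Bool) → ℕ
  count P = Σℕ.sum (λ i → if P i then 1 else 0)

  if-push : ∀ {X : Set} (b c : Bool) (x y : X) →
    (if b then y else (if c then x else y)) ≡ (if (if b then false else c) then x else y)
  if-push true  c x y = ≡.refl
  if-push false c x y = ≡.refl

  product-remove : ∀ P i → P i ≡ true → product P ≈ el i * product (remove P i)
  product-remove P i Pi = trans (sum-single *-commutativeMonoid (λ i → if P i then el i else 1#) i)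
    (*-cong (reflexive (≡.cong (λ b → if b then el i else 1#) Pi))
      (Π.sum-cong-≋ (λ j → reflexive (if-push (does (j Fin.≟ i)) (P j) (el j) 1#))))

  count-remove : ∀ P i → P i ≡ true → count P ≡ suc (count (remove P i))
  count-remove P i Pi = ≡.trans (sum-single ℕₚ.+-0-commutativeMonoid (λ i → if P i then 1 else 0) i)
    (≡.cong₂ ℕ._+_ (≡.cong (λ b → if b then 1 else 0) Pi)
      (Σℕ.sum-cong-≗ (λ j → if-push (does (j Fin.≟ i)) (P j) 1 0)))

  remove-true : ∀ P i j → remove P i j ≡ true → j ≢ i × P j ≡ true
  remove-true P i j eq with j Fin.≟ i
  ... | no j≢i = j≢i , eq

  remove-≢ : ∀ P i j → j ≢ i → remove P i j ≡ P j
  remove-≢ P i j j≢i with j Fin.≟ i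
  ... | yes j≡i = ⊥-elim (j≢i j≡i)
  ... | no  _   = ≡.refl

  product-empty : ∀ P → (∀ i → P i ≡ false) → product P ≈ 1#
  product-empty P empty = trans
    (Π.sum-cong-≋ (λ i → reflexive (≡.cong (λ b → if b then el i else 1#) (empty i))))
    (Π.sum-replicate-zero size)

  count-empty : ∀ P → (∀ i → P i ≡ false) → count P ≡ 0
  count-empty P empty = ≡.trans (Σℕ.sum-cong-≗ (λ i → ≡.cong (λ b → if b then 1 else 0) (empty i)))
    (Σℕ.sum-replicate-zero size)

  -- A subset stable under a fixed-point-free involution y ↦ c / y splits into pairs of product c.
  product-pairs : ∀ c (τ : Fin size → Fin size) (P : Fin size → Bool) →
    (∀ i → P i ≡ true → P (τ i) ≡ true × τ i ≢ i × τ (τ i) ≡ i × el i * el (τ i) ≈ c) →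
    ∃ λ h → count P ≡ h ℕ.+ h × product P ≈ pow c h
  product-pairs c τ P = go (count P) P ℕₚ.≤-refl
    where
    go : ∀ fuel P → count P ℕ.≤ fuel →
      (∀ i → P i ≡ true → P (τ i) ≡ true × τ i ≢ i × τ (τ i) ≡ i × el i * el (τ i) ≈ c) →
      ∃ λ h → count P ≡ h ℕ.+ h × product P ≈ pow c h
    go fuel P fits pairs with Finₚ.any? (λ i → P i Bool.≟ true)
    go fuel P fits pairs | no none =
      0 , count-empty P empty , product-empty P empty
      where
      empty : ∀ i → P i ≡ false
      empty i = Boolₚ.¬-not (λ eq → none (i , eq))
    go zero P fits pairs | yes (i , Pi) =
      ⊥-elim (ℕₚ.n≮0 (≡.subst (ℕ._≤ 0) (count-remove P i Pi) fits))
    go (suc fuel) P fits pairs | yes (i , Pi) with pairs i Pi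
    ... | Pτ , τ≢ , ττ , prod with go fuel P″ fits″ pairs″
      where
      P″ : Fin size → Bool
      P″ = remove (remove P i) (τ i)
      Pτ′ : remove P i (τ i) ≡ true
      Pτ′ = ≡.trans (remove-≢ P i (τ i) τ≢) Pτ
      fits″ : count P″ ℕ.≤ fuel
      fits″ = ℕₚ.≤-trans (ℕₚ.n≤1+n _) (ℕ.s≤s⁻¹ (≡.subst (ℕ._≤ suc fuel)
        (≡.trans (count-remove P i Pi) (≡.cong suc (count-remove (remove P i) (τ i) Pτ′))) fits))
      pairs″ : ∀ j → P″ j ≡ true → P″ (τ j) ≡ true × τ j ≢ j × τ (τ j) ≡ j × el j * el (τ j) ≈ c
      pairs″ j P″j with remove-true (remove P i) (τ i) j P″j
      ... | j≢τi , P′j with remove-true P i j P′j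
      ... | j≢i , Pj with pairs j Pj
      ... | Pτj , τj≢j , ττj , prodj =
        ≡.trans (remove-≢ (remove P i) (τ i) (τ j) (λ eq → j≢i (≡.trans (≡.sym ττj) (≡.trans (≡.cong τ eq) ττ))))
          (≡.trans (remove-≢ P i (τ j) (λ eq → j≢τi (≡.trans (≡.sym ττj) (≡.cong τ eq)))) Pτj) ,
        τj≢j , ττj , prodj
    ... | h , counted , product≈ = suc h ,
      ≡.trans (count-remove P i Pi) (≡.cong suc (≡.trans (count-remove (remove P i) (τ i) Pτ′)
        (≡.trans (≡.cong suc counted) (≡.sym (ℕₚ.+-suc h h))))) ,
      (begin
        product P                                                  ≈⟨ product-remove P i Pi ⟩
        el i * product (remove P i)                                ≈⟨ *-congˡ (product-remove (remove P i) (τ i) Pτ′) ⟩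
        el i * (el (τ i) * product (remove (remove P i) (τ i)))    ≈⟨ *-assoc _ _ _ ⟨
        (el i * el (τ i)) * product (remove (remove P i) (τ i))    ≈⟨ *-cong prod product≈ ⟩
        c * pow c h                                                ∎)
      where
      Pτ′ : remove P i (τ i) ≡ true
      Pτ′ = ≡.trans (remove-≢ P i (τ i) τ≢) Pτ

  module OddSize (H : ℕ) (size≡ : size ≡ suc (H ℕ.+ H)) where

    -- If 2 were 0, then size · 1 = 0 with size = 1 + 2H would collapse to 1 = 0.
    2≉0 : ¬ (1# + 1# ≈ 0#)
    2≉0 2≈0 = nontrivial (begin
      1#                                     ≈⟨ +-identityʳ 1# ⟨
      1# + 0#                                ≈⟨ +-congˡ (trans (*-congʳ 2≈0) (zeroˡ (H · 1#))) ⟨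
      1# + (1# + 1#) * (H · 1#)              ≈⟨ +-congˡ (trans (distribʳ _ _ _) (+-cong (*-identityˡ _) (*-identityˡ _))) ⟩
      1# + (H · 1# + H · 1#)                 ≈⟨ +-congˡ (×-homo-+ 1# H H) ⟨
      suc (H ℕ.+ H) · 1#                     ≈⟨ ×-congˡ (≡.sym size≡) ⟩
      size · 1#                              ≈⟨ size·1≈0 ⟩
      0# ∎)

    1≉-1 : ¬ (1# ≈ - 1#)
    1≉-1 eq = 2≉0 (trans (+-congˡ eq) (-‿inverseʳ 1#))

    -1≉0 : ¬ (- 1# ≈ 0#)
    -1≉0 eq = nontrivial (trans (sym (-‿involutive 1#)) (trans (-‿cong eq) -0#≈0#))

    x²≈1⇒x≈±1 : ∀ {x} → x * x ≈ 1# → x ≈ 1# ⊎ x ≈ - 1#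
    x²≈1⇒x≈±1 {x} x²≈1 with x ≟ 1#
    ... | yes x≈1 = inj₁ x≈1
    ... | no  x≉1 = inj₂ (+-inverseˡ-unique x 1# (*≈0⇒≈0 (λ x-1≈0 → x≉1 (x∙y⁻¹≈ε⇒x≈y x 1# x-1≈0)) (begin
      (x - 1#) * (x + 1#)                ≈⟨ solve 2 (λ x m → (x :+ m) :* (x :+ con 1) := x :* x :+ (x :+ m :* x) :+ m) refl x (- 1#) ⟩
      x * x + (x + - 1# * x) + - 1#      ≈⟨ +-congʳ (+-cong x²≈1 (trans (+-congˡ (-1*x≈-x x)) (-‿inverseʳ x))) ⟩
      1# + 0# - 1#                       ≈⟨ trans (+-congʳ (+-identityʳ 1#)) (-‿inverseʳ 1#) ⟩
      0# ∎)))

    units : Fin size → Bool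
    units = remove (λ _ → true) origin

    units-≉0 : ∀ i → units i ≡ true → ¬ (el i ≈ 0#)
    units-≉0 i eq = el-≉0 (proj₁ (remove-true (λ _ → true) origin i eq))

    ≉0-units : ∀ i → ¬ (el i ≈ 0#) → units i ≡ true
    ≉0-units i el≉0 = remove-≢ (λ _ → true) origin i
      (λ eq → el≉0 (trans (reflexive (≡.cong el eq)) (el-idx 0#)))

    count-units : count units ≡ H ℕ.+ H
    count-units = ℕₚ.suc-injective (≡.trans
      (≡.sym (count-remove (λ _ → true) origin ≡.refl)) (≡.trans count-all size≡))
      where
      count-all : count (λ _ → true) ≡ size
      count-all = go size
        where
        go : ∀ N → Σℕ.sum {N} (λ _ → 1) ≡ N
        go zero    = ≡.refl
        go (suc N) = ≡.cong suc (go N)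

    module _ {c : Carrier} (c≉0 : ¬ (c ≈ 0#)) where

      quotient : Fin size → Fin size
      quotient i = idx (c * (el i) ⁻¹)

      quotient-* : ∀ i → ¬ (el i ≈ 0#) → el i * el (quotient i) ≈ c
      quotient-* i el≉0 = begin
        el i * el (quotient i)     ≈⟨ *-congˡ (el-idx _) ⟩
        el i * (c * (el i) ⁻¹)     ≈⟨ solve 3 (λ x c y → x :* (c :* y) := c :* (x :* y)) refl _ _ _ ⟩
        c * (el i * (el i) ⁻¹)     ≈⟨ *-congˡ (inverse (el i) el≉0) ⟩
        c * 1#                     ≈⟨ *-identityʳ c ⟩
        c ∎

      quotient-≉0 : ∀ i → ¬ (el i ≈ 0#) → ¬ (el (quotient i) ≈ 0#)
      quotient-≉0 i el≉0 eq = c≉0 (trans (sym (quotient-* i el≉0)) (trans (*-congˡ eq) (zeroʳ _)))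

      quotient-involutive : ∀ i → ¬ (el i ≈ 0#) → quotient (quotient i) ≡ i
      quotient-involutive i el≉0 = el-injective (*-cancelˡ (quotient-≉0 i el≉0)
        (trans (quotient-* (quotient i) (quotient-≉0 i el≉0)) (sym (trans (*-comm _ _) (quotient-* i el≉0)))))

    -- Pairing y with 1/y leaves out exactly the solutions of y² = 1, which are 1 and -1, and every
    -- pair has product 1.
    wilson : product units ≈ - 1#
    wilson = begin
      product units                                    ≈⟨ product-remove units i₁ 1∈units ⟩
      el i₁ * product P₁                               ≈⟨ *-cong (el-idx 1#) (product-remove P₁ i₋₁ -1∈P₁) ⟩
      1# * (el i₋₁ * product P₂)                       ≈⟨ trans (*-identityˡ _) (*-congʳ (el-idx (- 1#))) ⟩
      - 1# * product P₂                                ≈⟨ *-congˡ (proj₂ (proj₂ paired)) ⟩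
      - 1# * pow 1# (proj₁ paired)                     ≈⟨ trans (*-congˡ (pow-1# (proj₁ paired))) (*-identityʳ _) ⟩
      - 1# ∎
      where
      i₁ i₋₁ : Fin size
      i₁  = idx 1#
      i₋₁ = idx (- 1#)
      P₁ P₂ : Fin size → Bool
      P₁ = remove units i₁
      P₂ = remove P₁ i₋₁
      1∈units : units i₁ ≡ true
      1∈units = ≉0-units i₁ (λ eq → nontrivial (trans (sym (el-idx 1#)) eq))
      -1∈P₁ : P₁ i₋₁ ≡ true
      -1∈P₁ = ≡.trans
        (remove-≢ units i₁ i₋₁ (λ eq → 1≉-1 (trans (sym (el-idx 1#)) (trans (reflexive (≡.cong el (≡.sym eq))) (el-idx (- 1#))))))
        (≉0-units i₋₁ (λ eq → -1≉0 (trans (sym (el-idx _)) eq)))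
      member : ∀ i → P₂ i ≡ true → ¬ (el i ≈ 0#) × ¬ (el i ≈ 1#) × ¬ (el i ≈ - 1#)
      member i P₂i with remove-true P₁ i₋₁ i P₂i
      ... | i≢i₋₁ , P₁i with remove-true units i₁ i P₁i
      ... | i≢i₁ , Ui = units-≉0 i Ui , (λ eq → i≢i₁ (≡.sym (idx-unique eq))) , (λ eq → i≢i₋₁ (≡.sym (idx-unique eq)))
      τ : Fin size → Fin size
      τ = quotient nontrivial
      self-inverse : ∀ {x y} → x * y ≈ 1# → x * x ≈ 1# → y ≈ x
      self-inverse {x} xy≈1 xx≈1 = *-cancelˡ
        (λ x≈0 → nontrivial (trans (sym xx≈1) (trans (*-congʳ x≈0) (zeroˡ x)))) (trans xy≈1 (sym xx≈1))
      paired : ∃ λ h → count P₂ ≡ h ℕ.+ h × product P₂ ≈ pow 1# h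
      paired = product-pairs 1# τ P₂ λ i P₂i →
        let (i≉0 , i≉1 , i≉-1) = member i P₂i
            i*τ = quotient-* nontrivial i i≉0
            avoid : ∀ {c} → c * c ≈ 1# → ¬ (el i ≈ c) → τ i ≢ idx c
            avoid {c} cc≈1 i≉c eq = i≉c (self-inverse
              (trans (*-comm c _) (trans (*-congˡ (trans (sym (el-idx c)) (reflexive (≡.cong el (≡.sym eq))))) i*τ)) cc≈1)
        in
        ≡.trans (remove-≢ P₁ i₋₁ (τ i) (avoid (trans (-1*x≈-x (- 1#)) (-‿involutive 1#)) i≉-1))
          (≡.trans (remove-≢ units i₁ (τ i) (avoid (*-identityˡ 1#) i≉1))
            (≉0-units (τ i) (quotient-≉0 nontrivial i i≉0))) ,
        (λ τi≡i → [ i≉1 , i≉-1 ]′ (x²≈1⇒x≈±1 (trans (*-congˡ (reflexive (≡.cong el (≡.sym τi≡i)))) i*τ))) ,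
        quotient-involutive nontrivial i i≉0 ,
        i*τ

    -- For a nonsquare x the involution y ↦ x/y has no fixed point, so the 2H units split into H
    -- pairs of product x. Wilson's theorem evaluates the same product as -1.
    nonsquare-pow : ∀ {x} → ¬ (x ≈ 0#) → ¬ IsSquare x → pow x H ≈ - 1#
    nonsquare-pow {x} x≉0 nonsquare =
      trans (pow-≡ x H≡h) (trans (sym (proj₂ (proj₂ paired))) wilson)
      where
      paired : ∃ λ h → count units ≡ h ℕ.+ h × product units ≈ pow x h
      paired = product-pairs x (quotient x≉0) units λ i Ui →
        let i≉0 = units-≉0 i Ui in
        ≉0-units _ (quotient-≉0 x≉0 i i≉0) ,
        (λ eq → nonsquare (el i , trans (*-congˡ (reflexive (≡.cong el (≡.sym eq)))) (quotient-* x≉0 i i≉0))) ,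
        quotient-involutive x≉0 i i≉0 ,
        quotient-* x≉0 i i≉0
      h : ℕ
      h = proj₁ paired
      H≡h : H ≡ h
      H≡h = ≡.trans (ℕₚ.n≡⌊n+n/2⌋ H) (≡.trans
        (≡.cong ℕ.⌊_/2⌋ (≡.trans (≡.sym count-units) (proj₁ (proj₂ paired)))) (≡.sym (ℕₚ.n≡⌊n+n/2⌋ h)))

    pow≈1⇒square : ∀ {x} → ¬ (x ≈ 0#) → pow x H ≈ 1# → IsSquare x
    pow≈1⇒square {x} x≉0 x^H≈1 with Finₚ.any? (λ i → el i * el i ≟ x)
    ... | yes (i , eq) = el i , eq
    ... | no  none     = ⊥-elim (1≉-1 (trans (sym x^H≈1) (nonsquare-pow x≉0 (λ (y , yy≈x) →
            none (idx y , trans (*-cong (el-idx y) (el-idx y)) yy≈x)))))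

  pow≈^ : ∀ x k → pow x k ≈ x ^ k
  pow≈^ x zero    = refl
  pow≈^ x (suc k) = *-congˡ (pow≈^ x k)

  module PrimeCharacteristic {p : ℕ} (pr : Prime p) (p·1≈0 : p · 1# ≈ 0#) where

    ·≈0 : ∀ {c} → p ∣ c → ∀ x → c · x ≈ 0#
    ·≈0 (divides j ≡.refl) x = begin
      (j ℕ.* p) · x          ≈⟨ ×-assocˡ x j p ⟨
      j · (p · x)            ≈⟨ ×-congʳ j (×-congʳ p (*-identityˡ x)) ⟨
      j · (p · (1# * x))     ≈⟨ ×-congʳ j (×-assoc-* p 1# x) ⟨
      j · ((p · 1#) * x)     ≈⟨ ×-congʳ j (trans (*-congʳ p·1≈0) (zeroˡ x)) ⟩
      j · 0#                 ≈⟨ trans (×-congʳ j (sym (zeroʳ 1#))) (trans (sym (×-assoc-* j 1# 0#)) (zeroʳ _)) ⟩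
      0# ∎

    pow-p-+ : ∀ x y → pow (x + y) p ≈ pow x p + pow y p
    pow-p-+ x y = trans (pow≈^ (x + y) p) (trans (Binomial.theorem p x y)
      (trans (expansion p ≡.refl) (sym (trans (+-cong (pow≈^ x p) (pow≈^ y p)) (+-comm _ _)))))
      where
      -- `p` is a parameter of the module and cannot be matched on, so a copy tied to it by an
      -- equation is. The successor form exposes the two end terms of the binomial sum, the only
      -- ones not divisible by p.
      expansion : ∀ p′ → p′ ≡ p → Binomial.binomialExpansion x y p′ ≈ y ^ p′ + x ^ p′
      expansion zero    ≡.refl = ⊥-elim (ℕ.≢-nonZero⁻¹ 0 {{prime⇒nonZero pr}} ≡.refl)
      expansion (suc k) ≡.refl = +-cong first (trans (Σ.sum-init-last rest) (trans (+-cong middle last) (+-identityˡ _)))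
        where
        term = Binomial.binomialTerm x y (suc k)
        rest : Fin (suc k) → Carrier
        rest i = term (suc i)
        first : term zero ≈ y ^ suc k
        first = trans (×-congˡ (≡.trans (nCk≡nC[n∸k] {0} {suc k} z≤n) (nCn≡1 (suc k))))
          (trans (×-homo-1 _) (*-identityˡ _))
        middle : Σ.sum (λ i → rest (inject₁ i)) ≈ 0#
        middle = trans (Σ.sum-cong-≋ (λ i → ·≈0 (p∣pCk pr (suc (toℕ (inject₁ i))) (s≤s z≤n)
            (s≤s (≡.subst (ℕ._< k) (≡.sym (Finₚ.toℕ-inject₁ i)) (Finₚ.toℕ<n i)))) _))
          (Σ.sum-replicate-zero k)
        last : rest (fromℕ k) ≈ x ^ suc k
        last = begin
          (suc k C suc (toℕ (fromℕ k))) · (x ^ suc (toℕ (fromℕ k)) * y ^ (suc k ℕ.∸ suc (toℕ (fromℕ k))))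
            ≡⟨ ≡.cong (λ j → (suc k C suc j) · (x ^ suc j * y ^ (k ℕ.∸ j))) (Finₚ.toℕ-fromℕ k) ⟩
          (suc k C suc k) · (x ^ suc k * y ^ (k ℕ.∸ k))
            ≈⟨ ×-congˡ (nCn≡1 (suc k)) ⟩
          1 · (x ^ suc k * y ^ (k ℕ.∸ k))
            ≈⟨ ×-homo-1 _ ⟩
          x ^ suc k * y ^ (k ℕ.∸ k)
            ≡⟨ ≡.cong (λ j → x ^ suc k * y ^ j) (ℕₚ.n∸n≡0 k) ⟩
          x ^ suc k * 1#
            ≈⟨ *-identityʳ _ ⟩
          x ^ suc k ∎

    pow-p^-+ : ∀ k x y → pow (x + y) (p ℕ.^ k) ≈ pow x (p ℕ.^ k) + pow y (p ℕ.^ k)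
    pow-p^-+ zero    x y = trans (pow-one _) (sym (+-cong (pow-one x) (pow-one y)))
    pow-p^-+ (suc k) x y = begin
      pow (x + y) (p ℕ.* p ℕ.^ k)                              ≈⟨ pow-pow _ p (p ℕ.^ k) ⟨
      pow (pow (x + y) (p ℕ.^ k)) p                            ≈⟨ pow-cong p (pow-p^-+ k x y) ⟩
      pow (pow x (p ℕ.^ k) + pow y (p ℕ.^ k)) p                ≈⟨ pow-p-+ _ _ ⟩
      pow (pow x (p ℕ.^ k)) p + pow (pow y (p ℕ.^ k)) p        ≈⟨ +-cong (pow-pow x p _) (pow-pow y p _) ⟩
      pow x (p ℕ.* p ℕ.^ k) + pow y (p ℕ.* p ℕ.^ k)            ∎

  -- m^k · 1 is the k-th power of m · 1, and a field has no nonzero nilpotents.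
  ^·1≈0⇒·1≈0 : ∀ m k → (m ℕ.^ k) · 1# ≈ 0# → m · 1# ≈ 0#
  ^·1≈0⇒·1≈0 m zero    eq = ⊥-elim (nontrivial (trans (sym (×-homo-1 1#)) eq))
  ^·1≈0⇒·1≈0 m (suc k) eq with m · 1# ≟ 0#
  ... | yes m≈0 = m≈0
  ... | no  m≉0 = ^·1≈0⇒·1≈0 m k (*≈0⇒≈0 m≉0 (trans (sym (×1-homo-* m (m ℕ.^ k))) eq))

  -- The characteristic is not part of the data of `FiniteField`. It is recovered from size · 1 = 0:
  -- since size = (p^k)^n, two root extractions give p · 1 = 0.
  frobenius-+ : IsPrimePower q → size ≡ q ℕ.^ n → ∀ x y → pow (x + y) q ≈ pow x q + pow y q
  frobenius-+ (p , k , pr , 0<k , q≡p^k) size≡ x y = trans (pow-≡ _ q≡p^k)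
    (trans (PrimeCharacteristic.pow-p^-+ pr p·1≈0 k x y) (sym (+-cong (pow-≡ x q≡p^k) (pow-≡ y q≡p^k))))
    where
    p·1≈0 : p · 1# ≈ 0#
    p·1≈0 = ^·1≈0⇒·1≈0 p k (^·1≈0⇒·1≈0 (p ℕ.^ k) n
      (trans (×-congˡ (≡.sym (≡.trans size≡ (≡.cong (ℕ._^ n) q≡p^k)))) size·1≈0))

-- Inverse matrices by cofactors

module LinearAlgebra (F : FiniteField) (q n : ℕ) (a : ℕ → FiniteField.Carrier F) where
  open FiniteField F hiding (zero)
  open Setup F q n a
  open Determinants F q n a
  open FieldFacts F q n a
  open import Relation.Binary.Reasoning.Setoid setoid
  open import Algebra.Properties.Ring ring
  open import Algebra.Solver.Ring.NaturalCoefficients.Default commutativeSemiring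
    using (solve; _:=_; _:*_)

  kron : ℕ → ℕ → Carrier
  kron i j = if i ≡ᵇ j then 1# else 0#

  kron-refl : ∀ i → kron i i ≈ 1#
  kron-refl zero    = refl
  kron-refl (suc i) = kron-refl i

  kron-≢ : ∀ i j → i ≢ j → kron i j ≈ 0#
  kron-≢ zero    zero    i≢j = ⊥-elim (i≢j ≡.refl)
  kron-≢ zero    (suc j) i≢j = refl
  kron-≢ (suc i) zero    i≢j = refl
  kron-≢ (suc i) (suc j) i≢j = kron-≢ i j (i≢j ∘ ≡.cong suc)

  kron-sym : ∀ i j → kron i j ≈ kron j i
  kron-sym zero    zero    = refl
  kron-sym zero    (suc j) = refl
  kron-sym (suc i) zero    = refl
  kron-sym (suc i) (suc j) = kron-sym i j

  skip-≢ : ∀ l s → l ≢ skip l s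
  skip-≢ zero    s       ()
  skip-≢ (suc l) zero    ()
  skip-≢ (suc l) (suc s) eq = skip-≢ l s (ℕₚ.suc-injective (≡.trans eq (skip-suc l s)))

  skip-surjective : ∀ {k} l i → l ≢ i → l ℕ.≤ k → i ℕ.≤ k → ∃ λ s → s ℕ.< k × skip l s ≡ i
  skip-surjective zero    zero    l≢i l≤k i≤k = ⊥-elim (l≢i ≡.refl)
  skip-surjective zero    (suc i) l≢i l≤k i≤k = i , i≤k , ≡.refl
  skip-surjective (suc l) zero    l≢i l≤k i≤k = 0 , ℕₚ.<-≤-trans (s≤s z≤n) l≤k , ≡.refl
  skip-surjective (suc l) (suc i) l≢i (s≤s l≤k) (s≤s i≤k)
    with skip-surjective l i (l≢i ∘ ≡.cong suc) l≤k i≤k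
  ... | s , s<k , eq = suc s , s≤s s<k , ≡.trans (skip-suc l s) (≡.cong suc eq)

  sumTo-kron : ∀ k i (f : ℕ → Carrier) → i ℕ.< k → sumTo k (λ l → kron i l * f l) ≈ f i
  sumTo-kron (suc k) i f (s≤s i≤k) = begin
    sumTo (suc k) (λ l → kron i l * f l)
      ≈⟨ sumTo-skip k _ i i≤k ⟩
    kron i i * f i + sumTo k (λ l → kron i (skip i l) * f (skip i l))
      ≈⟨ +-cong (trans (*-congʳ (kron-refl i)) (*-identityˡ _))
           (sumTo-0# k (λ l _ → trans (*-congʳ (kron-≢ i _ (skip-≢ i l))) (zeroˡ _))) ⟩
    f i + 0#
      ≈⟨ +-identityʳ _ ⟩
    f i ∎

  -1²≈1 : - 1# * - 1# ≈ 1#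
  -1²≈1 = trans (-1*x≈-x (- 1#)) (-‿involutive 1#)

  -1^-square : ∀ l → -1^ l * -1^ l ≈ 1#
  -1^-square l = trans (sym (pow-distrib-* (- 1#) (- 1#) l)) (trans (pow-cong l -1²≈1) (pow-1# l))

  -1^-cancel : ∀ l x → -1^ l * (-1^ l * x) ≈ x
  -1^-cancel l x = trans (sym (*-assoc _ _ _)) (trans (*-congʳ (-1^-square l)) (*-identityˡ x))

  alternating-repeat : ∀ k {D} → IsAlternating (suc k) D → ∀ (u : ℕ → Column) s → s ℕ.< k →
    D (u s ∷ tab k u) ≈ 0#
  alternating-repeat (suc k) {D} alt u s (s≤s s≤k) = begin
    D (u s ∷ tab (suc k) u)                              ≈⟨ -1^-cancel s _ ⟨
    -1^ s * (-1^ s * D (u s ∷ tab (suc k) u))            ≈⟨ *-congˡ (alternating-move k (tail-alternating alt (u s)) u s s≤k) ⟨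
    -1^ s * D (u s ∷ u s ∷ tab k (u ∘ skip s))           ≈⟨ trans (*-congˡ (head-alternating alt (u s) _)) (zeroʳ _) ⟩
    0# ∎

  -- The adjugate over the determinant, stored transposed: the value at `l`, `s` is the entry of the
  -- inverse in row s and column l. The rows of `X` are fed to `cofactors` as columns.
  rightInverse : ℕ → (ℕ → ℕ → Carrier) → ℕ → ℕ → Carrier
  rightInverse zero    X l s = 0#
  rightInverse (suc k) X l s = det (suc k) X ⁻¹ * (-1^ l * cofactors (tab k (X ∘ skip l)) s)

  -- Up to the factor 1/det, the sum is the determinant of `X` with row l replaced by row i. It is
  -- det X when i = l and has a repeated row otherwise.
  rightInverse-* : ∀ k X → ¬ (det k X ≈ 0#) → ∀ i l → i ℕ.< k → l ℕ.< k →
    sumTo k (λ s → X i s * rightInverse k X l s) ≈ kron i l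
  rightInverse-* (suc k) X det≉0 i l (s≤s i≤k) (s≤s l≤k) = begin
    sumTo (suc k) (λ s → X i s * (d * (-1^ l * cof s)))
      ≈⟨ sumTo-cong (suc k) (λ s _ →
           solve 4 (λ x d m c → x :* (d :* (m :* c)) := d :* (m :* (x :* c))) refl (X i s) d (-1^ l) (cof s)) ⟩
    sumTo (suc k) (λ s → d * (-1^ l * (X i s * cof s)))
      ≈⟨ trans (*-congˡ (*-sumTo (suc k) _ _)) (*-sumTo (suc k) _ _) ⟨
    d * (-1^ l * sumTo (suc k) (λ s → X i s * cof s))
      ≈⟨ *-congˡ (*-congˡ (det-cofactors k (X i) _)) ⟨
    d * (-1^ l * det (suc k) (mat (X i ∷ tab k (X ∘ skip l))))
      ≈⟨ entry (l ℕ.≟ i) ⟩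
    kron i l ∎
    where
    d = det (suc k) X ⁻¹
    cof = cofactors (tab k (X ∘ skip l))
    alt = det-isAlternating (suc k)
    entry : Dec (l ≡ i) → d * (-1^ l * det (suc k) (mat (X i ∷ tab k (X ∘ skip l)))) ≈ kron i l
    entry (yes ≡.refl) = begin
      d * (-1^ l * det (suc k) (mat (X l ∷ tab k (X ∘ skip l))))
        ≈⟨ *-congˡ (*-congˡ (alternating-move k alt X l l≤k)) ⟩
      d * (-1^ l * (-1^ l * detCols (suc k) X))
        ≈⟨ *-congˡ (-1^-cancel l _) ⟩
      d * detCols (suc k) X
        ≈⟨ *-congˡ (trans (detCols-det (suc k) X) (det-transpose (suc k) X)) ⟩
      d * det (suc k) X
        ≈⟨ trans (*-comm _ _) (inverse _ det≉0) ⟩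
      1#
        ≈⟨ kron-refl l ⟨
      kron l l ∎
    entry (no l≢i) with skip-surjective l i l≢i l≤k i≤k
    ... | s , s<k , ≡.refl = begin
      d * (-1^ l * det (suc k) (mat (X (skip l s) ∷ tab k (X ∘ skip l))))
        ≈⟨ *-congˡ (*-congˡ (alternating-repeat k alt (X ∘ skip l) s s<k)) ⟩
      d * (-1^ l * 0#)
        ≈⟨ trans (*-congˡ (zeroʳ _)) (zeroʳ _) ⟩
      0#
        ≈⟨ kron-≢ (skip l s) l (l≢i ∘ ≡.sym) ⟨
      kron (skip l s) l ∎

  -- Cancelling `X` on the left takes a left inverse, which is the right inverse of the transposed
  -- matrix.
  kernel-trivial : ∀ k X → ¬ (det k X ≈ 0#) → ∀ g →
    (∀ i → i ℕ.< k → sumTo k (λ s → X i s * g s) ≈ 0#) → ∀ l → l ℕ.< k → g l ≈ 0#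
  kernel-trivial k X det≉0 g Xg≈0 l l<k = begin
    g l
      ≈⟨ sumTo-kron k l g l<k ⟨
    sumTo k (λ s → kron l s * g s)
      ≈⟨ sumTo-cong k (λ s s<k → trans (*-congʳ (trans (kron-sym l s)
           (sym (rightInverse-* k (λ i j → X j i) (λ eq → det≉0 (trans (sym (det-transpose k X)) eq)) s l s<k l<k))))
           (sumTo-* k (g s) _)) ⟩
    sumTo k (λ s → sumTo k (λ i → (X i s * y i) * g s))
      ≈⟨ sumTo-swap k k _ ⟩
    sumTo k (λ i → sumTo k (λ s → (X i s * y i) * g s))
      ≈⟨ sumTo-cong k (λ i _ → trans (sumTo-cong k (λ s _ →
           solve 3 (λ x y g → (x :* y) :* g := y :* (x :* g)) refl (X i s) (y i) (g s))) (sym (*-sumTo k (y i) _))) ⟩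
    sumTo k (λ i → y i * sumTo k (λ s → X i s * g s))
      ≈⟨ sumTo-0# k (λ i i<k → trans (*-congˡ (Xg≈0 i i<k)) (zeroʳ _)) ⟩
    0# ∎
    where
    y = rightInverse k (λ i j → X j i) l

-- Frobenius powers, the trace and Moore determinants

module LinearisedPolynomials (F : FiniteField) (q n : ℕ) (a : ℕ → FiniteField.Carrier F)
  (pow-q-+ : FieldFacts.FrobeniusAdditive F q n a)
  (pow-q^n : FieldFacts.FrobeniusPeriodic F q n a) where
  open FiniteField F hiding (zero)
  open Setup F q n a
  open Determinants F q n a
  open FieldFacts F q n a
  open LinearAlgebra F q n a
  open import Relation.Binary.Reasoning.Setoid setoid
  open import Algebra.Properties.Ring ring
  open import Algebra.Solver.Ring.NaturalCoefficients.Default commutativeSemiring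
    using (solve; _:=_; _:+_; _:*_)

  φ : ℕ → Carrier → Carrier
  φ s x = pow x (q ℕ.^ s)

  φ-cong : ∀ s {x y} → x ≈ y → φ s x ≈ φ s y
  φ-cong s = pow-cong (q ℕ.^ s)

  φ-≡ : ∀ {s t} x → s ≡ t → φ s x ≈ φ t x
  φ-≡ x eq = reflexive (≡.cong (λ s → φ s x) eq)

  φ-zero : ∀ x → φ 0 x ≈ x
  φ-zero = pow-one

  φ-suc : ∀ s x → φ (suc s) x ≈ pow (φ s x) q
  φ-suc s x = sym (pow-pow x q (q ℕ.^ s))

  φ-one : ∀ x → φ 1 x ≈ pow x q
  φ-one x = pow-≡ x (ℕₚ.*-identityʳ q)

  φ-φ : ∀ s t x → φ s (φ t x) ≈ φ (s ℕ.+ t) x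
  φ-φ s t x = trans (pow-pow x (q ℕ.^ s) (q ℕ.^ t)) (pow-≡ x (≡.sym (ℕₚ.^-distribˡ-+-* q s t)))

  φ-* : ∀ s x y → φ s (x * y) ≈ φ s x * φ s y
  φ-* s x y = pow-distrib-* x y (q ℕ.^ s)

  φ-+ : ∀ s x y → φ s (x + y) ≈ φ s x + φ s y
  φ-+ zero    x y = trans (φ-zero _) (sym (+-cong (φ-zero x) (φ-zero y)))
  φ-+ (suc s) x y = trans (φ-suc s (x + y)) (trans (pow-cong q (φ-+ s x y))
    (trans (pow-q-+ _ _) (sym (+-cong (φ-suc s x) (φ-suc s y)))))

  φ-1# : ∀ s → φ s 1# ≈ 1#
  φ-1# s = pow-1# (q ℕ.^ s)

  φ-0# : ∀ s → φ s 0# ≈ 0#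
  φ-0# s = +-identityˡ-unique _ _ (trans (sym (φ-+ s 0# 0#)) (φ-cong s (+-identityˡ 0#)))

  φ-neg : ∀ s x → φ s (- x) ≈ - φ s x
  φ-neg s x = +-inverseˡ-unique _ _ (trans (sym (φ-+ s (- x) x)) (trans (φ-cong s (-‿inverseˡ x)) (φ-0# s)))

  φ-sumTo : ∀ s k f → φ s (sumTo k f) ≈ sumTo k (φ s ∘ f)
  φ-sumTo s zero    f = φ-0# s
  φ-sumTo s (suc k) f = trans (φ-+ s _ _) (+-congʳ (φ-sumTo s k f))

  φ-prodTo : ∀ s k f → φ s (prodTo k f) ≈ prodTo k (φ s ∘ f)
  φ-prodTo s zero    f = φ-1# s
  φ-prodTo s (suc k) f = trans (φ-* s _ _) (*-congʳ (φ-prodTo s k f))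

  φ-pow : ∀ s x k → φ s (pow x k) ≈ pow (φ s x) k
  φ-pow s x k = pow-swap x k (q ℕ.^ s)

  φ--1^ : ∀ s l → φ s (-1^ l) ≈ -1^ l
  φ--1^ s l = trans (φ-pow s (- 1#) l) (pow-cong l (trans (φ-neg s 1#) (-‿cong (φ-1# s))))

  φ-periodic : ∀ s x → φ (n ℕ.+ s) x ≈ φ s x
  φ-periodic s x = trans (sym (φ-φ n s x)) (pow-q^n (φ s x))

  φ-inverse : ∀ s x → s ℕ.≤ n → φ (n ℕ.∸ s) (φ s x) ≈ x
  φ-inverse s x s≤n = trans (φ-φ (n ℕ.∸ s) s x) (trans (φ-≡ x (ℕₚ.m∸n+n≡m s≤n)) (pow-q^n x))

  φ-injective : ∀ s {x y} → s ℕ.≤ n → φ s x ≈ φ s y → x ≈ y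
  φ-injective s s≤n eq = trans (sym (φ-inverse s _ s≤n)) (trans (φ-cong (n ℕ.∸ s) eq) (φ-inverse s _ s≤n))

  φ-≉0 : ∀ s {x} → ¬ (x ≈ 0#) → ¬ (φ s x ≈ 0#)
  φ-≉0 s x≉0 = pow-≉0 x≉0 (q ℕ.^ s)

  φ-det : ∀ s k M → φ s (det k M) ≈ det k (λ i j → φ s (M i j))
  φ-det s zero    M = φ-1# s
  φ-det s (suc k) M = trans (φ-sumTo s (suc k) _) (sumTo-cong (suc k) λ j _ →
    trans (φ-* s _ _) (*-cong (φ--1^ s j) (trans (φ-* s _ _) (*-congˡ (φ-det s k (minor j M))))))

  InFq-φ : ∀ s {c} → InFq c → φ s c ≈ c
  InFq-φ zero    c∈ = φ-zero _
  InFq-φ (suc s) c∈ = trans (φ-suc s _) (trans (pow-cong q (InFq-φ s c∈)) c∈)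

  φ-InFq : ∀ {c} → φ 1 c ≈ c → InFq c
  φ-InFq φc≈c = trans (sym (φ-one _)) φc≈c

  InFq-resp : ∀ {x y} → x ≈ y → InFq x → InFq y
  InFq-resp x≈y x∈ = trans (pow-cong q (sym x≈y)) (trans x∈ x≈y)

  InFq-0# : InFq 0#
  InFq-0# = φ-InFq (φ-0# 1)

  InFq-1# : InFq 1#
  InFq-1# = pow-1# q

  InFq-+ : ∀ {x y} → InFq x → InFq y → InFq (x + y)
  InFq-+ x∈ y∈ = trans (pow-q-+ _ _) (+-cong x∈ y∈)

  InFq-neg : ∀ {x} → InFq x → InFq (- x)
  InFq-neg x∈ = φ-InFq (trans (φ-neg 1 _) (-‿cong (InFq-φ 1 x∈)))

  InFq-* : ∀ {x y} → InFq x → InFq y → InFq (x * y)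
  InFq-* x∈ y∈ = trans (pow-distrib-* _ _ q) (*-cong x∈ y∈)

  InFq-pow : ∀ {x} k → InFq x → InFq (pow x k)
  InFq-pow {x} k x∈ = trans (pow-swap x k q) (pow-cong k x∈)

  InFq-kron : ∀ i j → InFq (kron i j)
  InFq-kron i j with i ≡ᵇ j
  ... | true  = InFq-1#
  ... | false = InFq-0#

  InFq-prodTo : ∀ k {d} → (∀ i → i ℕ.< k → InFq (d i)) → InFq (prodTo k d)
  InFq-prodTo zero    d∈ = InFq-1#
  InFq-prodTo (suc k) d∈ = InFq-* (InFq-prodTo k (λ i i<k → d∈ i (ℕₚ.m<n⇒m<1+n i<k))) (d∈ k (ℕₚ.n<1+n k))

  Tr-cong : ∀ {x y} → x ≈ y → Tr x ≈ Tr y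
  Tr-cong x≈y = sumTo-cong n (λ i _ → φ-cong i x≈y)

  Tr-+ : ∀ x y → Tr (x + y) ≈ Tr x + Tr y
  Tr-+ x y = trans (sumTo-cong n (λ i _ → φ-+ i x y)) (sumTo-+ n _ _)

  Tr-scale : ∀ {c} → InFq c → ∀ x → Tr (c * x) ≈ c * Tr x
  Tr-scale {c} c∈ x = trans (sumTo-cong n (λ i _ → trans (φ-* i c x) (*-congʳ (InFq-φ i c∈)))) (sym (*-sumTo n c _))

  Tr-0# : Tr 0# ≈ 0#
  Tr-0# = sumTo-0# n (λ i _ → φ-0# i)

  Tr-sumTo : ∀ k f → Tr (sumTo k f) ≈ sumTo k (Tr ∘ f)
  Tr-sumTo zero    f = Tr-0#
  Tr-sumTo (suc k) f = trans (Tr-+ _ _) (+-congʳ (Tr-sumTo k f))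

  φ-Tr : ∀ x → φ 1 (Tr x) ≈ Tr x
  -- The conjugates with exponents 0 to n are summed with the first or the last one split off, and
  -- these two are equal by periodicity.
  φ-Tr x = +-cancelˡ (φ 0 x) _ _ (begin
    φ 0 x + φ 1 (Tr x)                      ≈⟨ +-congˡ (trans (φ-sumTo 1 n _) (sumTo-cong n (λ i _ → φ-φ 1 i x))) ⟩
    φ 0 x + sumTo n (λ i → φ (suc i) x)     ≈⟨ sumTo-head n (λ i → φ i x) ⟨
    Tr x + φ n x                            ≈⟨ +-comm _ _ ⟩
    φ n x + Tr x                            ≈⟨ +-congʳ (trans (pow-q^n x) (sym (φ-zero x))) ⟩
    φ 0 x + Tr x ∎)

  Tr-InFq : ∀ x → InFq (Tr x)
  Tr-InFq x = φ-InFq (φ-Tr x)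

  Tr-φ : ∀ s x → Tr (φ s x) ≈ Tr x
  Tr-φ s x = trans (sumTo-cong n (λ i _ → trans (φ-φ i s x) (trans (φ-≡ x (ℕₚ.+-comm i s)) (sym (φ-φ s i x)))))
    (trans (sym (φ-sumTo s n _)) (InFq-φ s (Tr-InFq x)))

  moore : ℕ → (ℕ → Carrier) → Carrier
  moore k f = det k (λ i s → φ s (f i))

  moore-cong : ∀ k {f g} → (∀ i → i ℕ.< k → f i ≈ g i) → moore k f ≈ moore k g
  moore-cong k f≈g = det-cong k (λ i s i<k _ → φ-cong s (f≈g i i<k))

  moore-scale : ∀ k g f → moore k (λ i → g * f i) ≈ prodTo k (λ s → φ s g) * moore k f
  moore-scale k g f = trans (det-cong k (λ i s _ _ → φ-* s g (f i))) (det-scaleCols k _ _)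

  -- Subtracting from each column of the Moore matrix of (1, h₁, …, h_k) its predecessor
  -- leaves the first row (1, 0, …, 0) and the Moore matrix of the elements hᵢ^q − hᵢ.
  moore-reduce : ∀ k h → h 0 ≈ 1# → moore (suc k) h ≈ moore k (λ i → pow (h (suc i)) q - h (suc i))
  moore-reduce k h h₀≈1 = begin
    moore (suc k) h
      ≈⟨ det-differences (suc k) _ K (λ i → refl) (λ i j → sym (trans (+-congˡ (+-comm _ _))
           (trans (sym (+-assoc _ _ _)) (trans (+-congʳ (-‿inverseʳ _)) (+-identityˡ _))))) ⟩
    det (suc k) K
      ≈⟨ sumTo-head k _ ⟩
    1# * (φ 0 (h 0) * det k (minor 0 K)) + sumTo k (λ j → -1^ (suc j) * (K 0 (suc j) * det k (minor (suc j) K)))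
      ≈⟨ +-cong (trans (*-identityˡ _) (trans (*-congʳ (trans (φ-zero _) h₀≈1)) (*-identityˡ _)))
           (sumTo-0# k (λ j _ → trans (*-congˡ (trans (*-congʳ (firstRow j)) (zeroˡ _))) (zeroʳ _))) ⟩
    det k (minor 0 K) + 0#
      ≈⟨ +-identityʳ _ ⟩
    det k (minor 0 K)
      ≈⟨ det-cong k (λ i s _ _ → sym (trans (φ-+ s _ _) (+-cong
           (trans (pow-swap _ q (q ℕ.^ s)) (sym (φ-suc s _))) (φ-neg s _)))) ⟩
    moore k (λ i → pow (h (suc i)) q - h (suc i)) ∎
    where
    K : ℕ → ℕ → Carrier
    K i zero    = φ 0 (h i)
    K i (suc s) = φ (suc s) (h i) - φ s (h i)
    firstRow : ∀ j → K 0 (suc j) ≈ 0#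
    firstRow j = trans (+-cong (trans (φ-cong (suc j) h₀≈1) (φ-1# (suc j)))
      (-‿cong (trans (φ-cong j h₀≈1) (φ-1# j)))) (-‿inverseʳ 1#)

  x-y≈0⇒x≈y : ∀ {x y} → x - y ≈ 0# → x ≈ y
  x-y≈0⇒x≈y {x} {y} eq = trans (+-inverseˡ-unique x (- y) eq) (-‿involutive y)

  -- Dividing by the first element and applying `moore-reduce` leaves the Moore determinant of the
  -- elements h^q - h. The kernel of h ↦ h^q - h is F_q: a relation Σ c_i y_i = 0 says that Z = Σ
  -- c_i h_(i+1) lies in F_q, and then -Z completes the c_i to a relation among the f_i.
  moore-≉0 : ∀ k f → FqIndependent k f → ¬ (moore k f ≈ 0#)
  moore-≉0 zero    f independent = nontrivial
  moore-≉0 (suc k) f independent moore≈0 =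
    *-≉0 (prodTo-≉0 (suc k) {λ s → φ s g} (λ s _ → φ-≉0 s g≉0)) (moore-≉0 k y y-independent)
      (begin
        prodTo (suc k) (λ s → φ s g) * moore k y             ≈⟨ *-congˡ (moore-reduce k h h₀≈1) ⟨
        prodTo (suc k) (λ s → φ s g) * moore (suc k) h       ≈⟨ moore-scale (suc k) g h ⟨
        moore (suc k) (λ i → g * h i)                        ≈⟨ moore-cong (suc k) (λ i _ → gh≈f i) ⟩
        moore (suc k) f                                      ≈⟨ moore≈0 ⟩
        0# ∎)
    where
    g = f 0
    g≉0 : ¬ (g ≈ 0#)
    g≉0 g≈0 = nontrivial (independent (λ i → kron 0 i) (λ i _ → InFq-kron 0 i)
      (trans (sumTo-kron (suc k) 0 f (s≤s z≤n)) g≈0) 0 (s≤s z≤n))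
    h : ℕ → Carrier
    h i = f i * g ⁻¹
    h₀≈1 : h 0 ≈ 1#
    h₀≈1 = inverse g g≉0
    gh≈f : ∀ i → g * h i ≈ f i
    gh≈f i = trans (solve 3 (λ g f w → g :* (f :* w) := f :* (g :* w)) refl g (f i) (g ⁻¹))
      (trans (*-congˡ (inverse g g≉0)) (*-identityʳ _))
    y : ℕ → Carrier
    y i = pow (h (suc i)) q - h (suc i)
    y-independent : FqIndependent k y
    y-independent c c∈ Σcy≈0 i i<k = independent c⁺ c⁺∈ Σc⁺f≈0 (suc i) (s≤s i<k)
      where
      Z = sumTo k (λ j → c j * h (suc j))
      Z∈ : InFq Z
      Z∈ = x-y≈0⇒x≈y (begin
        pow Z q - Z
          ≈⟨ +-congʳ (φ-one Z) ⟨
        φ 1 Z - Z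
          ≈⟨ +-cong (trans (φ-sumTo 1 k _) (sumTo-cong k (λ j j<k → trans (φ-* 1 _ _)
               (*-cong (InFq-φ 1 (c∈ j j<k)) (φ-one _)))))
             (trans (sym (-1*x≈-x Z)) (*-sumTo k (- 1#) _)) ⟩
        sumTo k (λ j → c j * pow (h (suc j)) q) + sumTo k (λ j → - 1# * (c j * h (suc j)))
          ≈⟨ sumTo-+ k _ _ ⟨
        sumTo k (λ j → c j * pow (h (suc j)) q + - 1# * (c j * h (suc j)))
          ≈⟨ sumTo-cong k (λ j _ → trans
               (solve 4 (λ c u m v → c :* u :+ m :* (c :* v) := c :* (u :+ m :* v)) refl (c j) _ (- 1#) _)
               (*-congˡ (+-congˡ (-1*x≈-x _)))) ⟩
        sumTo k (λ j → c j * y j)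
          ≈⟨ Σcy≈0 ⟩
        0# ∎)
      c⁺ : ℕ → Carrier
      c⁺ zero    = - Z
      c⁺ (suc j) = c j
      c⁺∈ : ∀ j → j ℕ.< suc k → InFq (c⁺ j)
      c⁺∈ zero    _         = InFq-neg Z∈
      c⁺∈ (suc j) (s≤s j<k) = c∈ j j<k
      Σc⁺f≈0 : sumTo (suc k) (λ j → c⁺ j * f j) ≈ 0#
      Σc⁺f≈0 = begin
        sumTo (suc k) (λ j → c⁺ j * f j)
          ≈⟨ sumTo-head k _ ⟩
        - Z * g + sumTo k (λ j → c j * f (suc j))
          ≈⟨ +-congˡ (sumTo-cong k (λ j _ → trans (*-congˡ (sym (gh≈f (suc j))))
               (solve 3 (λ c g h → c :* (g :* h) := g :* (c :* h)) refl (c j) g _))) ⟩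
        - Z * g + sumTo k (λ j → g * (c j * h (suc j)))
          ≈⟨ +-cong (*-comm (- Z) g) (sym (*-sumTo k g _)) ⟩
        g * - Z + g * Z
          ≈⟨ distribˡ g (- Z) Z ⟨
        g * (- Z + Z)
          ≈⟨ trans (*-congˡ (-‿inverseˡ Z)) (zeroʳ g) ⟩
        0# ∎

-- The quadratic form: dimension bounds, adjoints and polarisation

module QuadraticForm (F : FiniteField) (q n : ℕ) (a : ℕ → FiniteField.Carrier F)
  (pow-q-+ : FieldFacts.FrobeniusAdditive F q n a)
  (pow-q^n : FieldFacts.FrobeniusPeriodic F q n a)
  (0<n : 0 ℕ.< n) (2≉0 : FieldFacts.CharacteristicNot2 F q n a) where
  open FiniteField F hiding (zero)
  open Setup F q n a
  open Determinants F q n a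
  open FieldFacts F q n a
  open LinearAlgebra F q n a
  open LinearisedPolynomials F q n a pow-q-+ pow-q^n
  open import Relation.Binary.Reasoning.Setoid setoid
  open import Algebra.Properties.Ring ring
  open import Algebra.Solver.Ring.NaturalCoefficients.Default commutativeSemiring
    using (solve; _:=_; _:+_; _:*_)

  indicator : ℕ → ℕ → Carrier
  indicator k i with i ℕ.<? k
  ... | yes _ = 1#
  ... | no  _ = 0#

  indicator-< : ∀ {k i} → i ℕ.< k → indicator k i ≈ 1#
  indicator-< {k} {i} i<k with i ℕ.<? k
  ... | yes _   = refl
  ... | no  i≮k = ⊥-elim (i≮k i<k)

  indicator-≥ : ∀ {k i} → k ℕ.≤ i → indicator k i ≈ 0#
  indicator-≥ {k} {i} k≤i with i ℕ.<? k
  ... | yes i<k = ⊥-elim (ℕₚ.<⇒≱ i<k k≤i)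
  ... | no  _   = refl

  independent-suc : ∀ k v → FqIndependent (suc k) v → FqIndependent k v
  independent-suc k v independent c c∈ Σcv≈0 i i<k = trans (sym (restricted i i<k))
    (independent c′ c′∈ Σc′v≈0 i (ℕₚ.m<n⇒m<1+n i<k))
    where
    c′ : ℕ → Carrier
    c′ i with i ℕ.<? k
    ... | yes _ = c i
    ... | no  _ = 0#
    restricted : ∀ i → i ℕ.< k → c′ i ≈ c i
    restricted i i<k with i ℕ.<? k
    ... | yes _   = refl
    ... | no  i≮k = ⊥-elim (i≮k i<k)
    c′∈ : ∀ i → i ℕ.< suc k → InFq (c′ i)
    c′∈ i _ with i ℕ.<? k
    ... | yes i<k = c∈ i i<k
    ... | no  _   = InFq-0#
    c′k≈0 : c′ k ≈ 0#
    c′k≈0 with k ℕ.<? k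
    ... | yes k<k = ⊥-elim (ℕₚ.<-irrefl ≡.refl k<k)
    ... | no  _   = refl
    Σc′v≈0 : sumTo (suc k) (λ i → c′ i * v i) ≈ 0#
    Σc′v≈0 = trans (+-cong (trans (sumTo-cong k (λ i i<k → *-congʳ (restricted i i<k))) Σcv≈0)
      (trans (*-congʳ c′k≈0) (zeroˡ _))) (+-identityʳ 0#)

  independent-≤ : ∀ {k m} v → k ℕ.≤ m → FqIndependent m v → FqIndependent k v
  independent-≤ v k≤m = go (ℕₚ.≤⇒≤′ k≤m)
    where
    go : ∀ {k m} → k ℕ.≤′ m → FqIndependent m v → FqIndependent k v
    go (ℕ.≤′-reflexive ≡.refl) independent = independent
    go (ℕ.≤′-step k≤m)        independent = go k≤m (independent-suc _ v independent)

  independent-cong : ∀ k {u v} → (∀ i → i ℕ.< k → u i ≈ v i) → FqIndependent k u → FqIndependent k v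
  independent-cong k u≈v independent c c∈ Σ≈0 =
    independent c c∈ (trans (sumTo-cong k (λ i i<k → *-congˡ (u≈v i i<k))) Σ≈0)

  independent-scale : ∀ k (d v : ℕ → Carrier) → (∀ i → i ℕ.< k → InFq (d i) × ¬ (d i ≈ 0#)) →
    FqIndependent k v → FqIndependent k (λ i → d i * v i)
  independent-scale k d v d-unit independent c c∈ Σ≈0 i i<k =
    *≈0⇒≈0 (proj₂ (d-unit i i<k)) (trans (*-comm _ _)
      (independent (λ i → c i * d i) (λ i i<k → InFq-* (c∈ i i<k) (proj₁ (d-unit i i<k)))
        (trans (sumTo-cong k (λ i _ → *-assoc _ _ _)) Σ≈0) i i<k))

  -- The coefficient matrix has k + 1 rows and k columns. `indicator` pads it with a zero column, so
  -- that the product formula for square matrices applies and contributes a factor 0.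
  moore-degenerate : ∀ k u g (c : ℕ → ℕ → Carrier) →
    (∀ i l → i ℕ.< suc k → l ℕ.< k → InFq (c i l)) →
    (∀ i → i ℕ.< suc k → u i ≈ sumTo k (λ l → c i l * g l)) → moore (suc k) u ≈ 0#
  moore-degenerate k u g c c∈ u≈cg = begin
    moore (suc k) u
      ≈⟨ det-cong (suc k) (λ i s i<k _ → entry i s i<k) ⟩
    det (suc k) (λ i s → sumTo (suc k) (λ l → (indicator k l * c i l) * φ s (g l)))
      ≈⟨ det-* (suc k) (λ i l → indicator k l * c i l) _ ⟩
    det (suc k) (λ i l → indicator k l * c i l) * moore (suc k) g
      ≈⟨ *-congʳ (det-scaleCols (suc k) (indicator k) c) ⟩
    (prodTo k (indicator k) * indicator k k * det (suc k) c) * moore (suc k) g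
      ≈⟨ *-congʳ (*-congʳ (trans (*-congˡ (indicator-≥ (ℕₚ.≤-refl {k}))) (zeroʳ _))) ⟩
    (0# * det (suc k) c) * moore (suc k) g
      ≈⟨ trans (*-congʳ (zeroˡ _)) (zeroˡ _) ⟩
    0# ∎
    where
    entry : ∀ i s → i ℕ.< suc k → φ s (u i) ≈ sumTo (suc k) (λ l → (indicator k l * c i l) * φ s (g l))
    entry i s i<k = begin
      φ s (u i)
        ≈⟨ trans (φ-cong s (u≈cg i i<k)) (φ-sumTo s k _) ⟩
      sumTo k (λ l → φ s (c i l * g l))
        ≈⟨ sumTo-cong k (λ l l<k → trans (φ-* s _ _) (*-congʳ (trans (InFq-φ s (c∈ i l i<k l<k))
             (sym (trans (*-congʳ (indicator-< l<k)) (*-identityˡ _)))))) ⟩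
      sumTo k (λ l → (indicator k l * c i l) * φ s (g l))
        ≈⟨ +-identityʳ _ ⟨
      sumTo k (λ l → (indicator k l * c i l) * φ s (g l)) + 0#
        ≈⟨ +-congˡ (trans (*-congʳ (trans (*-congʳ (indicator-≥ (ℕₚ.≤-refl {k}))) (zeroˡ _))) (zeroˡ _)) ⟨
      sumTo (suc k) (λ l → (indicator k l * c i l) * φ s (g l)) ∎

  -- Steinitz's bound without elimination: k + 1 elements of a space spanned by k have vanishing
  -- Moore determinant, whereas independence makes it nonzero.
  independent-span-≤ : ∀ m k u g (c : ℕ → ℕ → Carrier) → FqIndependent m u →
    (∀ i l → i ℕ.< m → l ℕ.< k → InFq (c i l)) →
    (∀ i → i ℕ.< m → u i ≈ sumTo k (λ l → c i l * g l)) → m ℕ.≤ k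
  independent-span-≤ m k u g c independent c∈ u≈cg = ℕₚ.≮⇒≥ λ k<m →
    moore-≉0 (suc k) u (independent-≤ u k<m independent)
      (moore-degenerate k u g c (λ i l i≤k → c∈ i l (ℕₚ.<-≤-trans i≤k k<m))
        (λ i i≤k → u≈cg i (ℕₚ.<-≤-trans i≤k k<m)))

  -- The index change j ↦ -j modulo m, which sends 0 to itself. It is how the coefficients of ℓ′
  -- arise from those of ℓ.
  sumTo-negate : ∀ m {f g} → 0 ℕ.< m → f 0 ≈ g 0 →
    (∀ j → 0 ℕ.< j → j ℕ.< m → f (m ℕ.∸ j) ≈ g j) → sumTo m f ≈ sumTo m g
  sumTo-negate (suc m) {f} {g} _ f₀≈g₀ f≈g = begin
    sumTo (suc m) f                                        ≈⟨ sumTo-head m f ⟩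
    f 0 + sumTo m (f ∘ suc)                                ≈⟨ +-cong f₀≈g₀ (sumTo-reverse m (f ∘ suc)) ⟩
    g 0 + sumTo m (λ i → f (suc (m ℕ.∸ suc i)))            ≈⟨ +-congˡ (sumTo-cong m (λ i i<m → trans
                                                                (reflexive (≡.cong f (≡.sym (ℕₚ.+-∸-assoc 1 i<m))))
                                                                (f≈g (suc i) (s≤s z≤n) (s≤s i<m)))) ⟩
    g 0 + sumTo m (g ∘ suc)                                ≈⟨ sumTo-head m g ⟨
    sumTo (suc m) g ∎

  sumTo-rotate : ∀ k f → f k ≈ f 0 → sumTo k f ≈ sumTo k (f ∘ suc)
  sumTo-rotate k f fk≈f0 = +-cancelˡ (f 0) _ _ (trans (+-comm _ _)
    (trans (+-congˡ (sym fk≈f0)) (sumTo-head k f)))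

  qlin-cong : ∀ {c c′ x y} → (∀ t → t ℕ.< n → c t ≈ c′ t) → x ≈ y → qlin c x ≈ qlin c′ y
  qlin-cong c≈c′ x≈y = sumTo-cong n (λ t t<n → *-cong (c≈c′ t t<n) (φ-cong t x≈y))

  qlin-+ : ∀ c x y → qlin c (x + y) ≈ qlin c x + qlin c y
  qlin-+ c x y = trans (sumTo-cong n (λ t _ → trans (*-congˡ (φ-+ t x y)) (distribˡ _ _ _))) (sumTo-+ n _ _)

  Tr-*-qlin : ∀ x c y → Tr (x * qlin c y) ≈ sumTo n (λ t → Tr (x * (c t * φ t y)))
  Tr-*-qlin x c y = trans (Tr-cong (*-sumTo n x _)) (Tr-sumTo n _)

  -- This is what ℓ′ is for: it is the adjoint of ℓ for the trace form. The trace is invariant under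
  -- φ_j, and applying φ_j to the term of index n - j frees x, because φ_j φ_(n-j) is the identity.
  Tr-adjoint : ∀ x y → Tr (y * ℓ x) ≈ Tr (x * qlin ℓ′coeff y)
  Tr-adjoint x y = trans (Tr-*-qlin y a x) (trans (sumTo-negate n 0<n
      (Tr-cong (trans (*-congˡ (*-congˡ (φ-zero x))) (trans
        (solve 3 (λ x y c → y :* (c :* x) := x :* (c :* y)) refl x y (a 0))
        (*-congˡ (*-congˡ (sym (φ-zero y)))))))
      term) (sym (Tr-*-qlin x ℓ′coeff y)))
    where
    term : ∀ j → 0 ℕ.< j → j ℕ.< n →
      Tr (y * (a (n ℕ.∸ j) * φ (n ℕ.∸ j) x)) ≈ Tr (x * (ℓ′coeff j * φ j y))
    term (suc j) _ j<n = begin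
      Tr (y * (a i * φ i x))
        ≈⟨ Tr-φ (suc j) _ ⟨
      Tr (φ (suc j) (y * (a i * φ i x)))
        ≈⟨ Tr-cong (trans (φ-* (suc j) _ _) (*-congˡ (φ-* (suc j) _ _))) ⟩
      Tr (φ (suc j) y * (φ (suc j) (a i) * φ (suc j) (φ i x)))
        ≈⟨ Tr-cong (*-congˡ (*-congˡ (trans (φ-φ (suc j) i x)
             (trans (φ-≡ x (ℕₚ.m+[n∸m]≡n (ℕₚ.<⇒≤ j<n))) (pow-q^n x))))) ⟩
      Tr (φ (suc j) y * (φ (suc j) (a i) * x))
        ≈⟨ Tr-cong (solve 3 (λ x y c → y :* (c :* x) := x :* (c :* y)) refl _ _ _) ⟩
      Tr (x * (φ (suc j) (a i) * φ (suc j) y)) ∎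
      where i = n ℕ.∸ suc j

  2*half≈1 : (1# + 1#) * half ≈ 1#
  2*half≈1 = inverse (1# + 1#) 2≉0

  double : ∀ x → (1# + 1#) * x ≈ x + x
  double x = trans (distribʳ x 1# 1#) (+-cong (*-identityˡ x) (*-identityˡ x))

  double-cancel : ∀ {x y} → x + x ≈ y + y → x ≈ y
  double-cancel {x} {y} eq = *-cancelˡ 2≉0 (trans (double x) (trans eq (sym (double y))))

  double-L : ∀ y → L y + L y ≈ ℓ y + qlin ℓ′coeff y
  double-L y = trans (sym (double (L y))) (trans (*-sumTo n _ _) (trans
    (sumTo-cong n (λ t _ → trans (sym (*-assoc _ _ _)) (trans
      (*-congʳ (trans (sym (*-assoc _ _ _)) (trans (*-congʳ 2*half≈1) (*-identityˡ _))))
      (distribʳ _ _ _))))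
    (sumTo-+ n _ _)))

  Q-cong : ∀ {x y} → x ≈ y → Q x ≈ Q y
  Q-cong x≈y = Tr-cong (*-cong x≈y (qlin-cong (λ _ _ → refl) x≈y))

  -- L is the self-adjoint part of ℓ, so it carries the symmetric bilinear form of Q.
  Q-polarise : ∀ x y → Q (x + y) ≈ (Q x + Q y) + (Tr (x * L y) + Tr (x * L y))
  Q-polarise x y = begin
    Tr ((x + y) * ℓ (x + y))
      ≈⟨ Tr-cong (trans (*-congˡ (qlin-+ a x y))
           (solve 4 (λ x y u v → (x :+ y) :* (u :+ v) := (x :* u :+ y :* v) :+ (x :* v :+ y :* u)) refl x y (ℓ x) (ℓ y))) ⟩
    Tr ((x * ℓ x + y * ℓ y) + (x * ℓ y + y * ℓ x))
      ≈⟨ trans (Tr-+ _ _) (+-cong (Tr-+ _ _) (trans (Tr-+ _ _) (+-congˡ (Tr-adjoint x y)))) ⟩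
    (Q x + Q y) + (Tr (x * ℓ y) + Tr (x * qlin ℓ′coeff y))
      ≈⟨ +-congˡ (trans (sym (Tr-+ _ _)) (Tr-cong (sym (distribˡ x _ _)))) ⟩
    (Q x + Q y) + Tr (x * (ℓ y + qlin ℓ′coeff y))
      ≈⟨ +-congˡ (Tr-cong (*-congˡ (sym (double-L y)))) ⟩
    (Q x + Q y) + Tr (x * (L y + L y))
      ≈⟨ +-congˡ (trans (Tr-cong (distribˡ x _ _)) (Tr-+ _ _)) ⟩
    (Q x + Q y) + (Tr (x * L y) + Tr (x * L y)) ∎

  -- The dual basis as the inverse of a Moore matrix

  module DualBasis (e : ℕ → Carrier) (e-independent : FqIndependent n e) where

    basisMatrix : ℕ → ℕ → Carrier
    basisMatrix i s = φ s (e i)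

    -- The inverse of the Moore matrix of `e` is again a Moore matrix, transposed. Its row 0 holds
    -- the elements whose conjugates fill the other rows.
    dual : ℕ → Carrier
    dual l = rightInverse n basisMatrix l 0

    -- Applying Frobenius to the defining equations and rotating the sum gives the same equations,
    -- because the right-hand sides are 0 or 1. Their solution is unique, so the rotated Frobenius
    -- image is the solution itself.
    rightInverse-suc : ∀ l s → l ℕ.< n → suc s ℕ.< n →
      rightInverse n basisMatrix l (suc s) ≈ φ 1 (rightInverse n basisMatrix l s)
    rightInverse-suc l s l<n s<n = x-y≈0⇒x≈y (kernel-trivial n basisMatrix (moore-≉0 n e e-independent)
      (λ s → R s - z s) (λ i i<n → begin
        sumTo n (λ s → φ s (e i) * (R s - z s))
          ≈⟨ sumTo-cong n (λ s _ → trans (distribˡ _ _ _) (+-congˡ (sym (-‿distribʳ-* _ _)))) ⟩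
        sumTo n (λ s → φ s (e i) * R s + - (φ s (e i) * z s))
          ≈⟨ trans (sumTo-+ n _ _) (+-congˡ (trans (sumTo-cong n (λ s _ → sym (-1*x≈-x _))) (trans (sym (*-sumTo n _ _)) (-1*x≈-x _)))) ⟩
        sumTo n (λ s → φ s (e i) * R s) - sumTo n (λ s → φ s (e i) * z s)
          ≈⟨ +-cong (rightInverse-* n basisMatrix moore≉0 i l i<n l<n) (-‿cong (rotated i i<n)) ⟩
        kron i l - kron i l
          ≈⟨ -‿inverseʳ _ ⟩
        0# ∎) (suc s) s<n)
      where
      moore≉0 = moore-≉0 n e e-independent
      R = rightInverse n basisMatrix l
      -- The Frobenius image of the solution, moved one place cyclically. Since n = suc (n ∸ 1), its
      -- values at 0 and at n agree, as `sumTo-rotate` requires.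
      z : ℕ → Carrier
      z zero    = φ 1 (R (n ℕ.∸ 1))
      z (suc s) = φ 1 (R s)
      z-periodic : z n ≈ z 0
      z-periodic = reflexive (≡.cong z (≡.sym (ℕₚ.m+[n∸m]≡n 0<n)))
      rotated : ∀ i → i ℕ.< n → sumTo n (λ s → φ s (e i) * z s) ≈ kron i l
      rotated i i<n = begin
        sumTo n (λ s → φ s (e i) * z s)
          ≈⟨ sumTo-rotate n _ (*-cong (trans (pow-q^n (e i)) (sym (φ-zero (e i)))) z-periodic) ⟩
        sumTo n (λ s → φ (suc s) (e i) * φ 1 (R s))
          ≈⟨ sumTo-cong n (λ s _ → trans (*-congʳ (sym (φ-φ 1 s (e i)))) (sym (φ-* 1 _ _))) ⟩
        sumTo n (λ s → φ 1 (φ s (e i) * R s))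
          ≈⟨ φ-sumTo 1 n _ ⟨
        φ 1 (sumTo n (λ s → φ s (e i) * R s))
          ≈⟨ φ-cong 1 (rightInverse-* n basisMatrix moore≉0 i l i<n l<n) ⟩
        φ 1 (kron i l)
          ≈⟨ InFq-φ 1 (InFq-kron i l) ⟩
        kron i l ∎

    rightInverse-dual : ∀ l s → l ℕ.< n → s ℕ.< n → rightInverse n basisMatrix l s ≈ φ s (dual l)
    rightInverse-dual l zero    l<n s<n = sym (φ-zero _)
    rightInverse-dual l (suc s) l<n s<n = trans (rightInverse-suc l s l<n s<n)
      (trans (φ-cong 1 (rightInverse-dual l s l<n (ℕₚ.<-trans (ℕₚ.n<1+n s) s<n))) (φ-φ 1 s _))

    Tr-dual : ∀ i l → i ℕ.< n → l ℕ.< n → Tr (e i * dual l) ≈ kron i l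
    Tr-dual i l i<n l<n = trans
      (sumTo-cong n (λ s s<n → trans (φ-* s _ _) (*-congˡ (sym (rightInverse-dual l s l<n s<n)))))
      (rightInverse-* n basisMatrix (moore-≉0 n e e-independent) i l i<n l<n)

    -- The traces of e_i w are the Moore matrix applied to the vector of conjugates of w, so w is
    -- recovered as entry 0 of that vector.
    Tr-nondegenerate : ∀ {x y} → (∀ i → i ℕ.< n → Tr (e i * x) ≈ Tr (e i * y)) → x ≈ y
    Tr-nondegenerate {x} {y} eq = x-y≈0⇒x≈y (trans (sym (φ-zero _))
      (kernel-trivial n basisMatrix (moore-≉0 n e e-independent) (λ s → φ s (x - y))
        (λ i i<n → begin
          sumTo n (λ s → φ s (e i) * φ s (x - y))   ≈⟨ sumTo-cong n (λ s _ → φ-* s _ _) ⟨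
          Tr (e i * (x - y))                        ≈⟨ Tr-cong (trans (distribˡ _ _ _) (+-congˡ (trans (sym (-‿distribʳ-* _ _)) (sym (-1*x≈-x _))))) ⟩
          Tr (e i * x + - 1# * (e i * y))           ≈⟨ trans (Tr-+ _ _) (+-cong (eq i i<n) (Tr-scale (InFq-neg InFq-1#) _)) ⟩
          Tr (e i * y) + - 1# * Tr (e i * y)        ≈⟨ trans (+-congˡ (-1*x≈-x _)) (-‿inverseʳ _) ⟩
          0# ∎) 0 0<n))

    -- The values of a q-linear polynomial on the basis are the Moore matrix applied to its n
    -- coefficients.
    coefficients-unique : ∀ c c′ → (∀ j → j ℕ.< n → qlin c (e j) ≈ qlin c′ (e j)) → ∀ t → t ℕ.< n → c t ≈ c′ t
    coefficients-unique c c′ eq t t<n = x-y≈0⇒x≈y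
      (kernel-trivial n basisMatrix (moore-≉0 n e e-independent) (λ t → c t - c′ t)
        (λ j j<n → begin
          sumTo n (λ t → φ t (e j) * (c t - c′ t))
            ≈⟨ sumTo-cong n (λ t _ → trans (*-comm _ _) (trans (distribʳ _ _ _)
                 (+-congˡ (trans (sym (-‿distribˡ-* _ _)) (sym (-1*x≈-x _)))))) ⟩
          sumTo n (λ t → c t * φ t (e j) + - 1# * (c′ t * φ t (e j)))
            ≈⟨ trans (sumTo-+ n _ _) (+-congˡ (sym (*-sumTo n _ _))) ⟩
          qlin c (e j) + - 1# * qlin c′ (e j)
            ≈⟨ +-cong (eq j j<n) (-1*x≈-x _) ⟩
          qlin c′ (e j) - qlin c′ (e j)
            ≈⟨ -‿inverseʳ _ ⟩
          0# ∎) t t<n)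

    dual-independent : FqIndependent n dual
    dual-independent c c∈ Σ≈0 j j<n = begin
      c j                                                ≈⟨ sumTo-kron n j c j<n ⟨
      sumTo n (λ l → kron j l * c l)                     ≈⟨ sumTo-cong n (λ l l<n → trans (*-comm _ _) (trans
                                                              (*-congˡ (sym (Tr-dual j l j<n l<n))) (sym (Tr-scale (c∈ l l<n) _)))) ⟩
      sumTo n (λ l → Tr (c l * (e j * dual l)))          ≈⟨ Tr-sumTo n _ ⟨
      Tr (sumTo n (λ l → c l * (e j * dual l)))          ≈⟨ Tr-cong (trans (sumTo-cong n (λ l _ →
                                                              solve 3 (λ c e f → c :* (e :* f) := e :* (c :* f)) refl _ _ _)) (sym (*-sumTo n (e j) _))) ⟩
      Tr (e j * sumTo n (λ l → c l * dual l))            ≈⟨ Tr-cong (trans (*-congˡ Σ≈0) (zeroʳ _)) ⟩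
      Tr 0#                                              ≈⟨ Tr-0# ⟩
      0# ∎

  -- Rank and minors of M_L from a diagonal form

  module Diagonalised (e : ℕ → Carrier) (e-independent : FqIndependent n e)
    (k : ℕ) (k≤n : k ℕ.≤ n) (d : ℕ → Carrier) (d-unit : ∀ i → i ℕ.< k → InFq (d i) × ¬ (d i ≈ 0#))
    (diagonal : (w : ℕ → Carrier) → (∀ i → i ℕ.< n → InFq (w i)) →
      Q (sumTo n (λ i → w i * e i)) ≈ sumTo k (λ i → d i * (w i * w i))) where

    open DualBasis e e-independent

    -- The vector e_i + e_j has coordinates `kron i l + kron j l`. Expanding their squares and
    -- comparing with `Q-polarise` isolates twice the mixed term.
    Tr-*-L : ∀ i j → i ℕ.< n → j ℕ.< n → Tr (e i * L (e j)) ≈ sumTo k (λ l → d l * (kron i l * kron j l))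
    Tr-*-L i j i<n j<n = double-cancel (+-cancelˡ (Q (e i) + Q (e j)) _ _ (begin
      (Q (e i) + Q (e j)) + (Tr (e i * L (e j)) + Tr (e i * L (e j)))
        ≈⟨ Q-polarise (e i) (e j) ⟨
      Q (e i + e j)
        ≈⟨ Q-cong (trans (+-cong (sym (sumTo-kron n i e i<n)) (sym (sumTo-kron n j e j<n)))
             (trans (sym (sumTo-+ n _ _)) (sumTo-cong n (λ l _ → sym (distribʳ _ _ _))))) ⟩
      Q (sumTo n (λ l → (kron i l + kron j l) * e l))
        ≈⟨ diagonal _ (λ l _ → InFq-+ (InFq-kron i l) (InFq-kron j l)) ⟩
      sumTo k (λ l → d l * ((kron i l + kron j l) * (kron i l + kron j l)))
        ≈⟨ sumTo-cong k (λ l _ → solve 3 (λ d x y → d :* ((x :+ y) :* (x :+ y)) :=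
             (d :* (x :* x) :+ d :* (y :* y)) :+ (d :* (x :* y) :+ d :* (x :* y))) refl (d l) (kron i l) (kron j l)) ⟩
      sumTo k (λ l → (d l * (kron i l * kron i l) + d l * (kron j l * kron j l)) +
        (d l * (kron i l * kron j l) + d l * (kron i l * kron j l)))
        ≈⟨ trans (sumTo-+ k _ _) (+-cong (sumTo-+ k _ _) (sumTo-+ k _ _)) ⟩
      (sumTo k (λ l → d l * (kron i l * kron i l)) + sumTo k (λ l → d l * (kron j l * kron j l))) +
        (sumTo k (λ l → d l * (kron i l * kron j l)) + sumTo k (λ l → d l * (kron i l * kron j l)))
        ≈⟨ +-congʳ (+-cong (Q-e i i<n) (Q-e j j<n)) ⟨
      (Q (e i) + Q (e j)) +
        (sumTo k (λ l → d l * (kron i l * kron j l)) + sumTo k (λ l → d l * (kron i l * kron j l))) ∎))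
      where
      Q-e : ∀ i → i ℕ.< n → Q (e i) ≈ sumTo k (λ l → d l * (kron i l * kron i l))
      Q-e i i<n = trans (Q-cong (sym (sumTo-kron n i e i<n))) (diagonal _ (λ l _ → InFq-kron i l))

    L-basis : ∀ j → j ℕ.< n → L (e j) ≈ sumTo k (λ l → (d l * kron j l) * dual l)
    L-basis j j<n = Tr-nondegenerate λ i i<n → begin
      Tr (e i * L (e j))
        ≈⟨ Tr-*-L i j i<n j<n ⟩
      sumTo k (λ l → d l * (kron i l * kron j l))
        ≈⟨ sumTo-cong k (λ l l<k → trans (solve 3 (λ d x y → d :* (x :* y) := (d :* y) :* x) refl _ _ _)
             (*-congˡ (sym (Tr-dual i l i<n (ℕₚ.<-≤-trans l<k k≤n))))) ⟩
      sumTo k (λ l → (d l * kron j l) * Tr (e i * dual l))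
        ≈⟨ sumTo-cong k (λ l l<k → trans (sym (Tr-scale (InFq-* (proj₁ (d-unit l l<k)) (InFq-kron j l)) _))
             (Tr-cong (solve 3 (λ c e f → c :* (e :* f) := e :* (c :* f)) refl _ _ _))) ⟩
      sumTo k (λ l → Tr (e i * ((d l * kron j l) * dual l)))
        ≈⟨ trans (Tr-cong (*-sumTo k (e i) _)) (Tr-sumTo k _) ⟨
      Tr (e i * sumTo k (λ l → (d l * kron j l) * dual l)) ∎

    -- Expanding each trace exhibits a sum of k maps of rank one as a q-linear polynomial. By
    -- `coefficients-unique` these are then the coefficients of L.
    qlin-rankOne : ∀ x → qlin (λ t → sumTo k (λ l → d l * (dual l * φ t (dual l)))) x ≈
      sumTo k (λ l → (d l * Tr (x * dual l)) * dual l)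
    qlin-rankOne x = begin
      sumTo n (λ t → sumTo k (λ l → d l * (dual l * φ t (dual l))) * φ t x)
        ≈⟨ sumTo-cong n (λ t _ → sumTo-* k _ _) ⟩
      sumTo n (λ t → sumTo k (λ l → (d l * (dual l * φ t (dual l))) * φ t x))
        ≈⟨ sumTo-swap n k _ ⟩
      sumTo k (λ l → sumTo n (λ t → (d l * (dual l * φ t (dual l))) * φ t x))
        ≈⟨ sumTo-cong k (λ l _ → trans
             (sumTo-cong n (λ t _ → trans
               (solve 4 (λ d f u v → (d :* (f :* u)) :* v := (d :* f) :* (v :* u)) refl (d l) (dual l) _ _)
               (*-congˡ (sym (φ-* t x (dual l))))))
             (trans (sym (*-sumTo n _ _)) (solve 3 (λ d f t → (d :* f) :* t := (d :* t) :* f) refl _ _ _))) ⟩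
      sumTo k (λ l → (d l * Tr (x * dual l)) * dual l) ∎

    Lcoeff-dual : ∀ t → t ℕ.< n → Lcoeff t ≈ sumTo k (λ l → d l * (dual l * φ t (dual l)))
    Lcoeff-dual = coefficients-unique Lcoeff _ λ j j<n → begin
      L (e j)
        ≈⟨ L-basis j j<n ⟩
      sumTo k (λ l → (d l * kron j l) * dual l)
        ≈⟨ sumTo-cong k (λ l l<k → *-congʳ (*-congˡ (Tr-dual j l j<n (ℕₚ.<-≤-trans l<k k≤n)))) ⟨
      sumTo k (λ l → (d l * Tr (e j * dual l)) * dual l)
        ≈⟨ qlin-rankOne (e j) ⟨
      qlin (λ t → sumTo k (λ l → d l * (dual l * φ t (dual l)))) (e j) ∎

    L-dual : ∀ x → L x ≈ sumTo k (λ l → (d l * Tr (x * dual l)) * dual l)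
    L-dual x = trans (qlin-cong Lcoeff-dual refl) (qlin-rankOne x)

    L-basis-single : ∀ j → j ℕ.< k → L (e j) ≈ d j * dual j
    L-basis-single j j<k = trans (L-basis j (ℕₚ.<-≤-trans j<k k≤n)) (trans
      (sumTo-cong k (λ l _ → solve 3 (λ d m f → (d :* m) :* f := m :* (d :* f)) refl _ _ _))
      (sumTo-kron k j (λ l → d l * dual l) j<k))

    -- The image of L contains the independent elements d_j f_j = L(e_j) with j < k, and lies in the
    -- span of f_0, ..., f_(k-1). Each inclusion gives one inequality.
    rank-unique : ∀ r → DimImL r → k ≡ r
    rank-unique r (v , preimage , v-independent , spans) = ℕₚ.≤-antisym
      (independent-span-≤ k r (L ∘ e) v (λ i → proj₁ (spans (e i)))
        (independent-cong k (λ j j<k → sym (L-basis-single j j<k))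
          (independent-scale k d dual d-unit (independent-≤ dual k≤n dual-independent)))
        (λ i l _ l<r → proj₁ (proj₂ (spans (e i))) l l<r)
        (λ i _ → proj₂ (proj₂ (spans (e i)))))
      (independent-span-≤ r k v dual (λ i l → d l * Tr (x i * dual l)) v-independent
        (λ i l _ l<k → InFq-* (proj₁ (d-unit l l<k)) (Tr-InFq _))
        (λ i i<r → trans (sym (Lx≈v i i<r)) (L-dual (x i))))
      where
      x : ℕ → Carrier
      x i with i ℕ.<? r
      ... | yes i<r = proj₁ (preimage i i<r)
      ... | no  _   = 0#
      Lx≈v : ∀ i → i ℕ.< r → L (x i) ≈ v i
      Lx≈v i i<r with i ℕ.<? r
      ... | yes i<r′ = proj₂ (preimage i i<r′)
      ... | no  i≮r  = ⊥-elim (i≮r i<r)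

    -- Exponents of Frobenius matter only modulo n, and `cyc s t` represents t - s within the range
    -- covered by `Lcoeff-dual`.
    φ-cyc : ∀ s t x → s ℕ.< n → t ℕ.< n → cyc s t ℕ.< n × φ s (φ (cyc s t) x) ≈ φ t x
    φ-cyc s t x s<n t<n with s ℕ.≤ᵇ t in eq
    ... | true  = ℕₚ.≤-<-trans (ℕₚ.m∸n≤m t s) t<n ,
      trans (φ-φ s (t ℕ.∸ s) x) (φ-≡ x (ℕₚ.m+[n∸m]≡n (ℕₚ.≤ᵇ⇒≤ s t (≡.subst Bool.T (≡.sym eq) _))))
    ... | false = ℕₚ.+-cancelˡ-< s _ _ (≡.subst (ℕ._< s ℕ.+ n) (≡.sym s+cyc)
          (≡.subst (n ℕ.+ t ℕ.<_) (ℕₚ.+-comm n s) (ℕₚ.+-monoʳ-< n t<s))) ,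
      trans (φ-φ s _ x) (trans (φ-≡ x s+cyc) (φ-periodic t x))
      where
      t<s : t ℕ.< s
      t<s = ℕₚ.≰⇒> (λ s≤t → ≡.subst Bool.T eq (ℕₚ.≤⇒≤ᵇ s≤t))
      s+cyc : s ℕ.+ (n ℕ.+ t ℕ.∸ s) ≡ n ℕ.+ t
      s+cyc = ℕₚ.m+[n∸m]≡n (ℕₚ.≤-trans (ℕₚ.<⇒≤ s<n) (ℕₚ.m≤m+n n t))

    -- φ_s fixes d_l and turns f_l times its conjugate of exponent t - s into a product of the
    -- conjugates of exponents s and t. M_L thus factors through dimension k.
    M_L-dual : ∀ s t → s ℕ.< n → t ℕ.< n →
      M_L s t ≈ sumTo k (λ l → (d l * φ s (dual l)) * φ t (dual l))
    M_L-dual s t s<n t<n = begin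
      φ s (Lcoeff (cyc s t))
        ≈⟨ φ-cong s (Lcoeff-dual (cyc s t) (proj₁ (φ-cyc s t 0# s<n t<n))) ⟩
      φ s (sumTo k (λ l → d l * (dual l * φ (cyc s t) (dual l))))
        ≈⟨ φ-sumTo s k _ ⟩
      sumTo k (λ l → φ s (d l * (dual l * φ (cyc s t) (dual l))))
        ≈⟨ sumTo-cong k (λ l l<k → trans (φ-* s _ _) (trans
             (*-cong (InFq-φ s (proj₁ (d-unit l l<k))) (trans (φ-* s _ _) (*-congˡ (proj₂ (φ-cyc s t (dual l) s<n t<n)))))
             (sym (*-assoc _ _ _)))) ⟩
      sumTo k (λ l → (d l * φ s (dual l)) * φ t (dual l)) ∎

    δ : Carrier
    δ = moore k dual

    δ≉0 : ¬ (δ ≈ 0#)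
    δ≉0 = moore-≉0 k dual (independent-≤ dual k≤n dual-independent)

    -- The inner index runs over exactly k values, so a k by k minor is a product of square
    -- determinants and no Cauchy-Binet sum arises. Shifting all exponents by α applies φ_α to the
    -- Moore determinant.
    det-shifted : ∀ α β → α ℕ.+ k ℕ.≤ n → β ℕ.+ k ℕ.≤ n →
      det k (λ i j → M_L (α ℕ.+ i) (β ℕ.+ j)) ≈ prodTo k d * (φ α δ * φ β δ)
    det-shifted α β α+k≤n β+k≤n = begin
      det k (λ i j → M_L (α ℕ.+ i) (β ℕ.+ j))
        ≈⟨ det-cong k (λ i j i<k j<k → M_L-dual (α ℕ.+ i) (β ℕ.+ j)
             (ℕₚ.<-≤-trans (ℕₚ.+-monoʳ-< α i<k) α+k≤n) (ℕₚ.<-≤-trans (ℕₚ.+-monoʳ-< β j<k) β+k≤n)) ⟩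
      det k (λ i j → sumTo k (λ l → (d l * φ (α ℕ.+ i) (dual l)) * φ (β ℕ.+ j) (dual l)))
        ≈⟨ det-* k _ _ ⟩
      det k (λ i l → d l * φ (α ℕ.+ i) (dual l)) * det k (λ l j → φ (β ℕ.+ j) (dual l))
        ≈⟨ *-cong (det-scaleCols k d _) (shifted β) ⟩
      (prodTo k d * det k (λ i l → φ (α ℕ.+ i) (dual l))) * φ β δ
        ≈⟨ *-congʳ (*-congˡ (trans (det-transpose k (λ l i → φ (α ℕ.+ i) (dual l))) (shifted α))) ⟩
      (prodTo k d * φ α δ) * φ β δ
        ≈⟨ *-assoc _ _ _ ⟩
      prodTo k d * (φ α δ * φ β δ) ∎
      where
      shifted : ∀ β → det k (λ l j → φ (β ℕ.+ j) (dual l)) ≈ φ β δ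
      shifted β = sym (trans (φ-det β k _) (det-cong k (λ l j _ _ → φ-φ β j (dual l))))

-- Parity and geometric sums

odd⇒suc-double : ∀ m → m ℕ.% 2 ≡ 1 → m ≡ suc (m ℕ./ 2 ℕ.+ m ℕ./ 2)
odd⇒suc-double m odd = ≡.trans (m≡m%n+[m/n]*n m 2) (≡.cong₂ ℕ._+_ odd
  (≡.trans (ℕₚ.*-comm (m ℕ./ 2) 2) (≡.cong (m ℕ./ 2 ℕ.+_) (ℕₚ.+-identityʳ _))))

double/2 : ∀ h → (h ℕ.+ h) ℕ./ 2 ≡ h
double/2 h = ≡.trans
  (≡.cong (ℕ._/ 2) (≡.trans (≡.cong (h ℕ.+_) (≡.sym (ℕₚ.+-identityʳ h))) (ℕₚ.*-comm 2 h))) (m*n/n≡m h 2)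

-- With q = 2h + 1, `G` is the geometric sum 1 + q + ... + q^(n-1). Half the order of the unit group
-- is then G h, which relates η, the power h, to Euler's criterion in the large field.
odd-^ : ∀ h n → ∃ λ G → suc (h ℕ.+ h) ℕ.^ n ≡ suc (G ℕ.* h ℕ.+ G ℕ.* h)
odd-^ h zero    = 0 , ≡.refl
odd-^ h (suc n) with odd-^ h n
... | G , eq = suc (G ℕ.+ (h ℕ.+ h) ℕ.* G) , ≡.trans (≡.cong (suc (h ℕ.+ h) ℕ.*_) eq)
  (solve 2 (λ h G → (con 1 :+ (h :+ h)) :* (con 1 :+ (G :* h :+ G :* h)) :=
    con 1 :+ ((con 1 :+ (G :+ (h :+ h) :* G)) :* h :+ (con 1 :+ (G :+ (h :+ h) :* G)) :* h)) ≡.refl h G)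
  where open +-*-Solver

-- The geometric sum formula, free of truncated subtraction and division.
geom-telescope : ∀ q m → q ℕ.* geom q m ℕ.+ 1 ≡ geom q m ℕ.+ q ℕ.^ m
geom-telescope q zero    = ≡.cong (ℕ._+ 1) (ℕₚ.*-zeroʳ q)
geom-telescope q (suc m) = ≡.trans
  (solve 3 (λ q g p → q :* (g :+ p) :+ con 1 := (q :* g :+ con 1) :+ q :* p) ≡.refl q (geom q m) (q ℕ.^ m))
  (≡.cong (ℕ._+ q ℕ.^ suc m) (geom-telescope q m))
  where open +-*-Solver

-- The quadratic character and the evaluation of the invariant

module Invariant (F : FiniteField) (q n : ℕ) (a : ℕ → FiniteField.Carrier F)
  (h : ℕ) (q≡ : q ≡ suc (h ℕ.+ h))
  (G : ℕ) (size≡ : FiniteField.size F ≡ suc (G ℕ.* h ℕ.+ G ℕ.* h))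
  (pow-q-+ : FieldFacts.FrobeniusAdditive F q n a)
  (pow-q^n : FieldFacts.FrobeniusPeriodic F q n a) (0<n : 0 ℕ.< n) where
  open FiniteField F hiding (zero)
  open Setup F q n a
  open Determinants F q n a
  open FieldFacts F q n a
  open OddSize (G ℕ.* h) size≡
  open LinearAlgebra F q n a
  open LinearisedPolynomials F q n a pow-q-+ pow-q^n
  open QuadraticForm F q n a pow-q-+ pow-q^n 0<n 2≉0
  open import Relation.Binary.Reasoning.Setoid setoid
  open import Algebra.Properties.Ring ring
  open import Algebra.Solver.Ring.NaturalCoefficients.Default commutativeSemiring
    using (solve; _:=_; _:*_; con)

  half-q : (q ℕ.∸ 1) ℕ./ 2 ≡ h
  half-q = ≡.trans (≡.cong (λ q → (q ℕ.∸ 1) ℕ./ 2) q≡) (double/2 h)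

  half-q+1 : (q ℕ.+ 1) ℕ./ 2 ≡ suc h
  half-q+1 = ≡.trans (≡.cong (ℕ._/ 2) (≡.trans (ℕₚ.+-comm q 1)
    (≡.trans (≡.cong suc q≡) (≡.cong suc (≡.sym (ℕₚ.+-suc h h)))))) (double/2 (suc h))

  η-pow : ∀ x → η x ≈ pow x h
  η-pow x = pow-≡ x half-q

  -- The bridge from Frobenius to the character: q = 1 + 2h, and the factor (x²)^h is `η` of x².
  pow-q : ∀ x → pow x q ≈ x * pow (x * x) h
  pow-q x = trans (pow-≡ x q≡) (*-congˡ (trans (pow-+ x h h) (sym (pow-distrib-* x x h))))

  -- The quadratic character of u² is u^(q-1), which need not be 1 since u may lie outside F_q.
  module _ {u σ : Carrier} (u≉0 : ¬ (u ≈ 0#)) (σ²≈1 : σ * σ ≈ 1#) (u^q≈σu : φ 1 u ≈ σ * u) where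

    pow-u² : pow (u * u) h ≈ σ
    pow-u² = *-cancelˡ u≉0 (trans (sym (pow-q u)) (trans (sym (φ-one u)) (trans u^q≈σu (*-comm σ u))))

    InFq-twisted : ∀ {x} → InFq x → InFq (x * (u * u))
    InFq-twisted {x} x∈ = InFq-* x∈ (φ-InFq (begin
      φ 1 (u * u)              ≈⟨ trans (φ-* 1 u u) (*-cong u^q≈σu u^q≈σu) ⟩
      (σ * u) * (σ * u)        ≈⟨ solve 2 (λ s u → (s :* u) :* (s :* u) := (s :* s) :* (u :* u)) refl σ u ⟩
      (σ * σ) * (u * u)        ≈⟨ trans (*-congʳ σ²≈1) (*-identityˡ _) ⟩
      u * u                    ∎))

    η-twisted : ∀ x → η x ≈ σ * η (x * (u * u))
    η-twisted x = sym (begin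
      σ * η (x * (u * u))             ≈⟨ *-congˡ (trans (η-pow _) (pow-distrib-* x (u * u) h)) ⟩
      σ * (pow x h * pow (u * u) h)   ≈⟨ *-congˡ (*-congˡ pow-u²) ⟩
      σ * (pow x h * σ)               ≈⟨ solve 2 (λ s p → s :* (p :* s) := (s :* s) :* p) refl σ (pow x h) ⟩
      (σ * σ) * pow x h               ≈⟨ trans (*-congʳ σ²≈1) (*-identityˡ _) ⟩
      pow x h                         ≈⟨ η-pow x ⟨
      η x                             ∎)

  η-square : ∀ {x} → ¬ (x ≈ 0#) → InFq x → η x * η x ≈ 1#
  η-square {x} x≉0 x∈ = *-cancelˡ x≉0 (begin
    x * (η x * η x)         ≈⟨ *-congˡ (trans (*-cong (η-pow x) (η-pow x)) (sym (pow-distrib-* x x h))) ⟩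
    x * pow (x * x) h       ≈⟨ pow-q x ⟨
    pow x q                 ≈⟨ x∈ ⟩
    x                       ≈⟨ *-identityʳ x ⟨
    x * 1#                  ∎)

  skip-below : ∀ l c → c ℕ.< l → skip l c ≡ c
  skip-below l c c<l with c <ᵇ l in eq
  ... | true  = ≡.refl
  ... | false = ⊥-elim (≡.subst Bool.T eq (ℕₚ.<⇒<ᵇ c<l))

  moore-frobenius : ∀ m f → (∀ i → φ m (f i) ≈ φ 0 (f i)) → φ 1 (moore m f) ≈ -1^ (m ℕ.∸ 1) * moore m f
  moore-frobenius zero    f periodic = trans (φ-1# 1) (sym (*-identityˡ 1#))
  moore-frobenius (suc m) f periodic = sym (begin
    -1^ m * moore (suc m) f                                 ≈⟨ *-congˡ (sym rotated) ⟩
    -1^ m * det (suc m) (mat (S m ∷ tab m (S ∘ skip m)))    ≈⟨ *-congˡ (alternating-move m (det-isAlternating (suc m)) S m ℕₚ.≤-refl) ⟩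
    -1^ m * (-1^ m * detCols (suc m) S)                     ≈⟨ -1^-cancel m _ ⟩
    detCols (suc m) S                                       ≈⟨ trans (detCols-det (suc m) S) (det-cong (suc m) (λ i j _ _ → sym (φ-φ 1 j (f i)))) ⟩
    det (suc m) (λ i j → φ 1 (φ j (f i)))                   ≈⟨ φ-det 1 (suc m) (λ i j → φ j (f i)) ⟨
    φ 1 (moore (suc m) f) ∎)
    where
    -- The columns of the Frobenius image. By periodicity the last one is column 0 of the Moore
    -- matrix, so moving it to the front restores that matrix.
    S : ℕ → Column
    S j i = φ (suc j) (f i)
    rotated : det (suc m) (mat (S m ∷ tab m (S ∘ skip m))) ≈ moore (suc m) f
    rotated = det-cong (suc m) {mat (S m ∷ tab m (S ∘ skip m))} {λ i s → φ s (f i)} λ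
      { i zero    _ _         → periodic i
      ; i (suc j) _ (s≤s j<m) → trans (mat-tab m (S ∘ skip m) i j j<m)
          (φ-≡ (f i) (≡.cong suc (skip-below m j j<m)))
      }

  det-lowerTriangular : ∀ k M → (∀ i j → i ℕ.< j → j ℕ.< k → M i j ≈ 0#) →
    det k M ≈ prodTo k (λ i → M i i)
  det-lowerTriangular zero    M above≈0 = refl
  det-lowerTriangular (suc k) M above≈0 = begin
    det (suc k) M
      ≈⟨ sumTo-head k _ ⟩
    1# * (M 0 0 * det k (minor 0 M)) + sumTo k (λ j → -1^ (suc j) * (M 0 (suc j) * det k (minor (suc j) M)))
      ≈⟨ +-cong (trans (*-identityˡ _) (*-congˡ (det-lowerTriangular k (minor 0 M)
           (λ i j i<j j<k → above≈0 (suc i) (suc j) (s≤s i<j) (s≤s j<k)))))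
         (sumTo-0# k (λ j j<k → trans (*-congˡ (trans (*-congʳ (above≈0 0 (suc j) (s≤s z≤n) (s≤s j<k))) (zeroˡ _))) (zeroʳ _))) ⟩
    M 0 0 * prodTo k (λ i → M (suc i) (suc i)) + 0#
      ≈⟨ +-identityʳ _ ⟩
    M 0 0 * prodTo k (λ i → M (suc i) (suc i))
      ≈⟨ prodTo-head k (λ i → M i i) ⟨
    prodTo (suc k) (λ i → M i i) ∎

  det-cornerRow : ∀ k M → (∀ j → j ℕ.< k → M 0 j ≈ 0#) →
    det (suc k) M ≈ -1^ k * (M 0 k * det k (λ i j → M (suc i) j))
  det-cornerRow k M row≈0 = trans
    (+-congʳ (sumTo-0# k (λ j j<k → trans (*-congˡ (trans (*-congʳ (row≈0 j j<k)) (zeroˡ _))) (zeroʳ _))))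
    (trans (+-identityˡ _) (*-congˡ (*-congˡ
      (det-cong k (λ i c _ c<k → reflexive (≡.cong (M (suc i)) (skip-below k c c<k)))))))

  cyc-≤ : ∀ s t → s ℕ.≤ t → cyc s t ≡ t ℕ.∸ s
  cyc-≤ s t s≤t with s ℕ.≤ᵇ t in eq
  ... | true  = ≡.refl
  ... | false = ⊥-elim (≡.subst Bool.T eq (ℕₚ.≤⇒≤ᵇ s≤t))

  M_L-≤ : ∀ s t → s ℕ.≤ t → M_L s t ≈ φ s (Lcoeff (t ℕ.∸ s))
  M_L-≤ s t s≤t = φ-cong s (reflexive (≡.cong Lcoeff (cyc-≤ s t s≤t)))

  module Evaluation (e : ℕ → Carrier) (e-independent : FqIndependent n e)
    (k : ℕ) (k≤n : k ℕ.≤ n) (d : ℕ → Carrier) (d-unit : ∀ i → i ℕ.< k → InFq (d i) × ¬ (d i ≈ 0#))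
    (diagonal : (w : ℕ → Carrier) → (∀ i → i ℕ.< n → InFq (w i)) →
      Q (sumTo n (λ i → w i * e i)) ≈ sumTo k (λ i → d i * (w i * w i))) where

    open DualBasis e e-independent
    open Diagonalised e e-independent k k≤n d d-unit diagonal public

    P : Carrier
    P = prodTo k d

    P∈ : InFq P
    P∈ = InFq-prodTo k (λ i i<k → proj₁ (d-unit i i<k))

    P≉0 : ¬ (P ≈ 0#)
    P≉0 = prodTo-≉0 k (λ i i<k → proj₂ (d-unit i i<k))

    det-M_L : det k M_L ≈ P * (δ * δ)
    det-M_L = trans (det-shifted 0 0 k≤n k≤n) (*-congˡ (*-cong (φ-zero δ) (φ-zero δ)))

    det-M_L≉0 : ¬ (det k M_L ≈ 0#)
    det-M_L≉0 eq = *-≉0 P≉0 (*-≉0 δ≉0 δ≉0) (trans (sym det-M_L) eq)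

    fullRank : k ≡ n → InFq (det n M_L) × (η P ≈ -1^ (n ℕ.∸ 1) * η (det n M_L))
    fullRank k≡n = InFq-resp (sym det≈) (InFq-twisted δ≉0 (-1^-square (n ℕ.∸ 1)) δ^q P∈) ,
      trans (η-twisted δ≉0 (-1^-square (n ℕ.∸ 1)) δ^q P) (*-congˡ (pow-cong ((q ℕ.∸ 1) ℕ./ 2) (sym det≈)))
      where
      δ^q : φ 1 δ ≈ -1^ (n ℕ.∸ 1) * δ
      δ^q = trans (moore-frobenius k dual (λ i → trans (φ-≡ (dual i) k≡n) (trans (pow-q^n _) (sym (φ-zero _)))))
        (*-congʳ (reflexive (≡.cong (λ m → -1^ (m ℕ.∸ 1)) k≡n)))
      det≈ : det n M_L ≈ P * (δ * δ)
      det≈ = trans (reflexive (≡.cong (λ m → det m M_L) (≡.sym k≡n))) det-M_L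

    module _ (k<n : k ℕ.< n) where

      det-dropRow : det k (dropRow M_L) ≈ P * (φ 1 δ * δ)
      det-dropRow = trans (det-shifted 1 0 k<n k≤n) (*-congˡ (*-congˡ (φ-zero δ)))

      det-dropRow≉0 : ¬ (det k (dropRow M_L) ≈ 0#)
      det-dropRow≉0 eq = *-≉0 P≉0 (*-≉0 (φ-≉0 1 δ≉0) δ≉0) (trans (sym det-dropRow) eq)

      -- P is fixed by Frobenius, so both sides are P² δ^(2q+2).
      det-pow-q+1 : pow (det k M_L) (q ℕ.+ 1) ≈ pow (det k (dropRow M_L)) 2
      det-pow-q+1 = begin
        pow (det k M_L) (q ℕ.+ 1)
          ≈⟨ trans (pow-≡ _ (ℕₚ.+-comm q 1)) (pow-cong (suc q) det-M_L) ⟩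
        (P * (δ * δ)) * pow (P * (δ * δ)) q
          ≈⟨ *-congˡ (trans (pow-distrib-* _ _ q) (*-cong P∈ (trans (pow-distrib-* δ δ q) (*-cong (sym (φ-one δ)) (sym (φ-one δ)))))) ⟩
        (P * (δ * δ)) * (P * (φ 1 δ * φ 1 δ))
          ≈⟨ solve 3 (λ p d u → (p :* (d :* d)) :* (p :* (u :* u)) := (p :* (u :* d)) :* ((p :* (u :* d)) :* con 1)) refl P δ (φ 1 δ) ⟩
        pow (P * (φ 1 δ * δ)) 2
          ≈⟨ pow-cong 2 det-dropRow ⟨
        pow (det k (dropRow M_L)) 2 ∎

      -- (q+1)/2 = 1 + h. One factor of δ² absorbs (δ²)^h and becomes δ^q, which completes the other
      -- minor; what is left over is P^h. So η(P) is exactly the quotient of the two quantities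
      -- compared in (1).
      det-pow-half : pow (det k M_L) ((q ℕ.+ 1) ℕ./ 2) ≈ det k (dropRow M_L) * η P
      det-pow-half = begin
        pow (det k M_L) ((q ℕ.+ 1) ℕ./ 2)
          ≈⟨ trans (pow-≡ _ half-q+1) (pow-cong (suc h) det-M_L) ⟩
        (P * (δ * δ)) * pow (P * (δ * δ)) h
          ≈⟨ *-congˡ (pow-distrib-* P (δ * δ) h) ⟩
        (P * (δ * δ)) * (pow P h * pow (δ * δ) h)
          ≈⟨ solve 4 (λ p d u v → (p :* (d :* d)) :* (u :* v) := (p :* ((d :* v) :* d)) :* u) refl P δ (pow P h) (pow (δ * δ) h) ⟩
        (P * ((δ * pow (δ * δ) h) * δ)) * pow P h
          ≈⟨ *-cong (*-congˡ (*-congʳ (trans (sym (pow-q δ)) (sym (φ-one δ))))) (sym (η-pow P)) ⟩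
        (P * (φ 1 δ * δ)) * η P
          ≈⟨ *-congʳ det-dropRow ⟨
        det k (dropRow M_L) * η P ∎

      η≈1⇔ : (η P ≈ 1# → pow (det k M_L) ((q ℕ.+ 1) ℕ./ 2) ≈ det k (dropRow M_L)) ×
             (pow (det k M_L) ((q ℕ.+ 1) ℕ./ 2) ≈ det k (dropRow M_L) → η P ≈ 1#)
      η≈1⇔ = (λ η≈1 → trans det-pow-half (trans (*-congˡ η≈1) (*-identityʳ _))) ,
        (λ eq → *-cancelˡ det-dropRow≉0 (trans (sym det-pow-half) (trans eq (sym (*-identityʳ _)))))

    η≈1⇒square : η P ≈ 1# → IsSquare (det k M_L)
    η≈1⇒square η≈1 = proj₁ root * δ , trans
      (solve 2 (λ z d → (z :* d) :* (z :* d) := (z :* z) :* (d :* d)) refl (proj₁ root) δ)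
      (trans (*-congʳ (proj₂ root)) (sym det-M_L))
      where
      root : IsSquare P
      -- P^(G h) is η(P)^G, so Euler's criterion in the large field applies.
      root = pow≈1⇒square P≉0 (trans (sym (pow-pow P G h))
        (trans (pow-cong G (trans (sym (η-pow P)) η≈1)) (pow-1# G)))

    -- A root z of P satisfies z^q = η(P) z, hence z = z^(q^n) = η(P)^n z.
    square⇒η≈1 : n ℕ.% 2 ≡ 1 → IsSquare (det k M_L) → η P ≈ 1#
    square⇒η≈1 n-odd (y , y²≈det) = begin
      η P                                              ≈⟨ *-identityʳ _ ⟨
      η P * 1#                                         ≈⟨ *-congˡ (trans (sym (pow-1# t)) (pow-cong t (sym (η-square P≉0 P∈)))) ⟩
      η P * pow (η P * η P) t                          ≈⟨ *-congˡ (trans (pow-distrib-* _ _ t) (sym (pow-+ (η P) t t))) ⟩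
      pow (η P) (suc (t ℕ.+ t))                        ≈⟨ pow-≡ (η P) (odd⇒suc-double n n-odd) ⟨
      pow (η P) n                                      ≈⟨ *-cancelˡ z≉0 (trans (*-comm _ _) (trans (sym (φ-z n)) (trans (pow-q^n z) (sym (*-identityʳ z))))) ⟩
      1# ∎
      where
      t = n ℕ./ 2
      z = y * δ ⁻¹
      z²≈P : z * z ≈ P
      z²≈P = *-cancelˡ (*-≉0 δ≉0 δ≉0) (begin
        (δ * δ) * (z * z)                              ≈⟨ solve 3 (λ d y w → (d :* d) :* ((y :* w) :* (y :* w)) := (y :* y) :* ((d :* w) :* (d :* w))) refl δ y (δ ⁻¹) ⟩
        (y * y) * ((δ * δ ⁻¹) * (δ * δ ⁻¹))            ≈⟨ *-cong (trans y²≈det det-M_L) (trans (*-cong (inverse δ δ≉0) (inverse δ δ≉0)) (*-identityˡ 1#)) ⟩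
        (P * (δ * δ)) * 1#                             ≈⟨ trans (*-identityʳ _) (*-comm _ _) ⟩
        (δ * δ) * P ∎)
      z≉0 : ¬ (z ≈ 0#)
      z≉0 z≈0 = P≉0 (trans (sym z²≈P) (trans (*-congʳ z≈0) (zeroˡ z)))
      φ-z : ∀ s → φ s z ≈ pow (η P) s * z
      φ-z zero    = trans (φ-zero z) (sym (*-identityˡ z))
      φ-z (suc s) = begin
        φ (suc s) z                         ≈⟨ φ-suc s z ⟩
        pow (φ s z) q                       ≈⟨ pow-cong q (φ-z s) ⟩
        pow (pow (η P) s * z) q             ≈⟨ pow-distrib-* _ _ q ⟩
        pow (pow (η P) s) q * pow z q       ≈⟨ *-cong (InFq-pow s (InFq-pow ((q ℕ.∸ 1) ℕ./ 2) P∈)) (trans (pow-q z) (*-congˡ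
                                                 (trans (pow-cong h z²≈P) (sym (η-pow P))))) ⟩
        pow (η P) s * (z * η P)             ≈⟨ solve 3 (λ u z e → u :* (z :* e) := (e :* u) :* z) refl _ z (η P) ⟩
        pow (η P) (suc s) * z ∎

    -- The case r = n - 2m with ℓ of degree q^m

    module Sparse (0<k : 0 ℕ.< k) (k<n : k ℕ.< n) (m : ℕ) (n≡ : n ≡ m ℕ.+ (m ℕ.+ k))
      (aₘ≉0 : ¬ (a m ≈ 0#)) (a≈0 : ∀ i → m ℕ.< i → a i ≈ 0#) where

      k′ : ℕ
      k′ = k ℕ.∸ 1

      k≡ : k ≡ suc k′
      k≡ = ≡.sym (ℕₚ.m+[n∸m]≡n 0<k)

      0<m : 0 ℕ.< m
      0<m = ℕₚ.n≢0⇒n>0 (λ m≡0 → ℕₚ.<⇒≢ k<n (≡.sym (≡.trans n≡ (≡.cong (λ m → m ℕ.+ (m ℕ.+ k)) m≡0))))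

      ℓ′coeff-pos : ∀ j → 0 ℕ.< j → ℓ′coeff j ≡ φ j (a (n ℕ.∸ j))
      ℓ′coeff-pos (suc j) _ = ≡.refl

      n∸[m+k] : n ℕ.∸ (m ℕ.+ k) ≡ m
      n∸[m+k] = ≡.trans (≡.cong (ℕ._∸ (m ℕ.+ k)) n≡) (ℕₚ.m+n∸n≡m m (m ℕ.+ k))

      m<m+k : m ℕ.< m ℕ.+ k
      m<m+k = ℕₚ.m<m+n m 0<k

      m+k≤n : m ℕ.+ k ℕ.≤ n
      m+k≤n = ≡.subst (m ℕ.+ k ℕ.≤_) (≡.sym n≡) (ℕₚ.m≤n+m (m ℕ.+ k) m)

      ℓ′coeff-0# : ∀ j → 0 ℕ.< j → j ℕ.< m ℕ.+ k → ℓ′coeff j ≈ 0#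
      ℓ′coeff-0# j 0<j j<m+k = trans (reflexive (ℓ′coeff-pos j 0<j)) (trans
        (φ-cong j (a≈0 (n ℕ.∸ j) (≡.subst (ℕ._< n ℕ.∸ j) n∸[m+k] (ℕₚ.∸-monoʳ-< j<m+k m+k≤n)))) (φ-0# j))

      -- ℓ has coefficients only at 0, ..., m, and ℓ′ only at 0 and at m + k, ..., n - 1. The gap
      -- has k - 1 places, just enough to clear the part above the diagonal of a k by k minor.
      Lcoeff-0# : ∀ j → m ℕ.< j → j ℕ.< m ℕ.+ k → Lcoeff j ≈ 0#
      Lcoeff-0# j m<j j<m+k = trans (*-congˡ (trans
        (+-cong (a≈0 j m<j) (ℓ′coeff-0# j (ℕₚ.≤-<-trans z≤n m<j) j<m+k)) (+-identityˡ 0#))) (zeroʳ half)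

      Lcoeff-m : Lcoeff m ≈ half * a m
      Lcoeff-m = *-congˡ (trans (+-congˡ (ℓ′coeff-0# m 0<m m<m+k)) (+-identityʳ _))

      Lcoeff-m+k : Lcoeff (m ℕ.+ k) ≈ half * φ (m ℕ.+ k) (a m)
      Lcoeff-m+k = *-congˡ (trans (+-cong (a≈0 _ m<m+k)
        (trans (reflexive (ℓ′coeff-pos _ (ℕₚ.<-trans 0<m m<m+k)))
          (φ-cong (m ℕ.+ k) (reflexive (≡.cong a n∸[m+k]))))) (+-identityˡ _))

      band : ∀ i j → M_L i (m ℕ.+ (i ℕ.+ j)) ≈ φ i (Lcoeff (m ℕ.+ j))
      band i j = trans (M_L-≤ i _ (ℕₚ.≤-trans (ℕₚ.m≤m+n i j) (ℕₚ.m≤n+m _ m)))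
        (φ-cong i (reflexive (≡.cong Lcoeff (≡.trans
          (≡.cong (ℕ._∸ i) (solve′ 3 (λ m i j → m :+′ (i :+′ j) :=′ i :+′ (m :+′ j)) ≡.refl m i j))
          (ℕₚ.m+n∸m≡n i (m ℕ.+ j))))))
        where open +-*-Solver renaming (solve to solve′; _:+_ to _:+′_; _:=_ to _:=′_)

      diagonal-M_L : ∀ i → M_L i (m ℕ.+ i) ≈ φ i (Lcoeff m)
      diagonal-M_L i = trans (reflexive (≡.cong (λ j → M_L i (m ℕ.+ j)) (≡.sym (ℕₚ.+-identityʳ i))))
        (trans (band i 0) (φ-cong i (reflexive (≡.cong Lcoeff (ℕₚ.+-identityʳ m)))))

      above-diagonal : ∀ i j → i ℕ.< j → j ℕ.< i ℕ.+ k → M_L i (m ℕ.+ j) ≈ 0#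
      above-diagonal i j i<j j<i+k = trans
        (reflexive (≡.cong (λ j → M_L i (m ℕ.+ j)) (≡.sym i+t≡j)))
        (trans (band i t) (trans (φ-cong i (Lcoeff-0# (m ℕ.+ t) (ℕₚ.m<m+n m (ℕₚ.m<n⇒0<n∸m i<j))
          (ℕₚ.+-monoʳ-< m (ℕₚ.+-cancelˡ-< i t k (≡.subst (ℕ._< i ℕ.+ k) (≡.sym i+t≡j) j<i+k))))) (φ-0# i)))
        where
        t = j ℕ.∸ i
        i+t≡j : i ℕ.+ t ≡ j
        i+t≡j = ℕₚ.m+[n∸m]≡n (ℕₚ.<⇒≤ i<j)

      -- The common part of both band minors: rows 1 to k - 1 contribute the same entries to each,
      -- and only row 0 tells the minors apart.
      lowerProduct : Carrier
      lowerProduct = prodTo k′ (λ i → φ (suc i) (Lcoeff m))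

      det-band : det k (λ i j → M_L i (m ℕ.+ j)) ≈ Lcoeff m * lowerProduct
      det-band = begin
        det k (λ i j → M_L i (m ℕ.+ j))
          ≈⟨ det-lowerTriangular k _ (λ i j i<j j<k → above-diagonal i j i<j (ℕₚ.<-≤-trans j<k (ℕₚ.m≤n+m k i))) ⟩
        prodTo k (λ i → M_L i (m ℕ.+ i))
          ≈⟨ prodTo-cong k (λ i _ → diagonal-M_L i) ⟩
        prodTo k (λ i → φ i (Lcoeff m))
          ≡⟨ ≡.cong (λ k → prodTo k (λ i → φ i (Lcoeff m))) k≡ ⟩
        prodTo (suc k′) (λ i → φ i (Lcoeff m))
          ≈⟨ prodTo-head k′ _ ⟩
        φ 0 (Lcoeff m) * lowerProduct
          ≈⟨ *-congʳ (φ-zero _) ⟩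
        Lcoeff m * lowerProduct ∎

      det-nextBand : det k (λ i j → M_L i (suc m ℕ.+ j)) ≈ -1^ k′ * (Lcoeff (m ℕ.+ k) * lowerProduct)
      det-nextBand = begin
        det k (λ i j → M_L i (suc m ℕ.+ j))
          ≡⟨ ≡.cong (λ k → det k (λ i j → M_L i (suc m ℕ.+ j))) k≡ ⟩
        det (suc k′) (λ i j → M_L i (suc m ℕ.+ j))
          ≈⟨ det-cornerRow k′ (λ i j → M_L i (suc m ℕ.+ j)) (λ j j<k′ → trans (shift 0 j)
               (above-diagonal 0 (suc j) (s≤s z≤n) (≡.subst (suc j ℕ.<_) (≡.sym k≡) (s≤s j<k′)))) ⟩
        -1^ k′ * (M_L 0 (suc m ℕ.+ k′) * det k′ (λ i j → M_L (suc i) (suc m ℕ.+ j)))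
          ≈⟨ *-congˡ (*-cong corner (trans
               (det-lowerTriangular k′ _ (λ i j i<j j<k′ → trans (shift (suc i) j) (above-diagonal (suc i) (suc j) (s≤s i<j)
                 (s≤s (ℕₚ.<-≤-trans j<k′ (ℕₚ.≤-trans (ℕₚ.m∸n≤m k 1) (ℕₚ.m≤n+m k i)))))))
               (prodTo-cong k′ (λ i _ → trans (shift (suc i) i) (diagonal-M_L (suc i)))))) ⟩
        -1^ k′ * (Lcoeff (m ℕ.+ k) * lowerProduct) ∎
        where
        shift : ∀ i j → M_L i (suc m ℕ.+ j) ≈ M_L i (m ℕ.+ suc j)
        shift i j = reflexive (≡.cong (M_L i) (≡.sym (ℕₚ.+-suc m j)))
        corner : M_L 0 (suc m ℕ.+ k′) ≈ Lcoeff (m ℕ.+ k)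
        corner = trans (shift 0 k′) (trans (reflexive (≡.cong (λ j → M_L 0 (m ℕ.+ j)) (≡.sym k≡)))
          (trans (band 0 k) (φ-zero _)))

      σ : Carrier
      σ = -1^ (n ℕ.∸ 1)

      -1^k′≈σ : -1^ k′ ≈ σ
      -1^k′≈σ = sym (begin
        -1^ (n ℕ.∸ 1)                       ≡⟨ ≡.cong -1^ n∸1 ⟩
        -1^ ((m ℕ.+ m) ℕ.+ k′)              ≈⟨ trans (pow-+ _ (m ℕ.+ m) k′) (*-congʳ (pow-+ _ m m)) ⟩
        (-1^ m * -1^ m) * -1^ k′            ≈⟨ trans (*-congʳ (-1^-square m)) (*-identityˡ _) ⟩
        -1^ k′ ∎)
        where
        n∸1 : n ℕ.∸ 1 ≡ (m ℕ.+ m) ℕ.+ k′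
        n∸1 = ≡.trans (≡.cong (ℕ._∸ 1) (≡.trans n≡ (≡.sym (ℕₚ.+-assoc m m k)))) (ℕₚ.+-∸-assoc (m ℕ.+ m) 0<k)

      half≉0 : ¬ (half ≈ 0#)
      half≉0 = inverse-≉0 2≉0

      1+m+k≤n : suc m ℕ.+ k ℕ.≤ n
      1+m+k≤n = ≡.subst (suc m ℕ.+ k ℕ.≤_) (≡.sym n≡) (ℕₚ.+-monoˡ-≤ (m ℕ.+ k) 0<m)

      -- The two determinants just computed are also P δ δ^(q^m) and P δ δ^(q^(m+1)).
      δ-ratio : φ (suc m) δ * a m ≈ σ * (φ (m ℕ.+ k) (a m) * φ m δ)
      δ-ratio = *-cancelˡ (*-≉0 (*-≉0 P≉0 (φ-≉0 0 δ≉0)) half≉0) (begin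
        ((P * φ 0 δ) * half) * (φ (suc m) δ * a m)
          ≈⟨ solve 5 (λ p d h u c → ((p :* d) :* h) :* (u :* c) := (p :* (d :* u)) :* (h :* c)) refl P (φ 0 δ) half (φ (suc m) δ) (a m) ⟩
        (P * (φ 0 δ * φ (suc m) δ)) * (half * a m)
          ≈⟨ *-cong (trans (sym (det-shifted 0 (suc m) k≤n 1+m+k≤n)) det-nextBand) (sym Lcoeff-m) ⟩
        (-1^ k′ * (Lcoeff (m ℕ.+ k) * lowerProduct)) * Lcoeff m
          ≈⟨ solve 4 (λ s c l b → (s :* (c :* l)) :* b := (s :* c) :* (b :* l)) refl (-1^ k′) (Lcoeff (m ℕ.+ k)) lowerProduct (Lcoeff m) ⟩
        (-1^ k′ * Lcoeff (m ℕ.+ k)) * (Lcoeff m * lowerProduct)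
          ≈⟨ *-cong (*-cong -1^k′≈σ Lcoeff-m+k) (trans (sym det-band) (det-shifted 0 m k≤n m+k≤n)) ⟩
        (σ * (half * φ (m ℕ.+ k) (a m))) * (P * (φ 0 δ * φ m δ))
          ≈⟨ solve 6 (λ s h c p d u → (s :* (h :* c)) :* (p :* (d :* u)) := ((p :* d) :* h) :* (s :* (c :* u))) refl σ half (φ (m ℕ.+ k) (a m)) P (φ 0 δ) (φ m δ) ⟩
        ((P * φ 0 δ) * half) * (σ * (φ (m ℕ.+ k) (a m) * φ m δ)) ∎)

      -- Applying φ_m turns the claim into `δ-ratio`, since φ_m φ_(m+k) = φ_n is the identity; φ_m
      -- is injective.
      δ^q : φ 1 δ * φ (m ℕ.+ k) (a m) ≈ σ * (φ k (a m) * δ)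
      δ^q = φ-injective m (ℕₚ.≤-trans (ℕₚ.m≤m+n m k) m+k≤n) (begin
        φ m (φ 1 δ * φ (m ℕ.+ k) (a m))
          ≈⟨ trans (φ-* m _ _) (*-cong (trans (φ-φ m 1 δ) (φ-≡ δ (ℕₚ.+-comm m 1)))
               (trans (φ-φ m (m ℕ.+ k) (a m)) (trans (φ-≡ (a m) (≡.sym n≡)) (pow-q^n (a m))))) ⟩
        φ (suc m) δ * a m
          ≈⟨ δ-ratio ⟩
        σ * (φ (m ℕ.+ k) (a m) * φ m δ)
          ≈⟨ trans (φ-* m _ _) (*-cong (φ--1^ m (n ℕ.∸ 1)) (trans (φ-* m _ _) (*-congʳ (φ-φ m k (a m))))) ⟨
        φ m (σ * (φ k (a m) * δ)) ∎)

      -- By `δ^q`, δ^(q-1) is σ divided by the power of `a m` with exponent q^(m+k) - q^k. That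
      -- exponent is divisible by q - 1, and `scale` is the resulting (q-1)-st root, so it cancels
      -- this power in u^(q-1).
      scale : Carrier
      scale = pow (a m) (q ℕ.^ k ℕ.* geom q m)

      scale^q : φ 1 scale * φ k (a m) ≈ scale * φ (m ℕ.+ k) (a m)
      scale^q = begin
        φ 1 scale * φ k (a m)
          ≈⟨ *-congʳ (trans (φ-one scale) (pow-pow (a m) q _)) ⟩
        pow (a m) (q ℕ.* (q ℕ.^ k ℕ.* geom q m)) * pow (a m) (q ℕ.^ k)
          ≈⟨ pow-+ (a m) (q ℕ.* (q ℕ.^ k ℕ.* geom q m)) (q ℕ.^ k) ⟨
        pow (a m) (q ℕ.* (q ℕ.^ k ℕ.* geom q m) ℕ.+ q ℕ.^ k)
          ≈⟨ pow-≡ (a m) exponents ⟩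
        pow (a m) (q ℕ.^ k ℕ.* geom q m ℕ.+ q ℕ.^ (m ℕ.+ k))
          ≈⟨ pow-+ (a m) (q ℕ.^ k ℕ.* geom q m) (q ℕ.^ (m ℕ.+ k)) ⟩
        scale * φ (m ℕ.+ k) (a m) ∎
        where
        open +-*-Solver renaming (solve to solve′; _:+_ to _:+′_; _:*_ to _:*′_; _:=_ to _:=′_; con to con′)
        exponents : q ℕ.* (q ℕ.^ k ℕ.* geom q m) ℕ.+ q ℕ.^ k ≡ q ℕ.^ k ℕ.* geom q m ℕ.+ q ℕ.^ (m ℕ.+ k)
        exponents = ≡.trans
          (solve′ 3 (λ q p g → q :*′ (p :*′ g) :+′ p :=′ p :*′ (q :*′ g :+′ con′ 1)) ≡.refl q (q ℕ.^ k) (geom q m))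
          (≡.trans (≡.cong (q ℕ.^ k ℕ.*_) (geom-telescope q m))
          (≡.trans (ℕₚ.*-distribˡ-+ (q ℕ.^ k) (geom q m) (q ℕ.^ m))
          (≡.cong (q ℕ.^ k ℕ.* geom q m ℕ.+_)
            (≡.trans (ℕₚ.*-comm (q ℕ.^ k) (q ℕ.^ m)) (≡.sym (ℕₚ.^-distribˡ-+-* q m k))))))

      u : Carrier
      u = scale * δ

      u≉0 : ¬ (u ≈ 0#)
      u≉0 = *-≉0 (pow-≉0 aₘ≉0 (q ℕ.^ k ℕ.* geom q m)) δ≉0

      u^q : φ 1 u ≈ σ * u
      u^q = *-cancelˡ (φ-≉0 k aₘ≉0) (begin
        φ k (a m) * φ 1 u                                ≈⟨ *-congˡ (φ-* 1 scale δ) ⟩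
        φ k (a m) * (φ 1 scale * φ 1 δ)                  ≈⟨ solve 3 (λ c s d → c :* (s :* d) := (s :* c) :* d) refl _ _ _ ⟩
        (φ 1 scale * φ k (a m)) * φ 1 δ                  ≈⟨ *-congʳ scale^q ⟩
        (scale * φ (m ℕ.+ k) (a m)) * φ 1 δ              ≈⟨ solve 3 (λ s c d → (s :* c) :* d := s :* (d :* c)) refl _ _ _ ⟩
        scale * (φ 1 δ * φ (m ℕ.+ k) (a m))              ≈⟨ *-congˡ δ^q ⟩
        scale * (σ * (φ k (a m) * δ))                    ≈⟨ solve 4 (λ s t c d → s :* (t :* (c :* d)) := c :* (t :* (s :* d))) refl _ _ _ _ ⟩
        φ k (a m) * (σ * u) ∎)

      scaled-det : pow (a m) (2 ℕ.* (q ℕ.^ k) ℕ.* geom q m) * det k M_L ≈ P * (u * u)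
      scaled-det = begin
        pow (a m) (2 ℕ.* (q ℕ.^ k) ℕ.* geom q m) * det k M_L
          ≈⟨ *-cong (trans (pow-≡ (a m) exponents) (pow-+ (a m) (q ℕ.^ k ℕ.* geom q m) (q ℕ.^ k ℕ.* geom q m))) det-M_L ⟩
        (scale * scale) * (P * (δ * δ))
          ≈⟨ solve 3 (λ s p d → (s :* s) :* (p :* (d :* d)) := p :* ((s :* d) :* (s :* d))) refl scale P δ ⟩
        P * (u * u) ∎
        where
        open +-*-Solver renaming (solve to solve′; _:+_ to _:+′_; _:*_ to _:*′_; _:=_ to _:=′_; con to con′)
        exponents : 2 ℕ.* (q ℕ.^ k) ℕ.* geom q m ≡ q ℕ.^ k ℕ.* geom q m ℕ.+ q ℕ.^ k ℕ.* geom q m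
        exponents = solve′ 2 (λ p g → con′ 2 :*′ p :*′ g :=′ p :*′ g :+′ p :*′ g) ≡.refl (q ℕ.^ k) (geom q m)

      sparse : let x = pow (a m) (2 ℕ.* (q ℕ.^ k) ℕ.* geom q m) * det k M_L in
        InFq x × (η P ≈ σ * η x)
      sparse = InFq-resp (sym scaled-det) (InFq-twisted u≉0 (-1^-square (n ℕ.∸ 1)) u^q P∈) ,
        trans (η-twisted u≉0 (-1^-square (n ℕ.∸ 1)) u^q P) (*-congˡ (pow-cong ((q ℕ.∸ 1) ℕ./ 2) (sym scaled-det)))

    -- The rank `r` and the number `k` of diagonal entries have different sources. Keeping `r` a
    -- variable lets `≡.refl` identify them.
    conclusion : ∀ r → k ≡ r → 0 ℕ.< r → ∀ {ε} → ε ≈ η P →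
      (r ≡ n → InFq (det n M_L) × (ε ≈ (pow (- 1#) (n ℕ.∸ 1) * η (det n M_L)))) ×
      (r ℕ.< n →
        ¬ (det r M_L ≈ 0#) ×
        (pow (det r M_L) (q ℕ.+ 1) ≈ pow (det r (dropRow M_L)) 2) ×
        ((ε ≈ 1# → pow (det r M_L) ((q ℕ.+ 1) ℕ./ 2) ≈ det r (dropRow M_L)) ×
         (pow (det r M_L) ((q ℕ.+ 1) ℕ./ 2) ≈ det r (dropRow M_L) → ε ≈ 1#)) ×
        (n ℕ.% 2 ≡ 1 → (ε ≈ 1# → IsSquare (det r M_L)) × (IsSquare (det r M_L) → ε ≈ 1#)) ×
        ((m : ℕ) → r ≡ n ℕ.∸ (2 ℕ.* m) → ¬ (a m ≈ 0#) → (∀ i → m ℕ.< i → a i ≈ 0#) →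
          InFq (pow (a m) (2 ℕ.* (q ℕ.^ r) ℕ.* geom q m) * det r M_L) ×
          (ε ≈ (pow (- 1#) (n ℕ.∸ 1) * η (pow (a m) (2 ℕ.* (q ℕ.^ r) ℕ.* geom q m) * det r M_L)))))
    conclusion r ≡.refl 0<k ε≈ =
      (λ k≡n → proj₁ (fullRank k≡n) , trans ε≈ (proj₂ (fullRank k≡n))) ,
      (λ k<n →
        det-M_L≉0 , det-pow-q+1 k<n ,
        ((λ ε≈1 → proj₁ (η≈1⇔ k<n) (trans (sym ε≈) ε≈1)) , (λ eq → trans ε≈ (proj₂ (η≈1⇔ k<n) eq))) ,
        (λ n-odd → (λ ε≈1 → η≈1⇒square (trans (sym ε≈) ε≈1)) , (λ square → trans ε≈ (square⇒η≈1 n-odd square))) ,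
        (λ m k≡ aₘ≉0 a≈0 → let open Sparse 0<k k<n m (n-split m k≡) aₘ≉0 a≈0 in
          proj₁ sparse , trans ε≈ (proj₂ sparse)))
      where
      n-split : ∀ m → k ≡ n ℕ.∸ (2 ℕ.* m) → n ≡ m ℕ.+ (m ℕ.+ k)
      n-split m k≡ = ≡.sym (≡.trans (≡.sym (ℕₚ.+-assoc m m k))
        (≡.trans (≡.cong (λ t → m ℕ.+ t ℕ.+ k) (≡.sym (ℕₚ.+-identityʳ m)))
        (≡.trans (≡.cong (2 ℕ.* m ℕ.+_) k≡) (ℕₚ.m+[n∸m]≡n 2m≤n))))
        where
        -- A positive `k` excludes truncation in `n ∸ 2 * m`.
        2m≤n : 2 ℕ.* m ℕ.≤ n
        2m≤n = ℕₚ.<⇒≤ (ℕₚ.m∸n≢0⇒n<m (λ eq → ℕₚ.<⇒≢ 0<k (≡.sym (≡.trans k≡ eq))))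

theorem2p2 : (F : FiniteField) (q n : ℕ) (a : ℕ → FiniteField.Carrier F) →
    let open FiniteField F
        open Setup F q n a
    in IsPrimePower q → q ℕ.% 2 ≡ 1 → 1 ℕ.< n → size ≡ q ℕ.^ n →
       (∀ i → n ℕ.≤ i → a i ≈ 0#) →
       (∃ λ i → i ℕ.< n × ¬ (a i ≈ 0#)) →
       (r : ℕ) → 0 ℕ.< r → r ℕ.≤ n → DimImL r →
       (ε : Carrier) → IsInvariant ε →
       (r ≡ n → InFq (det n M_L) × (ε ≈ (pow (- 1#) (n ℕ.∸ 1) * η (det n M_L)))) ×
       (r ℕ.< n →
         ¬ (det r M_L ≈ 0#) ×
         (pow (det r M_L) (q ℕ.+ 1) ≈ pow (det r (dropRow M_L)) 2) ×
         ((ε ≈ 1# → pow (det r M_L) ((q ℕ.+ 1) ℕ./ 2) ≈ det r (dropRow M_L)) ×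
          (pow (det r M_L) ((q ℕ.+ 1) ℕ./ 2) ≈ det r (dropRow M_L) → ε ≈ 1#)) ×
         (n ℕ.% 2 ≡ 1 → (ε ≈ 1# → IsSquare (det r M_L)) × (IsSquare (det r M_L) → ε ≈ 1#)) ×
         ((m : ℕ) → r ≡ n ℕ.∸ (2 ℕ.* m) → ¬ (a m ≈ 0#) → (∀ i → m ℕ.< i → a i ≈ 0#) →
           InFq (pow (a m) (2 ℕ.* (q ℕ.^ r) ℕ.* geom q m) * det r M_L) ×
           (ε ≈ (pow (- 1#) (n ℕ.∸ 1) * η (pow (a m) (2 ℕ.* (q ℕ.^ r) ℕ.* geom q m) * det r M_L)))))
theorem2p2 F q n a primePower q-odd 1<n size≡ _ _ r 0<r _ dim ε
  (e , e-independent , _ , k , k≤n , d , d-unit , diagonal , ε≈) =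
  conclusion r (rank-unique r dim) 0<r ε≈
  where
  open FieldFacts F q n a
  open Invariant F q n a
    -- Since q is odd, h = q / 2 is (q-1)/2; G is (q^n-1)/(q-1).
    (q ℕ./ 2) (odd⇒suc-double q q-odd) (proj₁ (odd-^ (q ℕ./ 2) n))
    (≡.trans size≡ (≡.trans (≡.cong (ℕ._^ n) (odd⇒suc-double q q-odd)) (proj₂ (odd-^ (q ℕ./ 2) n))))
    (frobenius-+ primePower size≡)
    (λ x → FiniteField.trans F (pow-≡ x (≡.sym size≡)) (fermat x))
    (ℕₚ.<-trans (s≤s z≤n) 1<n)
  open Evaluation e e-independent k k≤n d d-unit diagonal
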